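{- Let $A$ be an $r\times r$ indecomposable Cartan matrix of finite type, and let $S$ be a semi-ring which is a sub-semi-ring of some semi-field. Then every $S$-valued frieze pattern and every $S$-valued $\mathbf{Y}$-frieze pattern associated to $A$ is $\mathbf{F}_A$-invariant, i.e. $g(\mathbf{F}_A(i,m))=g(i,m)$ for all $(i,m)\in[1,r]\times\mathbb{Z}$.
   Context: A Cartan matrix $A=(a_{i,j})$ is an integer matrix with $a_{i,i}=2$, $a_{i,j}\le0$ for $i\ne j$, $a_{i,j}=0$ iff $a_{j,i}=0$, symmetrisable; it is of finite type if all its principal minors are positive, and indecomposable if there is no nonempty proper $I\subset[1,r]$ with $a_{i,j}=0$ for all $i\in I$, $j\notin I$. A semi-ring is a set with associative commutative multiplication with identity $1$, associative commutative addition (no zero required), and distributivity; a semi-field is a semi-ring whose multiplication makes it a group. An $S$-valued frieze pattern associated to $A$ is a map $f:[1,r]\times\mathbb{Z}\to S$ with $f(i,m)f(i,m+1)=1+\prod_{j>i} f(j,m)^{ -a_{j,i}}\prod_{j<i}f(j,m+1)^{ -a_{j,i}}$ for all $(i,m)$; an $S$-valued $\mathbf{Y}$-frieze pattern is a map $k$ with $k(i,m)k(i,m+1)=\prod_{j>i}(1+k(j,m))^{ -a_{j,i}}\prod_{j<i}(1+k(j,m+1))^{ -a_{j,i}}$ for all $(i,m)$. Let $\mathbf{h}$ be the Coxeter number of $A$ ($n+1$ for $A_n$; $2n$ for $B_n,C_n$; $2n-2$ for $D_n$; $12,18,30,12,6$ for $E_6,E_7,E_8,F_4,G_2$). If $A$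 is of type $A_1$, $B_n$, $C_n$, $D_{2n}$ ($n\ge2$), $E_7$, $E_8$, $F_4$ or $G_2$, set $i^*=i$ and $m_i=\mathbf{h}/2$ for all $i$. If $A$ is of type $A_n$ ($n\ge2$), $D_{2n+1}$ ($n\ge2$) or $E_6$, let $Q$ be the quiver with vertices $[1,r]$ and an arrow $i\to j$ iff $i<j$ and $a_{i,j}=-1$; let $i\mapsto i^*$ be the permutation of $[1,r]$ induced by the unique nontrivial automorphism of the Dynkin diagram; for $i=i^*$ put $a_i=b_i=0$, and otherwise let $a_i$ (resp. $b_i$) be the number of arrows of $Q$ lying on the unique path in the Dynkin diagram from $i$ to $i^*$ that point towards $i^*$ (resp. towards $i$); set $m_i=\tfrac12(\mathbf{h}+a_i-b_i)$. Define the bijection $\mathbf{F}_A:[1,r]\times\mathbb{Z}\to[1,r]\times\mathbb{Z}$, $\mathbf{F}_A(i,m)=(i^*,m+m_{i^*}+1)$. -}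

module Defs where

open import Level using (Level; _⊔_)
open import Data.Bool using (Bool; true; false; if_then_else_; _∧_; _∨_; not)
open import Data.Nat as ℕ using (ℕ; zero; suc; _≡ᵇ_; _<ᵇ_; _∸_; _/_)
open import Data.Integer as ℤ using (ℤ; +_; -[1+_]; ∣_∣)
open import Data.Fin as Fin using (Fin; zero; suc; toℕ; opposite; punchIn; #_)
open import Data.List as List using (List; []; _∷_; filterᵇ; reverse; zip; drop; length; allFin)
open import Data.Vec as Vec using (Vec; []; _∷_)
open import Data.Product using (Σ; ∃; _×_; _,_; proj₁; proj₂)
open import Relation.Nullary using (¬_)
open import Relation.Nullary.Decidable using (⌊_⌋)
open import Relation.Binary.PropositionalEquality using (_≡_)
open import Function.Bundles using (_↔_; Inverse)

Matrix : ℕ → Set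
Matrix r = Fin r → Fin r → ℤ

∑ : ∀ {n} → (Fin n → ℤ) → ℤ
∑ {zero}  f = + 0
∑ {suc n} f = f zero ℤ.+ ∑ (λ j → f (suc j))

det : ∀ {n} → Matrix n → ℤ
det {zero}  M = + 1
det {suc n} M = ∑ (λ j → ((-[1+ 0 ]) ℤ.^ toℕ j) ℤ.* (M zero j ℤ.* det (λ a b → M (suc a) (punchIn j b))))

record IsCartanMatrix {r : ℕ} (A : Matrix r) : Set where
  field
    diag       : ∀ i → A i i ≡ + 2
    offdiag≤0  : ∀ i j → ¬ (i ≡ j) → A i j ℤ.≤ + 0
    zero-sym   : ∀ i j → A i j ≡ + 0 → A j i ≡ + 0
    symmetrisable : Σ (Fin r → ℕ) λ d → (∀ i → 0 ℕ.< d i) ×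
                      (∀ i j → (+ d i) ℤ.* A i j ≡ (+ d j) ℤ.* A j i)

StrictlyIncreasing : ∀ {k r} → (Fin k → Fin r) → Set
StrictlyIncreasing σ = ∀ a b → a Fin.< b → σ a Fin.< σ b

FiniteType : ∀ {r} → Matrix r → Set
FiniteType {r} A = ∀ k (σ : Fin k → Fin r) → StrictlyIncreasing σ →
                   + 0 ℤ.< det (λ a b → A (σ a) (σ b))

Indecomposable : ∀ {r} → Matrix r → Set
Indecomposable {r} A =
  ¬ (Σ (Fin r → Bool) λ I → (∃ λ i → I i ≡ true) × (∃ λ j → I j ≡ false) ×
       (∀ i j → I i ≡ true → I j ≡ false → A i j ≡ + 0))

-- Dynkin types with a fixed standard labelling (0-based) of the vertices.
--   𝔸 k : type A_(k+1)     𝔹 k : type B_(k+2)     ℂ k : type C_(k+2)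
--   𝔻 k : type D_(k+4)     E₆ E₇ E₈ F₄ G₂

data DynkinType : Set where
  𝔸 𝔹 ℂ 𝔻 : ℕ → DynkinType
  E₆ E₇ E₈ F₄ G₂ : DynkinType

rank : DynkinType → ℕ
rank (𝔸 k) = suc k
rank (𝔹 k) = suc (suc k)
rank (ℂ k) = suc (suc k)
rank (𝔻 k) = 4 ℕ.+ k
rank E₆ = 6
rank E₇ = 7
rank E₈ = 8
rank F₄ = 4
rank G₂ = 2

coxeter : DynkinType → ℕ
coxeter t@(𝔸 k) = suc (rank t)
coxeter t@(𝔹 k) = 2 ℕ.* rank t
coxeter t@(ℂ k) = 2 ℕ.* rank t
coxeter t@(𝔻 k) = 2 ℕ.* rank t ∸ 2
coxeter E₆ = 12
coxeter E₇ = 18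
coxeter E₈ = 30
coxeter F₄ = 12
coxeter G₂ = 6

-1ℤ -2ℤ -3ℤ : ℤ
-1ℤ = -[1+ 0 ]
-2ℤ = -[1+ 1 ]
-3ℤ = -[1+ 2 ]

chainEdge : ℕ → ℕ → Bool
chainEdge i j = (suc i ≡ᵇ j) ∨ (suc j ≡ᵇ i)

-- D_n labelling: leaves 0 and 1 attached to 2, then chain 2 - 3 - ... - (n-1)
dEdge : ℕ → ℕ → Bool
dEdge 0 2 = true
dEdge 2 0 = true
dEdge 1 2 = true
dEdge 2 1 = true
dEdge 0 _ = false
dEdge _ 0 = false
dEdge 1 _ = false
dEdge _ 1 = false
dEdge i j = chainEdge i j

-- E_n (Bourbaki, 0-based): chain 0 - 2 - 3 - 4 - 5 - 6 - 7, and 1 attached to 3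
eEdge' : ℕ → ℕ → Bool
eEdge' 0 2 = true
eEdge' 2 3 = true
eEdge' 3 4 = true
eEdge' 4 5 = true
eEdge' 5 6 = true
eEdge' 6 7 = true
eEdge' 1 3 = true
eEdge' _ _ = false

eEdge : ℕ → ℕ → Bool
eEdge i j = eEdge' i j ∨ eEdge' j i

edgeVal : Bool → ℤ
edgeVal true  = -1ℤ
edgeVal false = + 0

offDiag : DynkinType → ℕ → ℕ → ℤ
offDiag (𝔸 k) i j = edgeVal (chainEdge i j)
offDiag (𝔹 k) 0 1 = -2ℤ
offDiag (𝔹 k) i j = edgeVal (chainEdge i j)
offDiag (ℂ k) 1 0 = -2ℤ
offDiag (ℂ k) i j = edgeVal (chainEdge i j)
offDiag (𝔻 k) i j = edgeVal (dEdge i j)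
offDiag E₆ i j = edgeVal (eEdge i j)
offDiag E₇ i j = edgeVal (eEdge i j)
offDiag E₈ i j = edgeVal (eEdge i j)
offDiag F₄ 1 2 = -2ℤ
offDiag F₄ i j = edgeVal (chainEdge i j)
offDiag G₂ 0 1 = -1ℤ
offDiag G₂ 1 0 = -3ℤ
offDiag G₂ i j = + 0

stdCartan : (t : DynkinType) → Matrix (rank t)
stdCartan t i j = if toℕ i ≡ᵇ toℕ j then + 2 else offDiag t (toℕ i) (toℕ j)

swap01 : ∀ {n} → Fin (suc (suc n)) → Fin (suc (suc n))
swap01 zero = suc zero
swap01 (suc zero) = zero
swap01 i = i

isOdd : ℕ → Bool
isOdd zero = false
isOdd (suc n) = not (isOdd n)

-- the involution i ↦ i* in the standard labelling: the nontrivial diagram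
-- automorphism for A_n (n ≥ 2), D_(2n+1), E₆, and the identity otherwise
star : (t : DynkinType) → Fin (rank t) → Fin (rank t)
star (𝔸 k) i = opposite i
star (𝔻 k) i = if isOdd k then swap01 i else i      -- rank = k+4 is odd iff k is odd
star E₆ i = Vec.lookup (# 5 ∷ # 1 ∷ # 4 ∷ # 3 ∷ # 2 ∷ # 0 ∷ []) i
star _ i = i

-- the (unique) path in the Dynkin diagram from i to i*, as a list of vertices
path : (t : DynkinType) → Fin (rank t) → List (Fin (rank t))
path (𝔸 k) i =
  if toℕ (opposite i) <ᵇ toℕ i then reverse segment else segment
  where
    lo hi : ℕ
    lo = ℕ._⊓_ (toℕ i) (toℕ (opposite i))
    hi = ℕ._⊔_ (toℕ i) (toℕ (opposite i))
    segment : List (Fin (suc k))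
    segment = filterᵇ (λ j → ((lo ≡ᵇ toℕ j) ∨ (lo <ᵇ toℕ j)) ∧ ((toℕ j ≡ᵇ hi) ∨ (toℕ j <ᵇ hi))) (allFin (suc k))
path (𝔻 k) zero = if isOdd k then zero ∷ suc (suc zero) ∷ suc zero ∷ [] else zero ∷ []
path (𝔻 k) (suc zero) = if isOdd k then suc zero ∷ suc (suc zero) ∷ zero ∷ [] else suc zero ∷ []
path E₆ i = Vec.lookup ( (# 0 ∷ # 2 ∷ # 3 ∷ # 4 ∷ # 5 ∷ [])
                       ∷ (# 1 ∷ [])
                       ∷ (# 2 ∷ # 3 ∷ # 4 ∷ [])
                       ∷ (# 3 ∷ [])
                       ∷ (# 4 ∷ # 3 ∷ # 2 ∷ [])
                       ∷ (# 5 ∷ # 4 ∷ # 3 ∷ # 2 ∷ # 0 ∷ [])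
                       ∷ []) i
path _ i = i ∷ []

-- The map F_A, given an identification e of [1,r] with the standard labelling
-- of a Dynkin type t such that A i j = stdCartan t (e i) (e j).

module _ {r : ℕ} (A : Matrix r) (t : DynkinType) (e : Fin r ↔ Fin (rank t)) where
  private
    to   = Inverse.to e
    from = Inverse.from e

  starA : Fin r → Fin r
  starA i = from (star t (to i))

  arrowᵇ : Fin r → Fin r → Bool
  arrowᵇ i j = (toℕ i <ᵇ toℕ j) ∧ ⌊ A i j ℤ.≟ -1ℤ ⌋

  pathEdges : Fin r → List (Fin r × Fin r)
  pathEdges i = let p = List.map from (path t (to i)) in zip p (drop 1 p)

  -- a_i : arrows on the path pointing towards i*;  b_i : towards i
  aᵢ bᵢ : Fin r → ℕ
  aᵢ i = length (filterᵇ (λ uv → arrowᵇ (proj₁ uv) (proj₂ uv)) (pathEdges i))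
  bᵢ i = length (filterᵇ (λ uv → arrowᵇ (proj₂ uv) (proj₁ uv)) (pathEdges i))

  -- m_i = (h + a_i - b_i) / 2   (h + a_i - b_i is always a nonnegative even number)
  mᵢ : Fin r → ℕ
  mᵢ i = (coxeter t ℕ.+ aᵢ i ∸ bᵢ i) / 2

  F : Fin r × ℤ → Fin r × ℤ
  F (i , m) = starA i , (m ℤ.+ + mᵢ (starA i)) ℤ.+ + 1

record SemiField (c : Level) : Set (Level.suc c) where
  infixl 7 _*_
  infixl 6 _+_
  field
    Carrier : Set c
    _+_ _*_ : Carrier → Carrier → Carrier
    1#      : Carrier
    _⁻¹     : Carrier → Carrier
    *-assoc    : ∀ x y z → (x * y) * z ≡ x * (y * z)
    *-comm     : ∀ x y → x * y ≡ y * x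
    *-identityˡ : ∀ x → 1# * x ≡ x
    +-assoc    : ∀ x y z → (x + y) + z ≡ x + (y + z)
    +-comm     : ∀ x y → x + y ≡ y + x
    distribˡ   : ∀ x y z → x * (y + z) ≡ x * y + x * z
    inverseˡ   : ∀ x → x ⁻¹ * x ≡ 1#

record IsSubSemiring {c ℓ} (K : SemiField c) (S : SemiField.Carrier K → Set ℓ) : Set (c ⊔ ℓ) where
  open SemiField K
  field
    1∈S : S 1#
    +-closed : ∀ {x y} → S x → S y → S (x + y)
    *-closed : ∀ {x y} → S x → S y → S (x * y)

module _ {c} (K : SemiField c) where
  open SemiField K

  _^_ : Carrier → ℕ → Carrier
  x ^ zero  = 1#
  x ^ suc n = x * (x ^ n)

  ∏ : ∀ {n} → (Fin n → Carrier) → Carrier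
  ∏ {zero}  f = 1#
  ∏ {suc n} f = f zero * ∏ (λ j → f (suc j))

  -- the factor for j in  ∏_{j>i} X j ^ (-a(j,i)) ∏_{j<i} Y j ^ (-a(j,i))
  splitFactor : ∀ {r} → Matrix r → Fin r → (Fin r → Carrier) → (Fin r → Carrier) → Fin r → Carrier
  splitFactor A i X Y j =
    if toℕ i <ᵇ toℕ j then X j ^ ∣ A j i ∣
    else if toℕ j <ᵇ toℕ i then Y j ^ ∣ A j i ∣
    else 1#

  IsFrieze : ∀ {r} → Matrix r → (Fin r → ℤ → Carrier) → Set c
  IsFrieze A f = ∀ i m → f i m * f i (m ℤ.+ + 1)
    ≡ 1# + ∏ (splitFactor A i (λ j → f j m) (λ j → f j (m ℤ.+ + 1)))

  IsYFrieze : ∀ {r} → Matrix r → (Fin r → ℤ → Carrier) → Set c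
  IsYFrieze A k = ∀ i m → k i m * k i (m ℤ.+ + 1)
    ≡ ∏ (splitFactor A i (λ j → 1# + k j m) (λ j → 1# + k j (m ℤ.+ + 1)))

  SValued : ∀ {ℓ r} → (Carrier → Set ℓ) → (Fin r → ℤ → Carrier) → Set ℓ
  SValued S g = ∀ i m → S (g i m)

Invariant : ∀ {a r} {X : Set a} → (Fin r × ℤ → Fin r × ℤ) → (Fin r → ℤ → X) → Set a
Invariant Φ g = ∀ i m → g (proj₁ (Φ (i , m))) (proj₂ (Φ (i , m))) ≡ g i m

{-# OPTIONS --safe #-}

-- A labelling of the diagram only shifts the entries of each vertex in time, so one may choose the orientation
-- in which the relations are solved; the shift by half the Coxeter number and the numbers a_i, b_i then come from
-- the height difference along the path from i* to i. The types B, C, F₄ and G₂ are folded from D, A, E₆ and D₄.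
-- For A_n and D_n the entries are given by explicit subtraction-free formulas: λ-lengths of arcs (for Y-friezes,
-- cross ratios) in a polygon, once punctured for D_n, on which the translation acts by rotation.
-- For E₆, E₇ and E₈ the relations are cluster mutations. Going backwards from one slice to the preceding one takes
-- r mutations, one at each vertex; expanding pentagons (two mutations into three) as often as possible
-- turns this sequence into one which runs forwards through all the remaining entries. Pentagons and commutations
-- are identities in every semifield, so the forward sequence ends in the same slice up to i ↦ i*.
module Submission where

open import Defs
open import Algebra.Bundles using (CommutativeMonoid; CommutativeSemiring)
import Algebra.Properties.CommutativeMonoid.Sum as Sum
import Algebra.Solver.Ring.NaturalCoefficients.Default as NatCoeffSolver
open import Algebra.Structures using (IsCommutativeMonoid)
import Algebra.Structures.Biased as Biased
open import Data.Bool using (Bool; true; false; if_then_else_; _∧_; _∨_; not)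
import Data.Bool.Properties as Bool
open import Data.Fin as Fin using (Fin; zero; suc; toℕ; #_; opposite; fromℕ<)
import Data.Fin.Properties as Fin
open import Data.Fin.Properties using (_≟_)
open import Data.Integer as ℤ using (ℤ; ∣_∣)
import Data.Integer.Properties as ℤ
open import Data.List as List using (List; []; _∷_)
import Data.List.Properties as List
open import Data.List.Relation.Unary.All using (All; []; _∷_)
open import Data.Maybe using (Maybe; just; nothing)
open import Data.Maybe.Properties using (just-injective)
open import Data.Nat as ℕ using (ℕ; zero; suc)
open import Data.Nat.Divisibility using (divides)
import Data.Nat.DivMod as ℕ
import Data.Nat.Properties as ℕ
import Data.Nat.Solver as ℕSolver
open import Data.Product using (∃; _×_; _,_; proj₁; proj₂)
open import Data.Sum using (_⊎_; inj₁; inj₂)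
open import Data.Vec as Vec using (Vec; []; _∷_)
open import Data.Vec.Properties using (lookup∘tabulate; lookup∘updateAt; lookup∘updateAt′; lookup-replicate)
open import Function using (id)
open import Function.Bundles using (_↔_; Inverse; Equivalence; mk↔ₛ′)
open import Function.Construct.Symmetry using (↔-sym)
open import Relation.Binary.Definitions using (tri<; tri≈; tri>)
open import Relation.Binary.PropositionalEquality
  using (_≡_; _≢_; refl; sym; trans; cong; cong₂; subst; subst₂; ≢-sym; isEquivalence; module ≡-Reasoning)
open import Relation.Nullary using (yes; no; contradiction)
open import Relation.Nullary.Decidable using (⌊_⌋)

-- Semifields

-- Nothing can be subtracted in a semifield, and the Laurent polynomials of E₈ are too large to
-- expand, so the E types are reduced to a finite check on matrices of signs. The backward sequence
-- has r mutations, the forward one r h / 2, as many as there are positive roots (36, 63 and 120). A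
-- pentagon lengthens a sequence by one, so r (h - 2) / 2 pentagons are needed, and the forward
-- sequence makes h / 2 rounds. With the one slice travelled backwards this gives the total shift h
-- / 2 + 1. The list of moves does not depend on what is being mutated. It is checked once and then
-- serves cluster variables (friezes) as well as coefficients (Y-friezes); for each of these only
-- commutation and the pentagon have to be proved. The infinite families A and D call for formulas
-- uniform in the rank.

module SemiFieldProperties {c} (K : SemiField c) where
  open SemiField K
  open ≡-Reasoning

  *-identityʳ : ∀ x → x * 1# ≡ x
  *-identityʳ x = trans (*-comm x 1#) (*-identityˡ x)

  inverseʳ : ∀ x → x * x ⁻¹ ≡ 1#
  inverseʳ x = trans (*-comm x (x ⁻¹)) (inverseˡ x)

  *-cancelˡ : ∀ x {y z} → x * y ≡ x * z → y ≡ z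
  *-cancelˡ x {y} {z} eq = begin
    y              ≡⟨ lemma y ⟨
    x ⁻¹ * (x * y) ≡⟨ cong (x ⁻¹ *_) eq ⟩
    x ⁻¹ * (x * z) ≡⟨ lemma z ⟩
    z              ∎
    where
    lemma : ∀ w → x ⁻¹ * (x * w) ≡ w
    lemma w = begin
      x ⁻¹ * (x * w) ≡⟨ *-assoc _ _ _ ⟨
      (x ⁻¹ * x) * w ≡⟨ cong (_* w) (inverseˡ x) ⟩
      1# * w         ≡⟨ *-identityˡ w ⟩
      w              ∎

  ⁻¹-unique : ∀ {x y} → x * y ≡ 1# → y ≡ x ⁻¹
  ⁻¹-unique {x} eq = *-cancelˡ x (trans eq (sym (inverseʳ x)))

  ⁻¹-involutive : ∀ x → (x ⁻¹) ⁻¹ ≡ x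
  ⁻¹-involutive x = sym (⁻¹-unique (inverseˡ x))

  ⁻¹-injective : ∀ {x y} → x ⁻¹ ≡ y ⁻¹ → x ≡ y
  ⁻¹-injective {x} {y} eq = trans (sym (⁻¹-involutive x)) (trans (cong _⁻¹ eq) (⁻¹-involutive y))

  infixl 7 _÷_
  _÷_ : Carrier → Carrier → Carrier
  x ÷ y = x * y ⁻¹

  ÷-* : ∀ x y → y * (x ÷ y) ≡ x
  ÷-* x y = begin
    y * (x * y ⁻¹) ≡⟨ *-comm y _ ⟩
    x * y ⁻¹ * y   ≡⟨ *-assoc _ _ _ ⟩
    x * (y ⁻¹ * y) ≡⟨ cong (x *_) (inverseˡ y) ⟩
    x * 1#         ≡⟨ *-identityʳ x ⟩
    x              ∎

  ÷-unique : ∀ {x y z} → y * z ≡ x → z ≡ x ÷ y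
  ÷-unique {x} {y} eq = *-cancelˡ y (trans eq (sym (÷-* x y)))

  *-isCommutativeMonoid : IsCommutativeMonoid _≡_ _*_ 1#
  *-isCommutativeMonoid = record
    { isMonoid = record
      { isSemigroup = record
        { isMagma = record { isEquivalence = isEquivalence ; ∙-cong = cong₂ _*_ }
        ; assoc = *-assoc }
      ; identity = *-identityˡ , *-identityʳ }
    ; comm = *-comm }

  *-commutativeMonoid : CommutativeMonoid c c
  *-commutativeMonoid = record { isCommutativeMonoid = *-isCommutativeMonoid }

  -- A semifield has no zero; adjoining one turns it into a commutative semiring, so that the semiring
  -- solver applies.
  private
    K₀ : Set c
    K₀ = Maybe Carrier

    _⊞_ _⊠_ : K₀ → K₀ → K₀
    just x ⊞ just y = just (x + y)
    just x ⊞ nothing = just x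
    nothing ⊞ y = y
    just x ⊠ just y = just (x * y)
    just x ⊠ nothing = nothing
    nothing ⊠ y = nothing

    ⊞-assoc : ∀ x y z → (x ⊞ y) ⊞ z ≡ x ⊞ (y ⊞ z)
    ⊞-assoc (just x) (just y) (just z) = cong just (+-assoc x y z)
    ⊞-assoc (just x) (just y) nothing = refl
    ⊞-assoc (just x) nothing z = refl
    ⊞-assoc nothing y z = refl

    ⊞-comm : ∀ x y → x ⊞ y ≡ y ⊞ x
    ⊞-comm (just x) (just y) = cong just (+-comm x y)
    ⊞-comm (just x) nothing = refl
    ⊞-comm nothing (just y) = refl
    ⊞-comm nothing nothing = refl

    ⊞-identityʳ : ∀ x → x ⊞ nothing ≡ x
    ⊞-identityʳ (just x) = refl
    ⊞-identityʳ nothing = refl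

    ⊠-assoc : ∀ x y z → (x ⊠ y) ⊠ z ≡ x ⊠ (y ⊠ z)
    ⊠-assoc (just x) (just y) (just z) = cong just (*-assoc x y z)
    ⊠-assoc (just x) (just y) nothing = refl
    ⊠-assoc (just x) nothing z = refl
    ⊠-assoc nothing y z = refl

    ⊠-comm : ∀ x y → x ⊠ y ≡ y ⊠ x
    ⊠-comm (just x) (just y) = cong just (*-comm x y)
    ⊠-comm (just x) nothing = refl
    ⊠-comm nothing (just y) = refl
    ⊠-comm nothing nothing = refl

    ⊠-identityˡ : ∀ x → just 1# ⊠ x ≡ x
    ⊠-identityˡ (just x) = cong just (*-identityˡ x)
    ⊠-identityˡ nothing = refl

    ⊠-distribʳ : ∀ x y z → (y ⊞ z) ⊠ x ≡ (y ⊠ x) ⊞ (z ⊠ x)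
    ⊠-distribʳ (just x) (just y) (just z) = cong just
      (trans (*-comm _ x) (trans (distribˡ x y z) (cong₂ _+_ (*-comm x y) (*-comm x z))))
    ⊠-distribʳ (just x) (just y) nothing = refl
    ⊠-distribʳ (just x) nothing z = refl
    ⊠-distribʳ nothing (just y) (just z) = refl
    ⊠-distribʳ nothing (just y) nothing = refl
    ⊠-distribʳ nothing nothing z = refl

    commutativeSemiring₀ : CommutativeSemiring c c
    commutativeSemiring₀ = record
      { Carrier = K₀ ; _≈_ = _≡_ ; _+_ = _⊞_ ; _*_ = _⊠_ ; 0# = nothing ; 1# = just 1#
      ; isCommutativeSemiring = Biased.isCommutativeSemiringˡ (record
        { +-isCommutativeMonoid = record
          { isMonoid = record
            { isSemigroup = record
              { isMagma = record { isEquivalence = isEquivalence ; ∙-cong = cong₂ _⊞_ }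
              ; assoc = ⊞-assoc }
            ; identity = (λ _ → refl) , ⊞-identityʳ }
          ; comm = ⊞-comm }
        ; *-isCommutativeMonoid = record
          { isMonoid = record
            { isSemigroup = record
              { isMagma = record { isEquivalence = isEquivalence ; ∙-cong = cong₂ _⊠_ }
              ; assoc = ⊠-assoc }
            ; identity = ⊠-identityˡ , (λ x → trans (⊠-comm x (just 1#)) (⊠-identityˡ x)) }
          ; comm = ⊠-comm }
        ; distribʳ = ⊠-distribʳ
        ; zeroˡ = λ _ → refl }) }

  open NatCoeffSolver commutativeSemiring₀ public using (solve; _:*_; _:+_; _:=_; con)

  open Sum *-commutativeMonoid using (sum; sum-permute; sum-cong-≗; ∑-distrib-+)

  ∏≡sum : ∀ {n} (f : Fin n → Carrier) → ∏ K f ≡ sum f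
  ∏≡sum {zero}  f = refl
  ∏≡sum {suc n} f = cong (f zero *_) (∏≡sum (λ j → f (suc j)))

  ∏-cong : ∀ {n} {f g : Fin n → Carrier} → (∀ i → f i ≡ g i) → ∏ K f ≡ ∏ K g
  ∏-cong {zero}  eq = refl
  ∏-cong {suc n} eq = cong₂ _*_ (eq zero) (∏-cong (λ j → eq (suc j)))

  ∏-distrib-* : ∀ {n} (f g : Fin n → Carrier) → ∏ K (λ i → f i * g i) ≡ ∏ K f * ∏ K g
  ∏-distrib-* f g = trans (∏≡sum (λ i → f i * g i))
    (trans (∑-distrib-+ f g) (sym (cong₂ _*_ (∏≡sum f) (∏≡sum g))))

  ∏-reindex : ∀ {m n} (e : Fin m ↔ Fin n) (f : Fin n → Carrier) → ∏ K f ≡ ∏ K (λ i → f (Inverse.to e i))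
  ∏-reindex e f = trans (∏≡sum f) (trans (sum-permute f e) (sym (∏≡sum (λ i → f (Inverse.to e i)))))

  ∏-1 : ∀ n → ∏ K {n} (λ _ → 1#) ≡ 1#
  ∏-1 zero    = refl
  ∏-1 (suc n) = trans (*-identityˡ _) (∏-1 n)

  ∏-update : ∀ {n} (i : Fin n) x {f g : Fin n → Carrier} →
             f i ≡ x * g i → (∀ j → j ≢ i → f j ≡ g j) → ∏ K f ≡ x * ∏ K g
  ∏-update zero x {f} {g} fi≡ f≡ = begin
    f zero * ∏ K (λ j → f (suc j))       ≡⟨ cong₂ _*_ fi≡ (∏-cong (λ j → f≡ (suc j) λ ())) ⟩
    x * g zero * ∏ K (λ j → g (suc j))   ≡⟨ *-assoc _ _ _ ⟩
    x * (g zero * ∏ K (λ j → g (suc j))) ∎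
  ∏-update (suc i) x {f} {g} fi≡ f≡ = begin
    f zero * ∏ K (λ j → f (suc j))
      ≡⟨ cong₂ _*_ (f≡ zero λ ())
           (∏-update i x fi≡ (λ j j≢i → f≡ (suc j) (λ { refl → j≢i refl }))) ⟩
    g zero * (x * ∏ K (λ j → g (suc j)))
      ≡⟨ just-injective (solve 3 (λ a b c → a :* (b :* c) := b :* (a :* c)) refl
           (just (g zero)) (just x) (just (∏ K (λ j → g (suc j))))) ⟩
    x * (g zero * ∏ K (λ j → g (suc j))) ∎

  1+-* : ∀ x y → (1# + x) * y ≡ x * y + y
  1+-* x y = just-injective (solve 2 (λ x y → (con 1 :+ x) :* y := x :* y :+ y) refl (just x) (just y))

  -- The induction step for Y-friezes. An equation `g * b ≡ a` stands for the fraction g = a / b;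
  -- once all other terms of a relation are known as fractions, the new entry g' is determined, and
  -- what remains is the last hypothesis, an identity of monomials for the solver.
  quotient-step : ∀ {g g' e₁ e₂ a b a' b' a₁ b₁ a₂ b₂} → g * g' ≡ e₁ * e₂ →
    g * b ≡ a → e₁ * b₁ ≡ a₁ → e₂ * b₂ ≡ a₂ → a * a' * (b₁ * b₂) ≡ b * b' * (a₁ * a₂) → g' * b' ≡ a'
  quotient-step {g} {g'} {e₁} {e₂} {a} {b} {a'} {b'} {a₁} {b₁} {a₂} {b₂} rel refl refl refl eq =
    *-cancelˡ (g * b * (b₁ * b₂)) (begin
      g * b * (b₁ * b₂) * (g' * b')
        ≡⟨ just-injective (solve 6 (λ g g' b b' b₁ b₂ → g :* b :* (b₁ :* b₂) :* (g' :* b') := (g :* g') :* (b :* b' :* (b₁ :* b₂))) refl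
             (just g) (just g') (just b) (just b') (just b₁) (just b₂)) ⟩
      (g * g') * (b * b' * (b₁ * b₂)) ≡⟨ cong (_* (b * b' * (b₁ * b₂))) rel ⟩
      (e₁ * e₂) * (b * b' * (b₁ * b₂))
        ≡⟨ just-injective (solve 6 (λ e₁ e₂ b b' b₁ b₂ → (e₁ :* e₂) :* (b :* b' :* (b₁ :* b₂)) := b :* b' :* (e₁ :* b₁ :* (e₂ :* b₂))) refl
             (just e₁) (just e₂) (just b) (just b') (just b₁) (just b₂)) ⟩
      b * b' * (e₁ * b₁ * (e₂ * b₂)) ≡⟨ eq ⟨
      g * b * a' * (b₁ * b₂)
        ≡⟨ just-injective (solve 3 (λ u a' v → u :* a' :* v := u :* v :* a') refl (just (g * b)) (just a') (just (b₁ * b₂))) ⟩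
      g * b * (b₁ * b₂) * a' ∎)

-- Mutation sequences

∧-split : ∀ {a b} → a ∧ b ≡ true → a ≡ true × b ≡ true
∧-split {true} {true} refl = refl , refl

allᵇ : ∀ {n} → (Fin n → Bool) → Bool
allᵇ {zero}  f = true
allᵇ {suc n} f = f zero ∧ allᵇ (λ i → f (suc i))

allᵇ-sound : ∀ {n} (f : Fin n → Bool) → allᵇ f ≡ true → ∀ i → f i ≡ true
allᵇ-sound f h zero    = proj₁ (∧-split h)
allᵇ-sound f h (suc i) = allᵇ-sound (λ i → f (suc i)) (proj₂ (∧-split {f zero} h)) i

-- Exchange matrices with entries in {-1, 0, 1}, which suffice for the simply laced finite types.

data Sign : Set where
  ⊖ ⊙ ⊕ : Sign

opp : Sign → Sign
opp ⊖ = ⊕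
opp ⊙ = ⊙
opp ⊕ = ⊖

-- s is b i j, p is b i k, q is b k j; a sum outside {-1, 0, 1} is truncated.
mutateEntry : Sign → Sign → Sign → Sign
mutateEntry ⊖ ⊕ ⊕ = ⊙
mutateEntry ⊙ ⊕ ⊕ = ⊕
mutateEntry ⊕ ⊖ ⊖ = ⊙
mutateEntry ⊙ ⊖ ⊖ = ⊖
mutateEntry s p q = s

_==ˢ_ : Sign → Sign → Bool
⊖ ==ˢ ⊖ = true
⊙ ==ˢ ⊙ = true
⊕ ==ˢ ⊕ = true
_ ==ˢ _ = false

==ˢ-sound : ∀ s t → s ==ˢ t ≡ true → s ≡ t
==ˢ-sound ⊖ ⊖ h = refl
==ˢ-sound ⊙ ⊙ h = refl
==ˢ-sound ⊕ ⊕ h = refl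

-- Vectors, so that a mutated matrix is data. With functions, an entry after d mutations would
-- unfold into up to 3^d entries, and the checks by `refl` below perform long mutation sequences.
Exchange : ℕ → Set
Exchange N = Vec (Vec Sign N) N

entry : ∀ {N} → Exchange N → Fin N → Fin N → Sign
entry B i j = Vec.lookup (Vec.lookup B i) j

entry-tabulate : ∀ {N} (f : Fin N → Fin N → Sign) i j →
                 entry (Vec.tabulate λ i → Vec.tabulate λ j → f i j) i j ≡ f i j
entry-tabulate f i j = trans (cong (λ row → Vec.lookup row j) (lookup∘tabulate (λ i → Vec.tabulate (f i)) i))
                             (lookup∘tabulate (f i) j)

mutateEntries : ∀ {N} → Exchange N → Fin N → Fin N → Fin N → Sign
mutateEntries B k i j = if ⌊ i ≟ k ⌋ ∨ ⌊ j ≟ k ⌋ then opp (entry B i j)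
                        else mutateEntry (entry B i j) (entry B i k) (entry B k j)

mutate : ∀ {N} → Exchange N → Fin N → Exchange N
mutate B k = Vec.tabulate λ i → Vec.tabulate λ j → mutateEntries B k i j

entry-mutate : ∀ {N} (B : Exchange N) k i j → entry (mutate B k) i j ≡ mutateEntries B k i j
entry-mutate B k = entry-tabulate (mutateEntries B k)

⌊≟⌋-refl : ∀ {N} (i : Fin N) → ⌊ i ≟ i ⌋ ≡ true
⌊≟⌋-refl i with i ≟ i
... | yes _ = refl
... | no i≢i = contradiction refl i≢i

⌊≟⌋-≢ : ∀ {N} {i j : Fin N} → i ≢ j → ⌊ i ≟ j ⌋ ≡ false
⌊≟⌋-≢ {i = i} {j} i≢j with i ≟ j
... | yes i≡j = contradiction i≡j i≢j
... | no _ = refl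

⌊≟⌋-sound : ∀ {N} {i j : Fin N} → ⌊ i ≟ j ⌋ ≡ true → i ≡ j
⌊≟⌋-sound {i = i} {j} h with i ≟ j
... | yes i≡j = i≡j

Involutive : ∀ {N} → (Fin N → Fin N) → Set
Involutive σ = ∀ i → σ (σ i) ≡ i

⌊≟⌋-involution : ∀ {N} (σ : Fin N → Fin N) → Involutive σ → ∀ i j → ⌊ σ i ≟ σ j ⌋ ≡ ⌊ i ≟ j ⌋
⌊≟⌋-involution σ inv i j with i ≟ j
... | yes refl = ⌊≟⌋-refl (σ i)
... | no i≢j = ⌊≟⌋-≢ λ eq → i≢j (trans (sym (inv i)) (trans (cong σ eq) (inv j)))

transpose : ∀ {N} → Fin N → Fin N → Fin N → Fin N
transpose a b i = if ⌊ i ≟ a ⌋ then b else if ⌊ i ≟ b ⌋ then a else i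

transpose-a : ∀ {N} (a b : Fin N) → transpose a b a ≡ b
transpose-a a b rewrite ⌊≟⌋-refl a = refl

transpose-b : ∀ {N} {a b : Fin N} → a ≢ b → transpose a b b ≡ a
transpose-b {a = a} {b} a≢b rewrite ⌊≟⌋-≢ (λ eq → a≢b (sym eq)) | ⌊≟⌋-refl b = refl

transpose-other : ∀ {N} {a b i : Fin N} → i ≢ a → i ≢ b → transpose a b i ≡ i
transpose-other i≢a i≢b rewrite ⌊≟⌋-≢ i≢a | ⌊≟⌋-≢ i≢b = refl

data Position {N} (a b i : Fin N) : Set where
  at-a  : i ≡ a → Position a b i
  at-b  : i ≡ b → Position a b i
  other : i ≢ a → i ≢ b → Position a b i

position : ∀ {N} (a b i : Fin N) → Position a b i
position a b i with i ≟ a | i ≟ b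
... | yes i≡a | _       = at-a i≡a
... | no  i≢a | yes i≡b = at-b i≡b
... | no  i≢a | no i≢b  = other i≢a i≢b

transpose-involutive : ∀ {N} {a b : Fin N} → a ≢ b → Involutive (transpose a b)
transpose-involutive {a = a} {b} a≢b i with position a b i
... | at-a refl = trans (cong (transpose a b) (transpose-a a b)) (transpose-b a≢b)
... | at-b refl = trans (cong (transpose a b) (transpose-b a≢b)) (transpose-a a b)
... | other i≢a i≢b = trans (cong (transpose a b) (transpose-other i≢a i≢b)) (transpose-other i≢a i≢b)

-- A record, because B and B' could not be inferred from an equation between their entries.
record Related {N} (σ : Fin N → Fin N) (B B' : Exchange N) : Set where
  field
    entry-≡ : ∀ i j → entry B (σ i) (σ j) ≡ entry B' i j
open Related

Related-refl : ∀ {N} (B : Exchange N) → Related (λ i → i) B B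
Related-refl B .entry-≡ i j = refl

mutate-related : ∀ {N} (σ : Fin N → Fin N) → Involutive σ → ∀ {B B'} → Related σ B B' →
                 ∀ k → Related σ (mutate B (σ k)) (mutate B' k)
mutate-related σ inv {B} {B'} rel k .entry-≡ i j = begin
  entry (mutate B (σ k)) (σ i) (σ j) ≡⟨ entry-mutate B (σ k) (σ i) (σ j) ⟩
  mutateEntries B (σ k) (σ i) (σ j)  ≡⟨ lemma ⟩
  mutateEntries B' k i j             ≡⟨ entry-mutate B' k i j ⟨
  entry (mutate B' k) i j            ∎
  where
  open ≡-Reasoning
  lemma : mutateEntries B (σ k) (σ i) (σ j) ≡ mutateEntries B' k i j
  lemma rewrite ⌊≟⌋-involution σ inv i k | ⌊≟⌋-involution σ inv j k
              | entry-≡ rel i j | entry-≡ rel i k | entry-≡ rel k j = refl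

relatedᵇ : ∀ {N} → (Fin N → Fin N) → Exchange N → Exchange N → Bool
relatedᵇ σ B B' = allᵇ λ i → allᵇ λ j → entry B (σ i) (σ j) ==ˢ entry B' i j

relatedᵇ-sound : ∀ {N} (σ : Fin N → Fin N) B B' → relatedᵇ σ B B' ≡ true → Related σ B B'
relatedᵇ-sound σ B B' h .entry-≡ i j = ==ˢ-sound _ _
  (allᵇ-sound (λ j → entry B (σ i) (σ j) ==ˢ entry B' i j)
    (allᵇ-sound (λ i → allᵇ λ j → entry B (σ i) (σ j) ==ˢ entry B' i j) h i) j)

commuteᵇ : ∀ {N} → Exchange N → Fin N → Fin N → Bool
commuteᵇ B a b = not ⌊ a ≟ b ⌋ ∧ ((entry B a b ==ˢ ⊙) ∧ ((entry B b a ==ˢ ⊙)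
                 ∧ relatedᵇ (λ i → i) (mutate (mutate B b) a) (mutate (mutate B a) b)))

-- Truncated entries do not obey the usual laws of matrix mutation: even at unlinked vertices the
-- two orders can give different signs. Hence the agreement of the mutated matrices is part of what
-- is checked, here and in `Pentagon`.
record Commute {N} (B : Exchange N) (a b : Fin N) : Set where
  field
    a≢b : a ≢ b
    ab  : entry B a b ≡ ⊙
    ba  : entry B b a ≡ ⊙
    related : Related (λ i → i) (mutate (mutate B b) a) (mutate (mutate B a) b)

not-⌊≟⌋ : ∀ {N} {i j : Fin N} → not ⌊ i ≟ j ⌋ ≡ true → i ≢ j
not-⌊≟⌋ {i = i} h refl with trans (sym h) (cong not (⌊≟⌋-refl i))
... | ()

commuteᵇ-sound : ∀ {N} (B : Exchange N) a b → commuteᵇ B a b ≡ true → Commute B a b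
commuteᵇ-sound B a b h with ∧-split {not ⌊ a ≟ b ⌋} h
... | h₁ , h' with ∧-split {entry B a b ==ˢ ⊙} h'
... | h₂ , h'' with ∧-split {entry B b a ==ˢ ⊙} h''
... | h₃ , h₄ = record
  { a≢b = not-⌊≟⌋ h₁ ; ab = ==ˢ-sound _ _ h₂ ; ba = ==ˢ-sound _ _ h₃
  ; related = relatedᵇ-sound (λ i → i) _ _ h₄ }

-- The rank three subquivers on b → a and a third vertex k that occur in finite type, given by (b k a, b k b).
data Link : Sign → Sign → Set where
  l⊙⊙ : Link ⊙ ⊙
  l⊕⊙ : Link ⊕ ⊙
  l⊖⊙ : Link ⊖ ⊙
  l⊙⊕ : Link ⊙ ⊕
  l⊙⊖ : Link ⊙ ⊖
  l⊖⊕ : Link ⊖ ⊕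

linkᵇ : Sign → Sign → Bool
linkᵇ ⊖ ⊖ = false
linkᵇ ⊕ ⊕ = false
linkᵇ ⊕ ⊖ = false
linkᵇ _ _ = true

linkᵇ-sound : ∀ p q → linkᵇ p q ≡ true → Link p q
linkᵇ-sound ⊙ ⊙ h = l⊙⊙
linkᵇ-sound ⊕ ⊙ h = l⊕⊙
linkᵇ-sound ⊖ ⊙ h = l⊖⊙
linkᵇ-sound ⊙ ⊕ h = l⊙⊕
linkᵇ-sound ⊙ ⊖ h = l⊙⊖
linkᵇ-sound ⊖ ⊕ h = l⊖⊕

record Pentagon {N} (B : Exchange N) (a b : Fin N) : Set where
  field
    a≢b  : a ≢ b
    aa   : entry B a a ≡ ⊙
    bb   : entry B b b ≡ ⊙
    ab   : entry B a b ≡ ⊖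
    ba   : entry B b a ≡ ⊕
    link : ∀ k → k ≢ a → k ≢ b → Link (entry B k a) (entry B k b)
    related : Related (transpose a b) (mutate (mutate (mutate B b) a) b) (mutate (mutate B a) b)

pentagonᵇ : ∀ {N} → Exchange N → Fin N → Fin N → Bool
pentagonᵇ B a b =
  not ⌊ a ≟ b ⌋ ∧ ((entry B a a ==ˢ ⊙) ∧ ((entry B b b ==ˢ ⊙)
  ∧ ((entry B a b ==ˢ ⊖) ∧ ((entry B b a ==ˢ ⊕)
  ∧ (allᵇ (λ k → ⌊ k ≟ a ⌋ ∨ (⌊ k ≟ b ⌋ ∨ linkᵇ (entry B k a) (entry B k b)))
  ∧ relatedᵇ (transpose a b) (mutate (mutate (mutate B b) a) b) (mutate (mutate B a) b))))))

pentagonᵇ-sound : ∀ {N} (B : Exchange N) a b → pentagonᵇ B a b ≡ true → Pentagon B a b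
pentagonᵇ-sound B a b h with ∧-split {not ⌊ a ≟ b ⌋} h
... | h₁ , h with ∧-split {entry B a a ==ˢ ⊙} h
... | h₂ , h with ∧-split {entry B b b ==ˢ ⊙} h
... | h₃ , h with ∧-split {entry B a b ==ˢ ⊖} h
... | h₄ , h with ∧-split {entry B b a ==ˢ ⊕} h
... | h₅ , h with ∧-split {allᵇ (λ k → ⌊ k ≟ a ⌋ ∨ (⌊ k ≟ b ⌋ ∨ linkᵇ (entry B k a) (entry B k b)))} h
... | h₆ , h₇ = record
  { a≢b = not-⌊≟⌋ h₁ ; aa = ==ˢ-sound _ _ h₂ ; bb = ==ˢ-sound _ _ h₃
  ; ab = ==ˢ-sound _ _ h₄ ; ba = ==ˢ-sound _ _ h₅
  ; link = link ; related = relatedᵇ-sound (transpose a b) _ _ h₇ }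
  where
  link : ∀ k → k ≢ a → k ≢ b → Link (entry B k a) (entry B k b)
  link k k≢a k≢b with allᵇ-sound (λ k → ⌊ k ≟ a ⌋ ∨ (⌊ k ≟ b ⌋ ∨ linkᵇ (entry B k a) (entry B k b))) h₆ k
  ... | h rewrite ⌊≟⌋-≢ k≢a | ⌊≟⌋-≢ k≢b = linkᵇ-sound _ _ h

-- Rewriting of mutation sequences. A pentagon replaces the two mutations at a, b by those at b, a, b, up to
-- exchanging the labels a and b afterwards.

data Move : Set where
  right left commute pentagon : Move

Word : ℕ → Set
Word N = List (Fin N)

record Rewrite (N : ℕ) : Set where
  constructor rewritten
  field
    word  : Word N
    moves : List Move
    perm  : Fin N → Fin N

-- The moves drive a cursor. `right` passes the first letter and rewrites the rest, starting from
-- the mutated matrix, up to the matching `left`; the moves then left over are applied to the whole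
-- word again. That second call works on a computed list, so the recursion is on fuel; since every
-- nested call has used up a move, fuel exceeding the number of moves suffices.
rewriteWord : ∀ {N} → ℕ → Exchange N → Word N → List Move → Maybe (Rewrite N)
rewriteWord zero    B w ms = nothing
rewriteWord (suc n) B w [] = just (rewritten w [] (λ i → i))
rewriteWord (suc n) B w (left ∷ ms) = just (rewritten w ms (λ i → i))
rewriteWord (suc n) B (a ∷ w) (right ∷ ms) with rewriteWord n (mutate B a) w ms
... | nothing = nothing
... | just (rewritten w₁ ms₁ π₁) with rewriteWord n B (a ∷ w₁) ms₁
...   | nothing = nothing
...   | just (rewritten w₂ ms₂ π₂) = just (rewritten w₂ ms₂ (λ i → π₂ (π₁ i)))
rewriteWord (suc n) B (a ∷ b ∷ w) (commute ∷ ms) with commuteᵇ B a b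
... | true  = rewriteWord n B (b ∷ a ∷ w) ms
... | false = nothing
rewriteWord (suc n) B (a ∷ b ∷ w) (pentagon ∷ ms) with pentagonᵇ B a b
... | false = nothing
... | true with rewriteWord n B (b ∷ a ∷ b ∷ List.map (transpose a b) w) ms
...   | nothing = nothing
...   | just (rewritten w₁ ms₁ π₁) = just (rewritten w₁ ms₁ (λ i → π₁ (transpose a b i)))
rewriteWord (suc n) B w ms = nothing

-- Exactly what the soundness of rewriting requires of a mutation rule. Both the exchange relation
-- and the rule for coefficients are instances, so one certificate proves two periodicities.
record Mutation {c} (X : Set c) (N : ℕ) : Set c where
  field
    step : Exchange N → Fin N → (Fin N → X) → Fin N → X
    step-related : ∀ (σ : Fin N → Fin N) → Involutive σ → ∀ {B B'} → Related σ B B' →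
      ∀ {x x'} → (∀ i → x (σ i) ≡ x' i) → ∀ k i → step B (σ k) x (σ i) ≡ step B' k x' i
    step-commute : ∀ {B a b} → Commute B a b → ∀ x i →
      step (mutate B a) b (step B a x) i ≡ step (mutate B b) a (step B b x) i
    step-pentagon : ∀ {B a b} → Pentagon B a b → ∀ x i →
      step (mutate (mutate B b) a) b (step (mutate B b) a (step B b x)) (transpose a b i)
        ≡ step (mutate B a) b (step B a x) i

module _ {c} {X : Set c} {N : ℕ} (M : Mutation X N) where
  open Mutation M

  run : Exchange N → Word N → (Fin N → X) → Fin N → X
  run B []      x = x
  run B (k ∷ w) x = run (mutate B k) w (step B k x)

  run-related : ∀ (σ : Fin N → Fin N) → Involutive σ → ∀ w {B B'} → Related σ B B' →
    ∀ {x x'} → (∀ i → x (σ i) ≡ x' i) → ∀ i → run B (List.map σ w) x (σ i) ≡ run B' w x' i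
  run-related σ inv []      rel x≡ i = x≡ i
  run-related σ inv (k ∷ w) rel x≡ i =
    run-related σ inv w (mutate-related σ inv rel k) (step-related σ inv rel x≡ k) i

  run-cong : ∀ w {B B'} → Related (λ i → i) B B' → ∀ {x x'} → (∀ i → x i ≡ x' i) →
    ∀ i → run B w x i ≡ run B' w x' i
  run-cong w {B} rel {x} x≡ i =
    trans (cong (λ w → run B w x i) (sym (List.map-id w))) (run-related (λ i → i) (λ _ → refl) w rel x≡ i)

  rewriteWord-sound : ∀ n B w ms {w' ms' π} → rewriteWord n B w ms ≡ just (rewritten w' ms' π) →
    ∀ x i → run B w x i ≡ run B w' x (π i)
  rewriteWord-sound (suc n) B w [] refl x i = refl
  rewriteWord-sound (suc n) B w (left ∷ ms) refl x i = refl
  rewriteWord-sound (suc n) B (a ∷ w) (right ∷ ms) eq x i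
    with rewriteWord n (mutate B a) w ms in eq₁
  ... | just (rewritten w₁ ms₁ π₁) with rewriteWord n B (a ∷ w₁) ms₁ in eq₂
  rewriteWord-sound (suc n) B (a ∷ w) (right ∷ ms) refl x i | just (rewritten w₁ ms₁ π₁) | just (rewritten w₂ ms₂ π₂) =
    trans (rewriteWord-sound n (mutate B a) w ms eq₁ (step B a x) i)
          (rewriteWord-sound n B (a ∷ w₁) ms₁ eq₂ x (π₁ i))
  rewriteWord-sound (suc n) B (a ∷ b ∷ w) (commute ∷ ms) eq x i with commuteᵇ B a b in ok
  ... | true = trans
    (run-cong w (record { entry-≡ = λ i j → sym (entry-≡ (Commute.related comm) i j) }) (step-commute comm x) i)
    (rewriteWord-sound n B (b ∷ a ∷ w) ms eq x i)
    where comm = commuteᵇ-sound B a b ok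
  rewriteWord-sound (suc n) B (a ∷ b ∷ w) (pentagon ∷ ms) eq x i with pentagonᵇ B a b in ok
  ... | true with rewriteWord n B (b ∷ a ∷ b ∷ List.map (transpose a b) w) ms in eq₁
  rewriteWord-sound (suc n) B (a ∷ b ∷ w) (pentagon ∷ ms) refl x i | true | just (rewritten w₁ ms₁ π₁) = trans
    -- The two sides of a pentagon agree only after a and b are exchanged, so the rest of the word
    -- runs with its letters exchanged too.
    (sym (run-related (transpose a b) (transpose-involutive (Pentagon.a≢b pent)) w
      (Pentagon.related pent) (step-pentagon pent x) i))
    (rewriteWord-sound n B (b ∷ a ∷ b ∷ List.map (transpose a b) w) ms eq₁ x (transpose a b i))
    where pent = pentagonᵇ-sound B a b ok

-- Lists of moves, found by a search, are stored as base 4 numerals, least significant digit first.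
decodeMove : ℕ → Move
decodeMove 0 = right
decodeMove 1 = left
decodeMove 2 = commute
decodeMove _ = pentagon

decodeMoves : (length code : ℕ) → List Move
decodeMoves zero    c = []
decodeMoves (suc n) c = decodeMove (c ℕ.% 4) ∷ decodeMoves n (c ℕ./ 4)

_==ʷ_ : ∀ {N} → Word N → Word N → Bool
w ==ʷ w' = ⌊ List.≡-dec _≟_ w w' ⌋

==ʷ-sound : ∀ {N} (w w' : Word N) → (w ==ʷ w') ≡ true → w ≡ w'
==ʷ-sound w w' h with List.≡-dec _≟_ w w'
... | yes eq = eq

rewritesToᵇ : ∀ {N} → Maybe (Rewrite N) → Word N → (Fin N → Fin N) → Bool
rewritesToᵇ nothing w π = false
rewritesToᵇ (just (rewritten w' _ π')) w π = (w' ==ʷ w) ∧ allᵇ (λ i → ⌊ π' i ≟ π i ⌋)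

rewritesTo-run : ∀ {c} {X : Set c} {N} (M : Mutation X N) n B w ms w' π →
  rewritesToᵇ (rewriteWord n B w ms) w' π ≡ true → ∀ x i → run M B w x i ≡ run M B w' x (π i)
rewritesTo-run M n B w ms w' π h x i with rewriteWord n B w ms in eq
... | just (rewritten w₁ _ π₁) with ∧-split {w₁ ==ʷ w'} h
...   | h₁ , h₂ rewrite sym (==ʷ-sound w₁ w' h₁)
                      | sym (⌊≟⌋-sound (allᵇ-sound (λ i → ⌊ π₁ i ≟ π i ⌋) h₂ i)) =
  rewriteWord-sound M n B w ms eq x i

-- Rewriting certificates for E₆, E₇ and E₈

-- The tree E_n with all edges directed away from the branch vertex 3; the parent 100 stands for none.
parent : ℕ → ℕ
parent 0 = 2
parent 1 = 3
parent 2 = 3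
parent 3 = 100
parent 4 = 3
parent 5 = 4
parent 6 = 5
parent 7 = 6
parent _ = 100

treeSign : ℕ → ℕ → Sign
treeSign i j = if parent j ℕ.≡ᵇ i then ⊕ else if parent i ℕ.≡ᵇ j then ⊖ else ⊙

treeExchange : ∀ N → Exchange N
treeExchange N = Vec.tabulate λ i → Vec.tabulate λ j → treeSign (toℕ i) (toℕ j)

replicateWord : ∀ {N} → ℕ → Word N → Word N
replicateWord zero    w = []
replicateWord (suc n) w = w List.++ replicateWord n w


-- Every vertex follows its parent, so it is a source when its turn comes, and a full round restores
-- the orientation. In the reversed word every vertex is a sink. Mutation at a source moves a vertex
-- forward in time, at a sink backward.
round₆ : Word 6
round₆ = # 3 ∷ # 2 ∷ # 4 ∷ # 1 ∷ # 0 ∷ # 5 ∷ []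

moves₆ : List Move
moves₆ = decodeMoves 256
  7967555486801175667016509782887315217289688707429524666249764371628785402474469968368036560986484565217421939551745408877512782839014109765681039523198720

-- The evaluation behind this `refl` is the combinatorial content of type E₆: each commutation and
-- pentagon is tested on the matrix reached at that point. The exchanges of labels compose to
-- `star E₆`; for E₇ and E₈ they cancel. The fuel 258 exceeds the 256 moves.
rewrites₆ : rewritesToᵇ (rewriteWord 258 (treeExchange 6) (List.reverse round₆) moves₆)
                          (replicateWord 6 round₆) (star E₆) ≡ true
rewrites₆ = refl

round₇ : Word 7
round₇ = # 3 ∷ # 2 ∷ # 4 ∷ # 1 ∷ # 0 ∷ # 5 ∷ # 6 ∷ []

moves₇ : List Move
moves₇ = decodeMoves 645
  12658842672560227617808463310425011483774251272874785666704978662247981943099913337488973654186679591071782524350948716637382504401004881753982551516629541434008465374036279297046488223731931329268689131718065104277663596071373114678648978766100134512598208015166387843634230906311629190825031075680172102530486025553656907006731634601365605514566256487846701629923001319854474543689161728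

rewrites₇ : rewritesToᵇ (rewriteWord 647 (treeExchange 7) (List.reverse round₇) moves₇)
                          (replicateWord 9 round₇) (λ i → i) ≡ true
rewrites₇ = refl

round₈ : Word 8
round₈ = # 3 ∷ # 2 ∷ # 4 ∷ # 1 ∷ # 0 ∷ # 5 ∷ # 6 ∷ # 7 ∷ []

moves₈ : List Move
moves₈ = decodeMoves 1837
  57819451714325936714453025272915144172079137038799190577937785024395154338492212766758568570291640412456163564078839223847395314822438930384894961619175822160426158786202783229857521575024641289748650540291141303779112283045583866032713570376430063704811918731580722721496795290921447189734545414022954002284903140076068585091592327388791651085570149735536085860238964018105606891456875843650095015813003880847839021971706442542633705644507672058360626628344699898374894453533894426237149655124239438148487424756974427472619432878476448439714807412247936882374151824448805688197421312581880870545459614033036193221089894764080599286204642970602585851384819775806878950186897755643009764717773824380282187958950257576890590500168977446576525505478211446216846561798310891307692266728616382007405772237693586972287152959366931985588839262735455187345206624753129539973796771182024281469090189227946367838154156266010660780859034711717873080124657672161431699328001028485066773860519885121968391056728457521840903918894388229319410139349157597834922558880167838404585437215890584383543843943919095623285174272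

rewrites₈ : rewritesToᵇ (rewriteWord 1839 (treeExchange 8) (List.reverse round₈) moves₈)
                          (replicateWord 15 round₈) (λ i → i) ≡ true
rewrites₈ = refl

-- Entries of mutated matrices near a commuting pair or a pentagon

entry-mutate-column : ∀ {N} (B : Exchange N) k i → entry (mutate B k) i k ≡ opp (entry B i k)
entry-mutate-column B k i = trans (entry-mutate B k i k) lemma
  where
  lemma : mutateEntries B k i k ≡ opp (entry B i k)
  lemma rewrite ⌊≟⌋-refl k with ⌊ i ≟ k ⌋
  ... | true  = refl
  ... | false = refl

entry-mutate-row : ∀ {N} (B : Exchange N) k j → entry (mutate B k) k j ≡ opp (entry B k j)
entry-mutate-row B k j = trans (entry-mutate B k k j) lemma
  where
  lemma : mutateEntries B k k j ≡ opp (entry B k j)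
  lemma rewrite ⌊≟⌋-refl k = refl

entry-mutate-other : ∀ {N} (B : Exchange N) {k i j} → i ≢ k → j ≢ k →
  entry (mutate B k) i j ≡ mutateEntry (entry B i j) (entry B i k) (entry B k j)
entry-mutate-other B {k} {i} {j} i≢k j≢k = trans (entry-mutate B k i j) lemma
  where
  lemma : mutateEntries B k i j ≡ mutateEntry (entry B i j) (entry B i k) (entry B k j)
  lemma rewrite ⌊≟⌋-≢ i≢k | ⌊≟⌋-≢ j≢k = refl

mutateEntry-⊙ : ∀ s p → mutateEntry s p ⊙ ≡ s
mutateEntry-⊙ ⊖ ⊖ = refl
mutateEntry-⊙ ⊖ ⊙ = refl
mutateEntry-⊙ ⊖ ⊕ = refl
mutateEntry-⊙ ⊙ ⊖ = refl
mutateEntry-⊙ ⊙ ⊙ = refl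
mutateEntry-⊙ ⊙ ⊕ = refl
mutateEntry-⊙ ⊕ ⊖ = refl
mutateEntry-⊙ ⊕ ⊙ = refl
mutateEntry-⊙ ⊕ ⊕ = refl

entry-mutate-unlinked : ∀ {N} (B : Exchange N) {k i j} → i ≢ k → j ≢ k → entry B k j ≡ ⊙ →
  entry (mutate B k) i j ≡ entry B i j
entry-mutate-unlinked B {k} {i} {j} i≢k j≢k kj≡⊙ = trans (entry-mutate-other B i≢k j≢k)
  (trans (cong (mutateEntry (entry B i j) (entry B i k)) kj≡⊙) (mutateEntry-⊙ _ _))

Commute-sym : ∀ {N} {B : Exchange N} {a b} → Commute B a b → Commute B b a
Commute-sym comm = record
  { a≢b = ≢-sym a≢b ; ab = ba ; ba = ab
  ; related = record { entry-≡ = λ i j → sym (Related.entry-≡ related i j) } }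
  where open Commute comm

-- For a third vertex k with entries p in column a and q in column b, the entries of k in the columns mutated
-- along a, b are p, q₁ and those along b, a, b are q, p₁, q₂.
module PentagonEntries {N} {B : Exchange N} {a b} (pent : Pentagon B a b) where
  open Pentagon pent public
  b≢a : b ≢ a
  b≢a = ≢-sym a≢b

  B₁ B₂ B₃ : Exchange N
  B₁ = mutate B a
  B₂ = mutate B b
  B₃ = mutate B₂ a

  ab₁ : entry B₁ a b ≡ ⊕
  ab₁ = trans (entry-mutate-row B a b) (cong opp ab)
  bb₁ : entry B₁ b b ≡ ⊙
  bb₁ = trans (entry-mutate-other B b≢a b≢a) lemma
    where
    lemma : mutateEntry (entry B b b) (entry B b a) (entry B a b) ≡ ⊙
    lemma rewrite bb | ba | ab = refl

  ab₂ : entry B₂ a b ≡ ⊕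
  ab₂ = trans (entry-mutate-column B b a) (cong opp ab)
  ba₂ : entry B₂ b a ≡ ⊖
  ba₂ = trans (entry-mutate-row B b a) (cong opp ba)
  aa₂ : entry B₂ a a ≡ ⊙
  aa₂ = trans (entry-mutate-other B a≢b a≢b) lemma
    where
    lemma : mutateEntry (entry B a a) (entry B a b) (entry B b a) ≡ ⊙
    lemma rewrite aa | ba | ab = refl
  bb₂ : entry B₂ b b ≡ ⊙
  bb₂ = trans (entry-mutate-row B b b) (cong opp bb)

  ab₃ : entry B₃ a b ≡ ⊖
  ab₃ = trans (entry-mutate-row B₂ a b) (cong opp ab₂)
  bb₃ : entry B₃ b b ≡ ⊙
  bb₃ = trans (entry-mutate-other B₂ b≢a b≢a) lemma
    where
    lemma : mutateEntry (entry B₂ b b) (entry B₂ b a) (entry B₂ a b) ≡ ⊙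
    lemma rewrite bb₂ | ba₂ | ab₂ = refl

  q₁ p₁ q₂ : Sign → Sign → Sign
  q₁ p q = mutateEntry q p ⊖
  p₁ p q = mutateEntry p q ⊕
  q₂ p q = mutateEntry (opp q) (p₁ p q) ⊕

  module _ {k} (k≢a : k ≢ a) (k≢b : k ≢ b) where
    kb₁ : entry B₁ k b ≡ q₁ (entry B k a) (entry B k b)
    kb₁ = trans (entry-mutate-other B k≢a b≢a) (cong (mutateEntry (entry B k b) (entry B k a)) ab)
    ka₂ : entry B₂ k a ≡ p₁ (entry B k a) (entry B k b)
    ka₂ = trans (entry-mutate-other B k≢b a≢b) (cong (mutateEntry (entry B k a) (entry B k b)) ba)
    kb₃ : entry B₃ k b ≡ q₂ (entry B k a) (entry B k b)
    kb₃ = trans (entry-mutate-other B₂ k≢a b≢a) lemma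
      where
      lemma : mutateEntry (entry B₂ k b) (entry B₂ k a) (entry B₂ a b) ≡ q₂ (entry B k a) (entry B k b)
      lemma rewrite entry-mutate-column B b k | ka₂ | ab₂ = refl

-- Reduces a decidable statement about all third vertices to six evaluations, discharged by a single
-- `refl` wherever it is used.
∀-Link : (f : Sign → Sign → Bool) →
  f ⊙ ⊙ ∧ (f ⊕ ⊙ ∧ (f ⊖ ⊙ ∧ (f ⊙ ⊕ ∧ (f ⊙ ⊖ ∧ f ⊖ ⊕)))) ≡ true → ∀ {p q} → Link p q → f p q ≡ true
∀-Link f h l with f ⊙ ⊙ in e₁ | f ⊕ ⊙ in e₂ | f ⊖ ⊙ in e₃ | f ⊙ ⊕ in e₄ | f ⊙ ⊖ in e₅ | f ⊖ ⊕ in e₆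
∀-Link f refl l⊙⊙ | true | true | true | true | true | true = e₁
∀-Link f refl l⊕⊙ | true | true | true | true | true | true = e₂
∀-Link f refl l⊖⊙ | true | true | true | true | true | true = e₃
∀-Link f refl l⊙⊕ | true | true | true | true | true | true = e₄
∀-Link f refl l⊙⊖ | true | true | true | true | true | true = e₅
∀-Link f refl l⊖⊕ | true | true | true | true | true | true = e₆

-- Mutation of cluster variables

module ClusterMutation {c} (K : SemiField c) {N : ℕ} where
  open SemiField K
  open SemiFieldProperties K
  open ≡-Reasoning

  choose : Bool → Carrier → Carrier
  choose b x = if b then x else 1#

  column : Exchange N → Fin N → Sign → (Fin N → Carrier) → Carrier
  column B k s x = ∏ K λ j → choose (s ==ˢ entry B j k) (x j)

  exchange : Exchange N → Fin N → (Fin N → Carrier) → Carrier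
  exchange B k x = column B k ⊕ x + column B k ⊖ x

  xStep : Exchange N → Fin N → (Fin N → Carrier) → Fin N → Carrier
  xStep B k x i = if ⌊ i ≟ k ⌋ then exchange B k x ÷ x k else x i

  xStep-at : ∀ B k x → xStep B k x k ≡ exchange B k x ÷ x k
  xStep-at B k x rewrite ⌊≟⌋-refl k = refl

  xStep-other : ∀ B {k} x {i} → i ≢ k → xStep B k x i ≡ x i
  xStep-other B x i≢k rewrite ⌊≟⌋-≢ i≢k = refl

  column-related : ∀ σ → Involutive σ → ∀ {B B'} → Related σ B B' → ∀ {x x'} → (∀ i → x (σ i) ≡ x' i) →
    ∀ k s → column B (σ k) s x ≡ column B' k s x'
  column-related σ inv {B} rel {x} x≡ k s = trans
    (∏-reindex (mk↔ₛ′ σ σ inv inv) (λ j → choose (s ==ˢ entry B j (σ k)) (x j)))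
    (∏-cong λ j → cong₂ (λ t → choose (s ==ˢ t)) (Related.entry-≡ rel j k) (x≡ j))

  xStep-related : ∀ σ → Involutive σ → ∀ {B B'} → Related σ B B' → ∀ {x x'} → (∀ i → x (σ i) ≡ x' i) →
    ∀ k i → xStep B (σ k) x (σ i) ≡ xStep B' k x' i
  xStep-related σ inv {B} {B'} rel {x} {x'} x≡ k i rewrite ⌊≟⌋-involution σ inv i k with ⌊ i ≟ k ⌋
  ... | false = x≡ i
  ... | true  = cong₂ _÷_ (cong₂ _+_ (column-related σ inv rel x≡ k ⊕) (column-related σ inv rel x≡ k ⊖)) (x≡ k)

  -- The only variable that changes, the one at b, occurs in the column of a neither before nor
  -- after.
  column-unlinked : ∀ {B a b} → Commute B a b → ∀ x s → s ≢ ⊙ → column B a s x ≡ column (mutate B b) a s (xStep B b x)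
  column-unlinked {B} {a} {b} comm x s s≢⊙ = ∏-cong pointwise
    where
    open Commute comm
    none : ∀ s y z → s ≢ ⊙ → choose (s ==ˢ ⊙) y ≡ choose (s ==ˢ ⊙) z
    none ⊖ y z _ = refl
    none ⊙ y z h = contradiction refl h
    none ⊕ y z _ = refl
    pointwise : ∀ j → choose (s ==ˢ entry B j a) (x j) ≡
                      choose (s ==ˢ entry (mutate B b) j a) (xStep B b x j)
    pointwise j with j ≟ b
    ... | yes refl rewrite entry-mutate-row B b a | ba = none s _ _ s≢⊙
    ... | no j≢b rewrite entry-mutate-unlinked B j≢b a≢b ba = refl

  xStep-unlinked : ∀ {B a b} → Commute B a b → ∀ x →
    xStep B a x a ≡ xStep (mutate B b) a (xStep B b x) a
  xStep-unlinked {B} {a} {b} comm x = trans (xStep-at B a x) (trans (cong₂ _÷_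
      (cong₂ _+_ (column-unlinked comm x ⊕ λ ()) (column-unlinked comm x ⊖ λ ()))
      (sym (xStep-other B x (Commute.a≢b comm))))
    (sym (xStep-at (mutate B b) a (xStep B b x))))

  xStep-commute : ∀ {B a b} → Commute B a b → ∀ x i →
    xStep (mutate B a) b (xStep B a x) i ≡ xStep (mutate B b) a (xStep B b x) i
  xStep-commute {B} {a} {b} comm x i with position a b i
  ... | at-a refl = trans (xStep-other (mutate B a) (xStep B a x) (Commute.a≢b comm))
                          (xStep-unlinked comm x)
  ... | at-b refl = sym (trans (xStep-other (mutate B b) (xStep B b x) (≢-sym (Commute.a≢b comm)))
                               (xStep-unlinked (Commute-sym comm) x))
  ... | other i≢a i≢b =
    trans (trans (xStep-other (mutate B a) (xStep B a x) i≢b) (xStep-other B x i≢a))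
          (sym (trans (xStep-other (mutate B b) (xStep B b x) i≢a) (xStep-other B x i≢b)))

  -- The five-term recurrence of type A₂ with coefficients A, ..., E. Multiplied by `xa * xb`, both
  -- y₂ and x₂ become `xb * A * C + B * C * E + xa * B * D`, so cancellation replaces subtraction.
  -- The second equation uses the first.
  pentagon-exchange : ∀ {xa xb x₁ x₂ y₁ y₂ y₃ A B C D E} →
    xa * x₁ ≡ xb * A + B * E → xb * x₂ ≡ x₁ * C + B * D →
    xb * y₁ ≡ C * E + xa * D → xa * y₂ ≡ A * C + y₁ * B → y₁ * y₃ ≡ A * D + y₂ * E →
    y₂ ≡ x₂ × y₃ ≡ x₁
  pentagon-exchange {xa} {xb} {x₁} {x₂} {y₁} {y₂} {y₃} {A} {B} {C} {D} {E} h₁ h₂ h₃ h₄ h₅ = y₂≡x₂ , y₃≡x₁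
    where
    y₂≡x₂ : y₂ ≡ x₂
    y₂≡x₂ = *-cancelˡ (xa * xb) (begin
      xa * xb * y₂
        ≡⟨ just-injective (solve 3 (λ xa xb y₂ → xa :* xb :* y₂ := xb :* (xa :* y₂)) refl (just xa) (just xb) (just y₂)) ⟩
      xb * (xa * y₂)              ≡⟨ cong (xb *_) h₄ ⟩
      xb * (A * C + y₁ * B)
        ≡⟨ just-injective (solve 5 (λ xb y₁ A B C → xb :* (A :* C :+ y₁ :* B) := xb :* A :* C :+ (xb :* y₁) :* B) refl
             (just xb) (just y₁) (just A) (just B) (just C)) ⟩
      xb * A * C + (xb * y₁) * B  ≡⟨ cong (λ z → xb * A * C + z * B) h₃ ⟩
      xb * A * C + (C * E + xa * D) * B
        ≡⟨ just-injective (solve 7 (λ xa xb A B C D E → xb :* A :* C :+ (C :* E :+ xa :* D) :* B :=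
             (xb :* A :+ B :* E) :* C :+ xa :* (B :* D)) refl
             (just xa) (just xb) (just A) (just B) (just C) (just D) (just E)) ⟩
      (xb * A + B * E) * C + xa * (B * D) ≡⟨ cong (λ z → z * C + xa * (B * D)) h₁ ⟨
      xa * x₁ * C + xa * (B * D)
        ≡⟨ just-injective (solve 5 (λ xa x₁ B C D → xa :* x₁ :* C :+ xa :* (B :* D) := xa :* (x₁ :* C :+ B :* D)) refl
             (just xa) (just x₁) (just B) (just C) (just D)) ⟩
      xa * (x₁ * C + B * D)       ≡⟨ cong (xa *_) h₂ ⟨
      xa * (xb * x₂)              ≡⟨ *-assoc _ _ _ ⟨
      xa * xb * x₂                ∎)
    y₃≡x₁ : y₃ ≡ x₁
    y₃≡x₁ = *-cancelˡ y₁ (*-cancelˡ (xa * xb) (begin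
      xa * xb * (y₁ * y₃)          ≡⟨ cong (xa * xb *_) h₅ ⟩
      xa * xb * (A * D + y₂ * E)   ≡⟨ cong (λ z → xa * xb * (A * D + z * E)) y₂≡x₂ ⟩
      xa * xb * (A * D + x₂ * E)
        ≡⟨ just-injective (solve 6 (λ xa xb x₂ A D E → xa :* xb :* (A :* D :+ x₂ :* E) :=
             xa :* (xb :* A :* D :+ (xb :* x₂) :* E)) refl
             (just xa) (just xb) (just x₂) (just A) (just D) (just E)) ⟩
      xa * (xb * A * D + (xb * x₂) * E) ≡⟨ cong (λ z → xa * (xb * A * D + z * E)) h₂ ⟩
      xa * (xb * A * D + (x₁ * C + B * D) * E)
        ≡⟨ just-injective (solve 8 (λ xa xb x₁ A B C D E → xa :* (xb :* A :* D :+ (x₁ :* C :+ B :* D) :* E) :=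
             (xb :* A :+ B :* E) :* (xa :* D) :+ (xa :* x₁) :* (C :* E)) refl
             (just xa) (just xb) (just x₁) (just A) (just B) (just C) (just D) (just E)) ⟩
      (xb * A + B * E) * (xa * D) + (xa * x₁) * (C * E) ≡⟨ cong (λ z → z * (xa * D) + (xa * x₁) * (C * E)) h₁ ⟨
      (xa * x₁) * (xa * D) + (xa * x₁) * (C * E)
        ≡⟨ just-injective (solve 5 (λ xa x₁ C D E → (xa :* x₁) :* (xa :* D) :+ (xa :* x₁) :* (C :* E) :=
             (xa :* x₁) :* (C :* E :+ xa :* D)) refl
             (just xa) (just x₁) (just C) (just D) (just E)) ⟩
      (xa * x₁) * (C * E + xa * D)  ≡⟨ cong (xa * x₁ *_) h₃ ⟨
      (xa * x₁) * (xb * y₁)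
        ≡⟨ just-injective (solve 4 (λ xa xb x₁ y₁ → (xa :* x₁) :* (xb :* y₁) := xa :* xb :* (y₁ :* x₁)) refl
             (just xa) (just xb) (just x₁) (just y₁)) ⟩
      xa * xb * (y₁ * x₁) ∎))

  module _ {B : Exchange N} {a b : Fin N} (pent : Pentagon B a b) (x : Fin N → Carrier) where
    open PentagonEntries pent

    private
      Class : Set
      Class = Sign → Sign → Bool

      -- The third vertices k fall into five classes, whose products of variables are the five
      -- coefficients of the pentagon recurrence.
      cA cB cC cD cE : Class
      cA p q = (p ==ˢ ⊕) ∧ (q ==ˢ ⊙)
      cB p q = (p ==ˢ ⊖) ∧ (q ==ˢ ⊙)
      cC p q = (p ==ˢ ⊙) ∧ (q ==ˢ ⊕)
      cD p q = (p ==ˢ ⊙) ∧ (q ==ˢ ⊖)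
      cE p q = (p ==ˢ ⊖) ∧ (q ==ˢ ⊕)

      mask : (Fin N → Carrier) → Fin N → Carrier
      mask f k = if ⌊ k ≟ a ⌋ then 1# else if ⌊ k ≟ b ⌋ then 1# else f k

      mask-a : ∀ f → mask f a ≡ 1#
      mask-a f rewrite ⌊≟⌋-refl a = refl
      mask-b : ∀ f → mask f b ≡ 1#
      mask-b f rewrite ⌊≟⌋-≢ b≢a | ⌊≟⌋-refl b = refl
      mask-other : ∀ f {k} → k ≢ a → k ≢ b → mask f k ≡ f k
      mask-other f k≢a k≢b rewrite ⌊≟⌋-≢ k≢a | ⌊≟⌋-≢ k≢b = refl

      classes : List Class → Fin N → Carrier
      classes cs k = List.foldr (λ c r → choose (c (entry B k a) (entry B k b)) (x k) * r) 1# cs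

      coefficient : Class → Carrier
      coefficient c = ∏ K (mask λ k → choose (c (entry B k a) (entry B k b)) (x k))

      coefficients : List Class → Carrier
      coefficients = List.foldr (λ c r → coefficient c * r) 1#

      ∏-classes : ∀ cs → ∏ K (mask (classes cs)) ≡ coefficients cs
      ∏-classes [] = trans (∏-cong lemma) (∏-1 N)
        where
        lemma : ∀ k → mask (λ _ → 1#) k ≡ 1#
        lemma k with position a b k
        ... | at-a refl = mask-a (λ _ → 1#)
        ... | at-b refl = mask-b (λ _ → 1#)
        ... | other k≢a k≢b = mask-other (λ _ → 1#) k≢a k≢b
      ∏-classes (c ∷ cs) = trans (∏-cong lemma) (trans (∏-distrib-* (mask f) (mask (classes cs)))
                                                   (cong (coefficient c *_) (∏-classes cs)))
        where
        f : Fin N → Carrier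
        f k = choose (c (entry B k a) (entry B k b)) (x k)
        lemma : ∀ k → mask (classes (c ∷ cs)) k ≡ mask f k * mask (classes cs) k
        lemma k with position a b k
        ... | at-a refl = trans (mask-a (classes (c ∷ cs))) (sym (trans (cong₂ _*_ (mask-a f) (mask-a (classes cs))) (*-identityˡ 1#)))
        ... | at-b refl = trans (mask-b (classes (c ∷ cs))) (sym (trans (cong₂ _*_ (mask-b f) (mask-b (classes cs))) (*-identityˡ 1#)))
        ... | other k≢a k≢b = trans (mask-other (classes (c ∷ cs)) k≢a k≢b)
                                (sym (cong₂ _*_ (mask-other f k≢a k≢b) (mask-other (classes cs) k≢a k≢b)))

      ∏-split : ∀ f → ∏ K f ≡ f a * (f b * ∏ K (mask f))
      ∏-split f = trans (∏-update a (f a) {f} {g} fa f-other)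
                        (cong (f a *_) (∏-update b (f b) {g} {mask f} gb g-other))
        where
        g : Fin N → Carrier
        g k = if ⌊ k ≟ a ⌋ then 1# else f k
        ga : g a ≡ 1#
        ga rewrite ⌊≟⌋-refl a = refl
        fa : f a ≡ f a * g a
        fa = sym (trans (cong (f a *_) ga) (*-identityʳ _))
        f-other : ∀ j → j ≢ a → f j ≡ g j
        f-other j j≢a rewrite ⌊≟⌋-≢ j≢a = refl
        gb : g b ≡ f b * mask f b
        gb rewrite ⌊≟⌋-≢ b≢a | ⌊≟⌋-refl b = sym (*-identityʳ (f b))
        g-other : ∀ j → j ≢ b → g j ≡ mask f j
        g-other j j≢b rewrite ⌊≟⌋-≢ j≢b = refl

      countᵇ : List Class → Sign → Sign → ℕ
      countᵇ cs p q = List.foldr (λ c n → if c p q then suc n else n) 0 cs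

      exactly : Bool → ℕ → Bool
      exactly true  1 = true
      exactly false 0 = true
      exactly _     _ = false

      classes-choose : ∀ d k cs → exactly d (countᵇ cs (entry B k a) (entry B k b)) ≡ true →
                       choose d (x k) ≡ classes cs k
      classes-choose true k (c ∷ cs) h with c (entry B k a) (entry B k b)
      ... | false = trans (classes-choose true k cs h) (sym (*-identityˡ _))
      ... | true with countᵇ cs (entry B k a) (entry B k b) in eq
      ...   | zero = sym (trans (cong (x k *_) (sym (classes-choose false k cs (cong (exactly false) eq)))) (*-identityʳ _))
      classes-choose false k [] h = refl
      classes-choose false k (c ∷ cs) h with c (entry B k a) (entry B k b)
      ... | false = trans (classes-choose false k cs h) (sym (*-identityˡ _))
      ... | true with countᵇ cs (entry B k a) (entry B k b)
      ...   | zero = contradiction h λ ()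
      ...   | suc _ = contradiction h λ ()

      -- A monomial of an exchange relation consists of the factors at a and b and of some of the
      -- five coefficients. The last hypothesis says that a third vertex has sign s in column d
      -- precisely when one class of `cs` contains its link, and then only one; counting rather than
      -- testing membership excludes repeated factors.
      column-split : ∀ B' x' d s {ta tb} (t : Sign → Sign → Sign) cs →
        entry B' a d ≡ ta → entry B' b d ≡ tb →
        (∀ {k} → k ≢ a → k ≢ b → entry B' k d ≡ t (entry B k a) (entry B k b)) →
        (∀ {k} → k ≢ a → k ≢ b → x' k ≡ x k) →
        (∀ {p q} → Link p q → exactly (s ==ˢ t p q) (countᵇ cs p q) ≡ true) →
        column B' d s x' ≡ choose (s ==ˢ ta) (x' a) * (choose (s ==ˢ tb) (x' b) * coefficients cs)
      column-split B' x' d s t cs refl refl entry≡ x≡ ok = trans (∏-split f)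
        (cong (λ r → f a * (f b * r)) (trans (∏-cong lemma) (∏-classes cs)))
        where
        f : Fin N → Carrier
        f j = choose (s ==ˢ entry B' j d) (x' j)
        lemma : ∀ k → mask f k ≡ mask (classes cs) k
        lemma k with position a b k
        ... | at-a refl = trans (mask-a f) (sym (mask-a (classes cs)))
        ... | at-b refl = trans (mask-b f) (sym (mask-b (classes cs)))
        ... | other k≢a k≢b = trans (mask-other f k≢a k≢b) (trans
          (trans (cong₂ (λ t → choose (s ==ˢ t)) (entry≡ k≢a k≢b) (x≡ k≢a k≢b))
                 (classes-choose _ k cs (ok (link k k≢a k≢b))))
          (sym (mask-other (classes cs) k≢a k≢b)))

      ok? : (s : Sign) (t : Sign → Sign → Sign) (cs : List Class) → Class
      ok? s t cs p q = exactly (s ==ˢ t p q) (countᵇ cs p q)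

      x₁ x₂ y₁ y₂ y₃ : Fin N → Carrier
      x₁ = xStep B a x
      x₂ = xStep B₁ b x₁
      y₁ = xStep B b x
      y₂ = xStep B₂ a y₁
      y₃ = xStep B₃ b y₂

      wA wB wC wD wE : Carrier
      wA = coefficient cA
      wB = coefficient cB
      wC = coefficient cC
      wD = coefficient cD
      wE = coefficient cE

      x₁-fixed : ∀ {k} → k ≢ a → x₁ k ≡ x k
      x₁-fixed = xStep-other B x
      y₁-fixed : ∀ {k} → k ≢ b → y₁ k ≡ x k
      y₁-fixed = xStep-other B x
      y₂-fixed : ∀ {k} → k ≢ a → k ≢ b → y₂ k ≡ x k
      y₂-fixed k≢a k≢b = trans (xStep-other B₂ y₁ k≢a) (y₁-fixed k≢b)

      exchange-at : ∀ B' x' d → x' d * xStep B' d x' d ≡ exchange B' d x'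
      exchange-at B' x' d = trans (cong (x' d *_) (xStep-at B' d x')) (÷-* _ _)

      relation₁ : x a * x₁ a ≡ x b * wA + wB * wE
      relation₁ = trans (exchange-at B x a) (trans (cong₂ _+_
        (column-split B x a ⊕ (λ p q → p) (cA ∷ []) aa ba (λ _ _ → refl) (λ _ _ → refl) (∀-Link (ok? ⊕ (λ p q → p) (cA ∷ [])) refl))
        (column-split B x a ⊖ (λ p q → p) (cB ∷ cE ∷ []) aa ba (λ _ _ → refl) (λ _ _ → refl) (∀-Link (ok? ⊖ (λ p q → p) (cB ∷ cE ∷ [])) refl)))
        (just-injective (solve 4 (λ xb wA wB wE →
          con 1 :* (xb :* (wA :* con 1)) :+ con 1 :* (con 1 :* (wB :* (wE :* con 1))) := xb :* wA :+ wB :* wE) refl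
          (just (x b)) (just wA) (just wB) (just wE))))

      relation₂ : x b * x₂ b ≡ x₁ a * wC + wB * wD
      relation₂ = trans (cong (_* x₂ b) (sym (x₁-fixed b≢a))) (trans (exchange-at B₁ x₁ b) (trans (cong₂ _+_
        (column-split B₁ x₁ b ⊕ q₁ (cC ∷ []) ab₁ bb₁ kb₁ (λ k≢a _ → x₁-fixed k≢a) (∀-Link (ok? ⊕ q₁ (cC ∷ [])) refl))
        (column-split B₁ x₁ b ⊖ q₁ (cB ∷ cD ∷ []) ab₁ bb₁ kb₁ (λ k≢a _ → x₁-fixed k≢a) (∀-Link (ok? ⊖ q₁ (cB ∷ cD ∷ [])) refl)))
        (just-injective (solve 4 (λ xa wC wB wD →
          xa :* (con 1 :* (wC :* con 1)) :+ con 1 :* (con 1 :* (wB :* (wD :* con 1))) := xa :* wC :+ wB :* wD) refl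
          (just (x₁ a)) (just wC) (just wB) (just wD)))))

      relation₃ : x b * y₁ b ≡ wC * wE + x a * wD
      relation₃ = trans (exchange-at B x b) (trans (cong₂ _+_
        (column-split B x b ⊕ (λ p q → q) (cC ∷ cE ∷ []) ab bb (λ _ _ → refl) (λ _ _ → refl) (∀-Link (ok? ⊕ (λ p q → q) (cC ∷ cE ∷ [])) refl))
        (column-split B x b ⊖ (λ p q → q) (cD ∷ []) ab bb (λ _ _ → refl) (λ _ _ → refl) (∀-Link (ok? ⊖ (λ p q → q) (cD ∷ [])) refl)))
        (just-injective (solve 4 (λ xa wC wE wD →
          con 1 :* (con 1 :* (wC :* (wE :* con 1))) :+ xa :* (con 1 :* (wD :* con 1)) := wC :* wE :+ xa :* wD) refl
          (just (x a)) (just wC) (just wE) (just wD))))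

      relation₄ : x a * y₂ a ≡ wA * wC + y₁ b * wB
      relation₄ = trans (cong (_* y₂ a) (sym (y₁-fixed a≢b))) (trans (exchange-at B₂ y₁ a) (trans (cong₂ _+_
        (column-split B₂ y₁ a ⊕ p₁ (cA ∷ cC ∷ []) aa₂ ba₂ ka₂ (λ _ → y₁-fixed) (∀-Link (ok? ⊕ p₁ (cA ∷ cC ∷ [])) refl))
        (column-split B₂ y₁ a ⊖ p₁ (cB ∷ []) aa₂ ba₂ ka₂ (λ _ → y₁-fixed) (∀-Link (ok? ⊖ p₁ (cB ∷ [])) refl)))
        (just-injective (solve 4 (λ yb wA wC wB →
          con 1 :* (con 1 :* (wA :* (wC :* con 1))) :+ con 1 :* (yb :* (wB :* con 1)) := wA :* wC :+ yb :* wB) refl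
          (just (y₁ b)) (just wA) (just wC) (just wB)))))

      relation₅ : y₁ b * y₃ b ≡ wA * wD + y₂ a * wE
      relation₅ = trans (cong (_* y₃ b) (sym (xStep-other B₂ y₁ b≢a))) (trans (exchange-at B₃ y₂ b) (trans (cong₂ _+_
        (column-split B₃ y₂ b ⊕ q₂ (cA ∷ cD ∷ []) ab₃ bb₃ kb₃ y₂-fixed (∀-Link (ok? ⊕ q₂ (cA ∷ cD ∷ [])) refl))
        (column-split B₃ y₂ b ⊖ q₂ (cE ∷ []) ab₃ bb₃ kb₃ y₂-fixed (∀-Link (ok? ⊖ q₂ (cE ∷ [])) refl)))
        (just-injective (solve 4 (λ ya wA wD wE →
          con 1 :* (con 1 :* (wA :* (wD :* con 1))) :+ ya :* (con 1 :* (wE :* con 1)) := wA :* wD :+ ya :* wE) refl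
          (just (y₂ a)) (just wA) (just wD) (just wE)))))

      agree : y₂ a ≡ x₂ b × y₃ b ≡ x₁ a
      agree = pentagon-exchange relation₁ relation₂ relation₃ relation₄ relation₅

    xStep-pentagon : ∀ i →
      xStep (mutate (mutate B b) a) b (xStep (mutate B b) a (xStep B b x)) (transpose a b i)
        ≡ xStep (mutate B a) b (xStep B a x) i
    xStep-pentagon i with position a b i
    ... | at-a refl = trans (cong y₃ (transpose-a a b)) (trans (proj₂ agree) (sym (xStep-other B₁ x₁ a≢b)))
    ... | at-b refl = trans (cong y₃ (transpose-b a≢b)) (trans (xStep-other B₃ y₂ a≢b) (proj₁ agree))
    ... | other i≢a i≢b = trans (cong y₃ (transpose-other i≢a i≢b))
      (trans (xStep-other B₃ y₂ i≢b) (trans (y₂-fixed i≢a i≢b)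
        (sym (trans (xStep-other B₁ x₁ i≢b) (x₁-fixed i≢a)))))

  clusterMutation : Mutation Carrier N
  clusterMutation = record
    { step = xStep ; step-related = xStep-related ; step-commute = xStep-commute
    ; step-pentagon = xStep-pentagon }

-- Mutation of coefficients

module CoefficientMutation {c} (K : SemiField c) {N : ℕ} where
  open SemiField K
  open SemiFieldProperties K
  open ≡-Reasoning

  -- The coefficient rule of cluster algebras: with b the entry in row i and column k, the factor is
  -- y_k^max(b,0) (1 + y_k)^(-b).
  factor : Sign → Carrier → Carrier
  factor ⊖ y = 1# + y
  factor ⊙ y = 1#
  factor ⊕ y = y ÷ (1# + y)

  yStep : Exchange N → Fin N → (Fin N → Carrier) → Fin N → Carrier
  yStep B k y i = if ⌊ i ≟ k ⌋ then y k ⁻¹ else y i * factor (entry B i k) (y k)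

  yStep-at : ∀ B k y → yStep B k y k ≡ y k ⁻¹
  yStep-at B k y rewrite ⌊≟⌋-refl k = refl

  yStep-other : ∀ B {k} y {i} → i ≢ k → yStep B k y i ≡ y i * factor (entry B i k) (y k)
  yStep-other B y i≢k rewrite ⌊≟⌋-≢ i≢k = refl

  yStep-related : ∀ σ → Involutive σ → ∀ {B B'} → Related σ B B' → ∀ {y y'} → (∀ i → y (σ i) ≡ y' i) →
    ∀ k i → yStep B (σ k) y (σ i) ≡ yStep B' k y' i
  yStep-related σ inv rel y≡ k i rewrite ⌊≟⌋-involution σ inv i k with ⌊ i ≟ k ⌋
  ... | true  = cong _⁻¹ (y≡ k)
  ... | false = cong₂ _*_ (y≡ i) (cong₂ factor (Related.entry-≡ rel i k) (y≡ k))

  yStep-unlinked : ∀ B {k} y {i} → i ≢ k → entry B i k ≡ ⊙ → yStep B k y i ≡ y i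
  yStep-unlinked B {k} y {i} i≢k ik≡⊙ = trans (yStep-other B y i≢k)
    (trans (cong (λ s → y i * factor s (y k)) ik≡⊙) (*-identityʳ (y i)))

  module _ {B : Exchange N} {a b} (comm : Commute B a b) (y : Fin N → Carrier) where
    open Commute comm

    ySteps-first : yStep (mutate B a) b (yStep B a y) a ≡ y a ⁻¹
    ySteps-first = trans (yStep-unlinked (mutate B a) (yStep B a y) a≢b
                        (trans (entry-mutate-row B a b) (cong opp ab)))
                     (yStep-at B a y)

    ySteps-second : yStep (mutate B a) b (yStep B a y) b ≡ y b ⁻¹
    ySteps-second = trans (yStep-at (mutate B a) b (yStep B a y))
                      (cong _⁻¹ (yStep-unlinked B y (≢-sym a≢b) ba))

    ySteps-other : ∀ {i} → i ≢ a → i ≢ b → yStep (mutate B a) b (yStep B a y) i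
               ≡ y i * factor (entry B i a) (y a) * factor (entry B i b) (y b)
    ySteps-other i≢a i≢b = trans (yStep-other (mutate B a) (yStep B a y) i≢b)
      (cong₂ _*_ (yStep-other B y i≢a)
        (cong₂ factor (entry-mutate-unlinked B i≢a (≢-sym a≢b) ab)
                      (yStep-unlinked B y (≢-sym a≢b) ba)))

  yStep-commute : ∀ {B a b} → Commute B a b → ∀ y i →
    yStep (mutate B a) b (yStep B a y) i ≡ yStep (mutate B b) a (yStep B b y) i
  yStep-commute {B} {a} {b} comm y i with position a b i
  ... | at-a refl = trans (ySteps-first comm y) (sym (ySteps-second (Commute-sym comm) y))
  ... | at-b refl = trans (ySteps-second comm y) (sym (ySteps-first (Commute-sym comm) y))
  ... | other i≢a i≢b = trans (ySteps-other comm y i≢a i≢b) (trans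
    (just-injective (solve 3 (λ u v w → u :* v :* w := u :* w :* v) refl
      (just (y i)) (just (factor (entry B i a) (y a))) (just (factor (entry B i b) (y b)))))
    (sym (ySteps-other (Commute-sym comm) y i≢b i≢a)))

  ÷-*-÷ : ∀ n d n' d' → (n ÷ d) * (n' ÷ d') ≡ (n * n') ÷ (d * d')
  ÷-*-÷ n d n' d' = ÷-unique (begin
    d * d' * (n ÷ d * (n' ÷ d'))
      ≡⟨ just-injective (solve 4 (λ d d' u v → d :* d' :* (u :* v) := (d :* u) :* (d' :* v)) refl
           (just d) (just d') (just (n ÷ d)) (just (n' ÷ d'))) ⟩
    (d * (n ÷ d)) * (d' * (n' ÷ d')) ≡⟨ cong₂ _*_ (÷-* n d) (÷-* n' d') ⟩
    n * n' ∎)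

  ÷-cross : ∀ {n d n' d'} → n * d' ≡ n' * d → n ÷ d ≡ n' ÷ d'
  ÷-cross {n} {d} {n'} {d'} eq = sym (÷-unique (*-cancelˡ d' (begin
    d' * (d * (n' ÷ d'))
      ≡⟨ just-injective (solve 3 (λ d d' u → d' :* (d :* u) := d :* (d' :* u)) refl (just d) (just d') (just (n' ÷ d'))) ⟩
    d * (d' * (n' ÷ d')) ≡⟨ cong (d *_) (÷-* n' d') ⟩
    d * n'               ≡⟨ *-comm d n' ⟩
    n' * d               ≡⟨ eq ⟨
    n * d'               ≡⟨ *-comm n d' ⟩
    d' * n               ∎)))

  ÷-⁻¹ : ∀ n d → (n ÷ d) ⁻¹ ≡ d ÷ n
  ÷-⁻¹ n d = sym (⁻¹-unique (trans (÷-*-÷ n d d n) (sym (÷-unique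
    (trans (*-identityʳ _) (*-comm d n))))))

  1+÷ : ∀ n d → 1# + n ÷ d ≡ (d + n) ÷ d
  1+÷ n d = ÷-unique (trans (distribˡ d 1# (n ÷ d)) (cong₂ _+_ (*-identityʳ d) (÷-* n d)))

  -- factor s (n ÷ d) as a fraction, where t is n + d.
  numerator denominator : Sign → (n d t : Carrier) → Carrier
  numerator ⊖ n d t = t
  numerator ⊙ n d t = 1#
  numerator ⊕ n d t = n
  denominator ⊖ n d t = d
  denominator ⊙ n d t = 1#
  denominator ⊕ n d t = t

  factor-÷ : ∀ s n d {t} → d + n ≡ t → factor s (n ÷ d) ≡ numerator s n d t ÷ denominator s n d t
  factor-÷ ⊖ n d refl = 1+÷ n d
  factor-÷ ⊙ n d refl = ÷-unique (*-identityˡ 1#)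
  factor-÷ ⊕ n d refl = begin
    n ÷ d ÷ (1# + n ÷ d)       ≡⟨ cong (λ z → n ÷ d * z ⁻¹) (1+÷ n d) ⟩
    n ÷ d * ((d + n) ÷ d) ⁻¹   ≡⟨ cong (n ÷ d *_) (÷-⁻¹ (d + n) d) ⟩
    n ÷ d * (d ÷ (d + n))      ≡⟨ ÷-*-÷ n d d (d + n) ⟩
    n * d ÷ (d * (d + n))      ≡⟨ ÷-cross (just-injective (solve 3 (λ n d t → n :* d :* t := n :* (d :* t)) refl
                                    (just n) (just d) (just (d + n)))) ⟩
    n ÷ (d + n) ∎

  module _ {B : Exchange N} {a b : Fin N} (pent : Pentagon B a b) (y : Fin N → Carrier) where
    open PentagonEntries pent

    private
      u v P Q R : Carrier
      u = y a
      v = y b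
      P = 1# + u
      Q = 1# + v
      R = 1# + u * Q

      -- Besides the definitions of P, Q and R, the two identities `PQ` and `PR` are the only
      -- additive relations in the pentagon; everything else is multiplicative.
      PQ : v + R ≡ P * Q
      PQ = just-injective (solve 2 (λ u v → v :+ (con 1 :+ u :* (con 1 :+ v)) := (con 1 :+ u) :* (con 1 :+ v)) refl
             (just u) (just v))

      PR : P + v * u ≡ R
      PR = just-injective (solve 2 (λ u v → con 1 :+ u :+ v :* u := con 1 :+ u :* (con 1 :+ v)) refl
             (just u) (just v))

      y₁ y₂ z₁ z₂ z₃ : Fin N → Carrier
      y₁ = yStep B a y
      y₂ = yStep B₁ b y₁
      z₁ = yStep B b y
      z₂ = yStep B₂ a z₁
      z₃ = yStep B₃ b z₂

      ÷1 : ∀ x → x ≡ x ÷ 1#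
      ÷1 x = ÷-unique (*-identityˡ x)

      y₁b : y₁ b ≡ v * u ÷ P
      y₁b = trans (yStep-other B y b≢a) (trans (cong (λ s → v * factor s u) ba) (sym (*-assoc v u _)))

      y₂b : y₂ b ≡ P ÷ (v * u)
      y₂b = trans (yStep-at B₁ b y₁) (trans (cong _⁻¹ y₁b) (÷-⁻¹ _ _))

      y₂a : y₂ a ≡ v ÷ R
      y₂a = begin
        y₂ a                              ≡⟨ yStep-other B₁ y₁ a≢b ⟩
        y₁ a * factor (entry B₁ a b) (y₁ b) ≡⟨ cong₂ _*_ (yStep-at B a y) (cong₂ factor ab₁ y₁b) ⟩
        u ⁻¹ * factor ⊕ (v * u ÷ P)       ≡⟨ cong₂ _*_ (sym (*-identityˡ _)) (factor-÷ ⊕ (v * u) P PR) ⟩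
        1# ÷ u * (v * u ÷ R)              ≡⟨ ÷-*-÷ 1# u (v * u) R ⟩
        1# * (v * u) ÷ (u * R)            ≡⟨ ÷-cross (just-injective (solve 3 (λ u v R → con 1 :* (v :* u) :* R := v :* (u :* R)) refl
                                               (just u) (just v) (just R))) ⟩
        v ÷ R                             ∎

      z₁a : z₁ a ≡ u * Q
      z₁a = trans (yStep-other B y a≢b) (cong (λ s → u * factor s v) ab)

      z₂b : z₂ b ≡ R ÷ v
      z₂b = begin
        z₂ b                                ≡⟨ yStep-other B₂ z₁ b≢a ⟩
        z₁ b * factor (entry B₂ b a) (z₁ a) ≡⟨ cong₂ _*_ (yStep-at B b y) (cong₂ factor ba₂ z₁a) ⟩
        v ⁻¹ * R                            ≡⟨ *-comm _ _ ⟩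
        R ÷ v                               ∎

      z₃b : z₃ b ≡ v ÷ R
      z₃b = trans (yStep-at B₃ b z₂) (trans (cong _⁻¹ z₂b) (÷-⁻¹ _ _))

      z₃a : z₃ a ≡ P ÷ (v * u)
      z₃a = begin
        z₃ a                                ≡⟨ yStep-other B₃ z₂ a≢b ⟩
        z₂ a * factor (entry B₃ a b) (z₂ b) ≡⟨ cong₂ _*_ (trans (yStep-at B₂ a z₁) (cong _⁻¹ z₁a)) (cong₂ factor ab₃ z₂b) ⟩
        (u * Q) ⁻¹ * factor ⊖ (R ÷ v)       ≡⟨ cong₂ _*_ (sym (*-identityˡ _)) (factor-÷ ⊖ R v PQ) ⟩
        1# ÷ (u * Q) * (P * Q ÷ v)          ≡⟨ ÷-*-÷ 1# (u * Q) (P * Q) v ⟩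
        1# * (P * Q) ÷ (u * Q * v)          ≡⟨ ÷-cross (just-injective (solve 4 (λ u v P Q → con 1 :* (P :* Q) :* (v :* u) := P :* (u :* Q :* v)) refl
                                                 (just u) (just v) (just P) (just Q))) ⟩
        P ÷ (v * u)                         ∎

      -- Both sides are Laurent monomials in u, v, P, Q and R.
      crossed : ∀ {p q} → Link p q →
        (numerator p u 1# P * numerator (q₁ p q) (v * u) P R)
          * (denominator q v 1# Q * denominator (p₁ p q) (u * Q) 1# R * denominator (q₂ p q) R v (P * Q))
        ≡ (numerator q v 1# Q * numerator (p₁ p q) (u * Q) 1# R * numerator (q₂ p q) R v (P * Q))
          * (denominator p u 1# P * denominator (q₁ p q) (v * u) P R)
      crossed l⊙⊙ = *-comm _ _
      crossed l⊕⊙ = just-injective (solve 4 (λ u P Q R →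
        u :* con 1 :* (con 1 :* R :* (P :* Q)) := con 1 :* (u :* Q) :* R :* (P :* con 1)) refl
        (just u) (just P) (just Q) (just R))
      crossed l⊖⊙ = just-injective (solve 2 (λ P R →
        P :* R :* (con 1 :* con 1 :* con 1) := con 1 :* R :* con 1 :* (con 1 :* P)) refl
        (just P) (just R))
      crossed l⊙⊕ = just-injective (solve 5 (λ u v P Q R →
        con 1 :* (v :* u) :* (Q :* R :* con 1) := v :* (u :* Q) :* con 1 :* (con 1 :* R)) refl
        (just u) (just v) (just P) (just Q) (just R))
      crossed l⊙⊖ = just-injective (solve 3 (λ P Q R →
        con 1 :* R :* (con 1 :* con 1 :* (P :* Q)) := Q :* con 1 :* R :* (con 1 :* P)) refl
        (just P) (just Q) (just R))
      crossed l⊖⊕ = just-injective (solve 3 (λ v P Q →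
        P :* con 1 :* (Q :* con 1 :* v) := v :* con 1 :* (P :* Q) :* (con 1 :* con 1)) refl
        (just v) (just P) (just Q))

      y₂-other : ∀ {k} → k ≢ a → k ≢ b →
        y₂ k ≡ y k * factor (entry B k a) u * factor (q₁ (entry B k a) (entry B k b)) (v * u ÷ P)
      y₂-other k≢a k≢b = trans (yStep-other B₁ y₁ k≢b)
        (cong₂ _*_ (yStep-other B y k≢a) (cong₂ factor (kb₁ k≢a k≢b) y₁b))

      z₃-other : ∀ {k} → k ≢ a → k ≢ b →
        z₃ k ≡ y k * factor (entry B k b) v * factor (p₁ (entry B k a) (entry B k b)) (u * Q)
                 * factor (q₂ (entry B k a) (entry B k b)) (R ÷ v)
      z₃-other k≢a k≢b = trans (yStep-other B₃ z₂ k≢b)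
        (cong₂ _*_ (trans (yStep-other B₂ z₁ k≢a)
                     (cong₂ _*_ (yStep-other B y k≢b) (cong₂ factor (ka₂ k≢a k≢b) z₁a)))
                   (cong₂ factor (kb₃ k≢a k≢b) z₂b))

      factor-1 : ∀ s x {t} → 1# + x ≡ t → factor s x ≡ numerator s x 1# t ÷ denominator s x 1# t
      factor-1 s x eq = trans (cong (factor s) (÷1 x)) (factor-÷ s x 1# eq)

      factors : ∀ {p q} → Link p q → factor q v * factor (p₁ p q) (u * Q) * factor (q₂ p q) (R ÷ v)
                                      ≡ factor p u * factor (q₁ p q) (v * u ÷ P)
      factors {p} {q} l = begin
        factor q v * factor (p₁ p q) (u * Q) * factor (q₂ p q) (R ÷ v)
          ≡⟨ cong₂ _*_ (trans (cong₂ _*_ (factor-1 q v refl) (factor-1 (p₁ p q) (u * Q) refl))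
                              (÷-*-÷ nq dq np₁ dp₁))
                       (factor-÷ (q₂ p q) R v PQ) ⟩
        (nq * np₁ ÷ (dq * dp₁)) * (nq₂ ÷ dq₂)
          ≡⟨ ÷-*-÷ (nq * np₁) (dq * dp₁) nq₂ dq₂ ⟩
        (nq * np₁ * nq₂) ÷ (dq * dp₁ * dq₂)
          ≡⟨ ÷-cross (sym (crossed l)) ⟩
        (np * nq₁) ÷ (dp * dq₁)
          ≡⟨ ÷-*-÷ np dp nq₁ dq₁ ⟨
        (np ÷ dp) * (nq₁ ÷ dq₁)
          ≡⟨ cong₂ _*_ (factor-1 p u refl) (factor-÷ (q₁ p q) (v * u) P PR) ⟨
        factor p u * factor (q₁ p q) (v * u ÷ P) ∎
        where
        np  = numerator p u 1# P
        dp  = denominator p u 1# P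
        nq  = numerator q v 1# Q
        dq  = denominator q v 1# Q
        nq₁ = numerator (q₁ p q) (v * u) P R
        dq₁ = denominator (q₁ p q) (v * u) P R
        np₁ = numerator (p₁ p q) (u * Q) 1# R
        dp₁ = denominator (p₁ p q) (u * Q) 1# R
        nq₂ = numerator (q₂ p q) R v (P * Q)
        dq₂ = denominator (q₂ p q) R v (P * Q)

    yStep-pentagon : ∀ i →
      yStep (mutate (mutate B b) a) b (yStep (mutate B b) a (yStep B b y)) (transpose a b i)
        ≡ yStep (mutate B a) b (yStep B a y) i
    yStep-pentagon i with position a b i
    ... | at-a refl = trans (cong z₃ (transpose-a a b)) (trans z₃b (sym y₂a))
    ... | at-b refl = trans (cong z₃ (transpose-b a≢b)) (trans z₃a (sym y₂b))
    ... | other i≢a i≢b = begin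
      z₃ (transpose a b i) ≡⟨ cong z₃ (transpose-other i≢a i≢b) ⟩
      z₃ i                 ≡⟨ z₃-other i≢a i≢b ⟩
      y i * f₁ * f₂ * f₃
        ≡⟨ just-injective (solve 4 (λ y f₁ f₂ f₃ → y :* f₁ :* f₂ :* f₃ := y :* (f₁ :* f₂ :* f₃)) refl
             (just (y i)) (just f₁) (just f₂) (just f₃)) ⟩
      y i * (f₁ * f₂ * f₃) ≡⟨ cong (y i *_) (factors (link i i≢a i≢b)) ⟩
      y i * (g₁ * g₂)      ≡⟨ *-assoc _ _ _ ⟨
      y i * g₁ * g₂        ≡⟨ y₂-other i≢a i≢b ⟨
      y₂ i                 ∎
      where
      f₁ = factor (entry B i b) v
      f₂ = factor (p₁ (entry B i a) (entry B i b)) (u * Q)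
      f₃ = factor (q₂ (entry B i a) (entry B i b)) (R ÷ v)
      g₁ = factor (entry B i a) u
      g₂ = factor (q₁ (entry B i a) (entry B i b)) (v * u ÷ P)

  coefficientMutation : Mutation Carrier N
  coefficientMutation = record
    { step = yStep ; step-related = yStep-related ; step-commute = yStep-commute
    ; step-pentagon = yStep-pentagon }

-- Slices of friezes under mutation

≡ᵇ-refl : ∀ n → (n ℕ.≡ᵇ n) ≡ true
≡ᵇ-refl zero    = refl
≡ᵇ-refl (suc n) = ≡ᵇ-refl n

≡ᵇ-suc : ∀ n → (n ℕ.≡ᵇ suc n) ≡ false
≡ᵇ-suc zero    = refl
≡ᵇ-suc (suc n) = ≡ᵇ-suc n

<ᵇ-irrefl : ∀ n → (n ℕ.<ᵇ n) ≡ false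
<ᵇ-irrefl zero    = refl
<ᵇ-irrefl (suc n) = <ᵇ-irrefl n

<ᵇ-suc : ∀ n → (n ℕ.<ᵇ suc n) ≡ true
<ᵇ-suc zero    = refl
<ᵇ-suc (suc n) = <ᵇ-suc n

suc-<ᵇ : ∀ n → (suc n ℕ.<ᵇ n) ≡ false
suc-<ᵇ zero    = refl
suc-<ᵇ (suc n) = suc-<ᵇ n

≡ᵇ-sound : ∀ m n → (m ℕ.≡ᵇ n) ≡ true → m ≡ n
≡ᵇ-sound zero    zero    h = refl
≡ᵇ-sound (suc m) (suc n) h = cong suc (≡ᵇ-sound m n h)

==ˢ-≢ : ∀ {s t} → s ≢ t → (s ==ˢ t) ≡ false
==ˢ-≢ {s} {t} s≢t with s ==ˢ t in e
... | true  = contradiction (==ˢ-sound s t e) s≢t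
... | false = refl

-- Slices of a frieze are recorded by a counter for every vertex. For an edge i → j of the orientation Q
-- the entry of j following (i , n) is (j , n), that of i following (j , n) is (i , suc n).
module Slices {N : ℕ} (Q : Exchange N) (antisymmetric : ∀ i j → entry Q j i ≡ opp (entry Q i j)) where

  loopless : ∀ i → entry Q i i ≡ ⊙
  loopless i with entry Q i i | antisymmetric i i
  ... | ⊙ | _ = refl

  Counters : Set
  Counters = Vec ℕ N

  infixl 20 _at_
  _at_ : Counters → Fin N → ℕ
  m at i = Vec.lookup m i

  next : Sign → ℕ → ℕ
  next ⊖ n = suc n
  next ⊙ n = n
  next ⊕ n = n

  isLinked : Sign → Bool
  isLinked ⊙ = false
  isLinked _ = true

  -- True when i stands at the very entry that the relation between `(j , m at j)` and its successor
  -- involves. In the exchange matrix of the slice this corresponds to an arrow from j to i.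
  ahead : Counters → Fin N → Fin N → Bool
  ahead m j i = isLinked (entry Q j i) ∧ (m at i ℕ.≡ᵇ next (entry Q j i) (m at j))

  -- By `ready`, the current slice contains every neighbouring entry in the relation between
  -- `(i , m at i)` and its successor; the relation of the frieze is then the exchange relation at
  -- i.
  record Advance (m m' : Counters) (i : Fin N) : Set where
    field
      self  : m' at i ≡ suc (m at i)
      fixed : ∀ {j} → j ≢ i → m' at j ≡ m at j
      ready : ∀ j → isLinked (entry Q i j) ≡ true → m at j ≡ next (entry Q i j) (m at i)

  linkSign : Sign → Sign → Sign
  linkSign s ⊙ = ⊙
  linkSign s _ = s

  stepᵇ : Sign → Exchange N → Counters → Fin N → Bool
  stepᵇ s B m i = allᵇ λ j → (entry B j i ==ˢ linkSign s (entry Q i j))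
                             ∧ (not (isLinked (entry Q i j)) ∨ (m at j ℕ.≡ᵇ next (entry Q i j) (m at i)))

  module _ {s B m i} (ok : stepᵇ s B m i ≡ true) where
    private
      at-j = λ j → ∧-split {entry B j i ==ˢ linkSign s (entry Q i j)} (allᵇ-sound _ ok j)

    step-column : ∀ j → entry B j i ≡ linkSign s (entry Q i j)
    step-column j = ==ˢ-sound _ _ (proj₁ (at-j j))

    step-ready : ∀ j → isLinked (entry Q i j) ≡ true → m at j ≡ next (entry Q i j) (m at i)
    step-ready j l with proj₂ (at-j j)
    ... | h rewrite l = ≡ᵇ-sound _ _ h

  raise lower : Counters → Fin N → Counters
  raise m i = Vec.updateAt m i suc
  lower m i = Vec.updateAt m i ℕ.pred

  raise-advance : ∀ {s B m i} → stepᵇ s B m i ≡ true → Advance m (raise m i) i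
  raise-advance {s} {B} {m} {i} ok = record
    { self = lookup∘updateAt i m ; fixed = λ j≢i → lookup∘updateAt′ _ i j≢i m
    ; ready = step-ready {s} {B} {m} {i} ok }

  lower-advance : ∀ {s B m i} → (m at i ℕ.≡ᵇ suc (lower m i at i)) ≡ true → stepᵇ s B (lower m i) i ≡ true →
                  Advance (lower m i) m i
  lower-advance {s} {B} {m} {i} h ok = record
    { self = ≡ᵇ-sound _ _ h ; fixed = λ j≢i → sym (lookup∘updateAt′ _ i j≢i m)
    ; ready = step-ready {s} {B} {lower m i} {i} ok }

  raises lowers : Counters → Word N → Counters
  raises m []      = m
  raises m (i ∷ w) = raises (raise m i) w
  lowers m []      = m
  lowers m (i ∷ w) = lowers (lower m i) w

  raisesᵇ lowersᵇ : Exchange N → Counters → Word N → Bool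
  raisesᵇ B m []      = true
  raisesᵇ B m (i ∷ w) = stepᵇ ⊖ B m i ∧ raisesᵇ (mutate B i) (raise m i) w
  lowersᵇ B m []      = true
  lowersᵇ B m (i ∷ w) = stepᵇ ⊕ B (lower m i) i ∧ ((m at i ℕ.≡ᵇ suc (lower m i at i))
                        ∧ lowersᵇ (mutate B i) (lower m i) w)

  module _ {c} {X : Set c} (M : Mutation X N) (slice : Counters → Fin N → X)
    (forward : ∀ B {m m' i} → (∀ j → entry B j i ≡ linkSign ⊖ (entry Q i j)) → Advance m m' i →
               ∀ j → Mutation.step M B i (slice m) j ≡ slice m' j)
    (backward : ∀ B {m m' i} → (∀ j → entry B j i ≡ linkSign ⊕ (entry Q i j)) → Advance m m' i →
               ∀ j → Mutation.step M B i (slice m') j ≡ slice m j) where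

    run-raises : ∀ w B m → raisesᵇ B m w ≡ true → ∀ {x} → (∀ j → x j ≡ slice m j) →
                 ∀ j → run M B w x j ≡ slice (raises m w) j
    run-raises []      B m h x≡ j = x≡ j
    run-raises (i ∷ w) B m h x≡ j with ∧-split {stepᵇ ⊖ B m i} h
    ... | h₁ , h₂ = run-raises w (mutate B i) (raise m i) h₂ (λ j → trans
      (Mutation.step-related M (λ k → k) (λ _ → refl) (Related-refl B) x≡ i j)
      (forward B (step-column {⊖} {B} {m} {i} h₁) (raise-advance {⊖} {B} {m} {i} h₁) j)) j

    run-lowers : ∀ w B m → lowersᵇ B m w ≡ true → ∀ {x} → (∀ j → x j ≡ slice m j) →
                 ∀ j → run M B w x j ≡ slice (lowers m w) j
    run-lowers []      B m h x≡ j = x≡ j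
    run-lowers (i ∷ w) B m h x≡ j with ∧-split {stepᵇ ⊕ B (lower m i) i} h
    ... | h₁ , h' with ∧-split {m at i ℕ.≡ᵇ suc (lower m i at i)} h'
    ... | h₂ , h₃ = run-lowers w (mutate B i) (lower m i) h₃ (λ j → trans
      (Mutation.step-related M (λ k → k) (λ _ → refl) (Related-refl B) x≡ i j)
      (backward B (step-column {⊕} {B} {lower m i} {i} h₁) (lower-advance {⊕} {B} {m} {i} h₂ h₁) j)) j

    -- Both words start at the slice 1; w₁ goes down to the slice 0 and w₂ up to the slice c.
    compare-slices : ∀ n w₁ w₂ ms σ c →
      rewritesToᵇ (rewriteWord n Q w₁ ms) w₂ σ ≡ true →
      lowersᵇ Q (Vec.replicate N 1) w₁ ≡ true → lowers (Vec.replicate N 1) w₁ ≡ Vec.replicate N 0 →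
      raisesᵇ Q (Vec.replicate N 1) w₂ ≡ true → raises (Vec.replicate N 1) w₂ ≡ Vec.replicate N c →
      ∀ j → slice (Vec.replicate N c) (σ j) ≡ slice (Vec.replicate N 0) j
    compare-slices n w₁ w₂ ms σ c h h₁ e₁ h₂ e₂ j = begin
      slice (Vec.replicate N c) (σ j)             ≡⟨ cong (λ m → slice m (σ j)) e₂ ⟨
      slice (raises (Vec.replicate N 1) w₂) (σ j) ≡⟨ run-raises w₂ Q (Vec.replicate N 1) h₂ (λ _ → refl) (σ j) ⟨
      run M Q w₂ (slice (Vec.replicate N 1)) (σ j) ≡⟨ rewritesTo-run M n Q w₁ ms w₂ σ h (slice (Vec.replicate N 1)) j ⟨
      run M Q w₁ (slice (Vec.replicate N 1)) j    ≡⟨ run-lowers w₁ Q (Vec.replicate N 1) h₁ (λ _ → refl) j ⟩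
      slice (lowers (Vec.replicate N 1) w₁) j     ≡⟨ cong (λ m → slice m j) e₁ ⟩
      slice (Vec.replicate N 0) j                 ∎
      where open ≡-Reasoning

  module _ {c} (K : SemiField c) where
    open SemiField K
    open SemiFieldProperties K
    open ≡-Reasoning

    neighbour : Sign → (ℕ → Carrier) → ℕ → Carrier
    neighbour ⊖ f n = f (suc n)
    neighbour ⊙ f n = 1#
    neighbour ⊕ f n = f n

    neighbours : (Fin N → ℕ → Carrier) → Fin N → ℕ → Carrier
    neighbours f i n = ∏ K λ j → neighbour (entry Q i j) (f j) n

    neighbour-at : ∀ s f n {k} → k ≡ next s n → neighbour s f n ≡ (if isLinked s then f k else 1#)
    neighbour-at ⊖ f n refl = refl
    neighbour-at ⊙ f n refl = refl
    neighbour-at ⊕ f n refl = refl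

    module _ (φ : Fin N → ℕ → Carrier)
      (frieze : ∀ i n → φ i n * φ i (suc n) ≡ 1# + neighbours φ i n) where
      open ClusterMutation K {N}

      xSlice : Counters → Fin N → Carrier
      xSlice m i = φ i (m at i)

      private
        module _ {m m' i} (adv : Advance m m' i) where
          open Advance adv

          product : ∀ {x : Fin N → Carrier} → (∀ {j} → j ≢ i → x j ≡ φ j (m at j)) →
                    ∏ K (λ j → choose (isLinked (entry Q i j)) (x j)) ≡ neighbours φ i (m at i)
          product {x} x≡ = ∏-cong lemma
            where
            lemma : ∀ j → choose (isLinked (entry Q i j)) (x j) ≡ neighbour (entry Q i j) (φ j) (m at i)
            lemma j with j ≟ i
            ... | yes refl rewrite loopless j = refl
            ... | no j≢i rewrite x≡ j≢i with isLinked (entry Q i j) in l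
            ...   | true  = sym (trans (neighbour-at (entry Q i j) (φ j) (m at i) (ready j l)) (cong (λ b → if b then φ j (m at j) else 1#) l))
            ...   | false with entry Q i j
            ...     | ⊙ = refl

          none : ∀ s B x → (∀ j → entry B j i ≡ linkSign s (entry Q i j)) → (t : Sign) → t ≢ ⊙ → t ≢ s → column B i t x ≡ 1#
          none s B x col t t≢⊙ t≢s = trans (∏-cong lemma) (∏-1 N)
            where
            unequal : ∀ q → (t ==ˢ linkSign s q) ≡ false
            unequal ⊖ = ==ˢ-≢ t≢s
            unequal ⊙ = ==ˢ-≢ t≢⊙
            unequal ⊕ = ==ˢ-≢ t≢s
            lemma : ∀ j → choose (t ==ˢ entry B j i) (x j) ≡ 1#
            lemma j rewrite col j | unequal (entry Q i j) = refl

          all : ∀ s B x → s ≢ ⊙ → (∀ j → entry B j i ≡ linkSign s (entry Q i j)) →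
                column B i s x ≡ ∏ K (λ j → choose (isLinked (entry Q i j)) (x j))
          all s B x s≢⊙ col = ∏-cong λ j → cong (λ b → choose b (x j)) (trans (cong (s ==ˢ_) (col j)) (equal s s≢⊙ (entry Q i j)))
            where
            equal : ∀ s → s ≢ ⊙ → ∀ q → (s ==ˢ linkSign s q) ≡ isLinked q
            equal ⊖ s≢⊙ ⊖ = refl
            equal ⊖ s≢⊙ ⊙ = refl
            equal ⊖ s≢⊙ ⊕ = refl
            equal ⊙ s≢⊙ q = contradiction refl s≢⊙
            equal ⊕ s≢⊙ ⊖ = refl
            equal ⊕ s≢⊙ ⊙ = refl
            equal ⊕ s≢⊙ ⊕ = refl

      xSlice-forward : ∀ B {m m' i} → (∀ j → entry B j i ≡ linkSign ⊖ (entry Q i j)) → Advance m m' i →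
        ∀ j → xStep B i (xSlice m) j ≡ xSlice m' j
      xSlice-forward B {m} {m'} {i} col adv j with j ≟ i
      ... | no j≢i = cong (φ j) (sym (Advance.fixed adv j≢i))
      -- At a source one of the two columns is empty, and its empty product is the summand 1 of the
      -- frieze relation.
      ... | yes refl = sym (trans (cong (φ i) (Advance.self adv)) (÷-unique (trans (frieze i (m at i)) (sym (cong₂ _+_
        (none adv ⊖ B (xSlice m) col ⊕ (λ ()) (λ ()))
        (trans (all adv ⊖ B (xSlice m) (λ ()) col) (product adv (λ _ → refl))))))))

      xSlice-backward : ∀ B {m m' i} → (∀ j → entry B j i ≡ linkSign ⊕ (entry Q i j)) → Advance m m' i →
        ∀ j → xStep B i (xSlice m') j ≡ xSlice m j
      xSlice-backward B {m} {m'} {i} col adv j with j ≟ i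
      ... | no j≢i = cong (φ j) (Advance.fixed adv j≢i)
      ... | yes refl = sym (÷-unique (begin
        φ i (m' at i) * φ i (m at i)     ≡⟨ cong (λ n → φ i n * φ i (m at i)) (Advance.self adv) ⟩
        φ i (suc (m at i)) * φ i (m at i) ≡⟨ *-comm _ _ ⟩
        φ i (m at i) * φ i (suc (m at i)) ≡⟨ frieze i (m at i) ⟩
        1# + neighbours φ i (m at i)     ≡⟨ +-comm _ _ ⟩
        neighbours φ i (m at i) + 1#     ≡⟨ cong₂ _+_
          (trans (all adv ⊕ B (xSlice m') (λ ()) col) (product adv (λ {j} j≢i → cong (φ j) (Advance.fixed adv j≢i))))
          (none adv ⊕ B (xSlice m') col ⊖ (λ ()) (λ ())) ⟨
        exchange B i (xSlice m')   ∎))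

    module _ (φ : Fin N → ℕ → Carrier)
      (frieze : ∀ i n → φ i n * φ i (suc n) ≡ neighbours (λ j n → 1# + φ j n) i n) where
      open CoefficientMutation K {N}

      private
        choose : Bool → Carrier → Carrier
        choose b x = if b then x else 1#

      numeratorSlice : Counters → Fin N → Carrier
      numeratorSlice m j = ∏ K λ i → choose (ahead m j i) (1# + φ i (m at i))

      -- If all neighbours are ahead of j, this is the next entry of j by the Y-frieze relation; if
      -- none is, it is the inverse of the current entry. In between, each neighbour that advances
      -- contributes one factor, just as coefficients mutate.
      ySlice : Counters → Fin N → Carrier
      ySlice m j = numeratorSlice m j ÷ φ j (m at j)

      private
        module _ {m m' i} (adv : Advance m m' i) where
          open Advance adv

          before : ySlice m i ≡ φ i (suc (m at i))
          before = sym (÷-unique (trans (frieze i (m at i)) (∏-cong lemma)))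
            where
            lemma : ∀ j → neighbour (entry Q i j) (λ n → 1# + φ j n) (m at i) ≡ choose (ahead m i j) (1# + φ j (m at j))
            lemma j with isLinked (entry Q i j) in l
            ... | true = trans (neighbour-at (entry Q i j) (λ n → 1# + φ j n) (m at i) (ready j l)) (cong₂ choose
              (trans l (sym (trans (cong (λ k → k ℕ.≡ᵇ next (entry Q i j) (m at i)) (ready j l)) (≡ᵇ-refl (next (entry Q i j) (m at i)))))) refl)
            ... | false with entry Q i j
            ...   | ⊙ = refl

          after : ySlice m' i ≡ 1# ÷ φ i (suc (m at i))
          after = cong₂ _÷_ (trans (∏-cong lemma) (∏-1 N)) (cong (φ i) self)
            where
            behind : ∀ s n → (next s n ℕ.≡ᵇ next s (suc n)) ≡ false
            behind ⊖ n = ≡ᵇ-suc n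
            behind ⊙ n = ≡ᵇ-suc n
            behind ⊕ n = ≡ᵇ-suc n
            lemma : ∀ j → choose (ahead m' i j) (1# + φ j (m' at j)) ≡ 1#
            lemma j with isLinked (entry Q i j) in l
            ... | false = refl
            ... | true rewrite self with j ≟ i
            ...   | yes refl = contradiction (trans (sym (cong isLinked (loopless j))) l) λ ()
            ...   | no j≢i rewrite fixed j≢i | ready j l | behind (entry Q i j) (m at i) = refl

          others : ∀ {j} → j ≢ i → ySlice m' j ≡
                     choose (isLinked (entry Q i j)) (1# + φ i (suc (m at i))) * ySlice m j
          others {j} j≢i = trans (cong₂ _÷_ (∏-update i (choose (isLinked (entry Q i j)) (1# + φ i (suc (m at i)))) at-i away)
                                            (cong (φ j) (fixed j≢i)))
                                 (*-assoc _ _ _)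
            where
            away : ∀ k → k ≢ i → choose (ahead m' j k) (1# + φ k (m' at k)) ≡ choose (ahead m j k) (1# + φ k (m at k))
            away k k≢i rewrite fixed k≢i | fixed j≢i = refl
            -- Before the step a neighbour i is one entry short of being ahead of j and contributes
            -- 1; the step makes it ahead.
            at-i : choose (ahead m' j i) (1# + φ i (m' at i)) ≡
                   choose (isLinked (entry Q i j)) (1# + φ i (suc (m at i))) * choose (ahead m j i) (1# + φ i (m at i))
            at-i rewrite self | fixed j≢i | antisymmetric i j with entry Q i j | ready j
            ... | ⊙ | _ = sym (*-identityʳ _)
            ... | ⊕ | r rewrite r refl | ≡ᵇ-refl (m at i) | ≡ᵇ-suc (m at i) = sym (*-identityʳ _)
            ... | ⊖ | r rewrite r refl | ≡ᵇ-refl (m at i) | ≡ᵇ-suc (m at i) = sym (*-identityʳ _)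

      ySlice-forward : ∀ B {m m' i} → (∀ j → entry B j i ≡ linkSign ⊖ (entry Q i j)) → Advance m m' i →
        ∀ j → yStep B i (ySlice m) j ≡ ySlice m' j
      ySlice-forward B {m} {m'} {i} col adv j with j ≟ i
      ... | yes refl = trans (cong _⁻¹ (before adv)) (trans (sym (*-identityˡ _)) (sym (after adv)))
      ... | no j≢i = trans (*-comm _ _) (trans (cong (_* ySlice m j) lemma) (sym (others adv j≢i)))
        where
        lemma : factor (entry B j i) (ySlice m i) ≡ choose (isLinked (entry Q i j)) (1# + φ i (suc (m at i)))
        lemma rewrite col j | before adv with entry Q i j
        ... | ⊖ = refl
        ... | ⊙ = refl
        ... | ⊕ = refl

      ySlice-backward : ∀ B {m m' i} → (∀ j → entry B j i ≡ linkSign ⊕ (entry Q i j)) → Advance m m' i →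
        ∀ j → yStep B i (ySlice m') j ≡ ySlice m j
      ySlice-backward B {m} {m'} {i} col adv j with j ≟ i
      ... | yes refl = trans (cong _⁻¹ (trans (after adv) (*-identityˡ _))) (trans (⁻¹-involutive _) (sym (before adv)))
      ... | no j≢i = begin
        ySlice m' j * factor (entry B j i) (ySlice m' i)
          ≡⟨ cong₂ _*_ (others adv j≢i) refl ⟩
        t * ySlice m j * f
          ≡⟨ just-injective (solve 3 (λ t s f → t :* s :* f := (t :* f) :* s) refl (just t) (just (ySlice m j)) (just f)) ⟩
        t * f * ySlice m j ≡⟨ cong (_* ySlice m j) lemma ⟩
        1# * ySlice m j    ≡⟨ *-identityˡ _ ⟩
        ySlice m j         ∎
        where
        t = choose (isLinked (entry Q i j)) (1# + φ i (suc (m at i)))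
        f = factor (entry B j i) (ySlice m' i)
        unit : ∀ z → (1# + z) * factor ⊕ (1# ÷ z) ≡ 1#
        unit z = trans (cong ((1# + z) *_) (factor-÷ ⊕ 1# z (+-comm z 1#))) (÷-* 1# (1# + z))
        lemma : t * f ≡ 1#
        lemma rewrite col j | after adv with entry Q i j
        ... | ⊖ = unit _
        ... | ⊙ = *-identityˡ _
        ... | ⊕ = unit _

      -- The children of j determine the numerator of a constant slice, so that φ j is recovered from the slice
      -- by induction on the height.
      ySlice-recover : (height : Fin N → ℕ) → (∀ j i → entry Q j i ≡ ⊕ → height i ℕ.< height j) →
        (σ : Fin N → Fin N) → Involutive σ → Related σ Q Q → ∀ c →
        (∀ j → ySlice (Vec.replicate N c) (σ j) ≡ ySlice (Vec.replicate N 0) j) →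
        ∀ j → φ (σ j) c ≡ φ j 0
      ySlice-recover height descends σ inv rel c slices≡ j = go (suc (height j)) j ℕ.≤-refl
        where
        constant : ∀ n s (f : ℕ → Carrier) → choose (isLinked s ∧ (n ℕ.≡ᵇ next s n)) (f n) ≡ choose (s ==ˢ ⊕) (f n)
        constant n ⊖ f rewrite ≡ᵇ-suc n = refl
        constant n ⊙ f = refl
        constant n ⊕ f rewrite ≡ᵇ-refl n = refl

        numerator-constant : ∀ n j → numeratorSlice (Vec.replicate N n) j ≡ ∏ K λ i → choose (entry Q j i ==ˢ ⊕) (1# + φ i n)
        numerator-constant n j = ∏-cong λ i → trans (cong₂ (λ u v → choose (isLinked (entry Q j i) ∧ (u ℕ.≡ᵇ next (entry Q j i) v)) (1# + φ i u))
          (lookup-replicate i n) (lookup-replicate j n)) (constant n (entry Q j i) (λ n → 1# + φ i n))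

        go : ∀ h j → height j ℕ.< h → φ (σ j) c ≡ φ j 0
        go (suc h) j (ℕ.s≤s j≤h) = ⁻¹-injective (*-cancelˡ (numeratorSlice (Vec.replicate N 0) j) (begin
          numeratorSlice (Vec.replicate N 0) j * φ (σ j) c ⁻¹     ≡⟨ cong (_* φ (σ j) c ⁻¹) numerators ⟨
          numeratorSlice (Vec.replicate N c) (σ j) * φ (σ j) c ⁻¹ ≡⟨ cong (λ n → numeratorSlice (Vec.replicate N c) (σ j) ÷ φ (σ j) n) (lookup-replicate (σ j) c) ⟨
          ySlice (Vec.replicate N c) (σ j)              ≡⟨ slices≡ j ⟩
          ySlice (Vec.replicate N 0) j                  ≡⟨ cong (λ n → numeratorSlice (Vec.replicate N 0) j ÷ φ j n) (lookup-replicate j 0) ⟩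
          numeratorSlice (Vec.replicate N 0) j * φ j 0 ⁻¹         ∎))
          where
          child : ∀ i → choose (entry Q (σ j) (σ i) ==ˢ ⊕) (1# + φ (σ i) c) ≡ choose (entry Q j i ==ˢ ⊕) (1# + φ i 0)
          child i rewrite Related.entry-≡ rel j i with entry Q j i in e
          ... | ⊖ = refl
          ... | ⊙ = refl
          ... | ⊕ = cong (1# +_) (go h i (ℕ.≤-trans (descends j i e) j≤h))
          numerators : numeratorSlice (Vec.replicate N c) (σ j) ≡ numeratorSlice (Vec.replicate N 0) j
          numerators = begin
            numeratorSlice (Vec.replicate N c) (σ j)                          ≡⟨ numerator-constant c (σ j) ⟩
            ∏ K (λ i → choose (entry Q (σ j) i ==ˢ ⊕) (1# + φ i c))            ≡⟨ ∏-reindex (mk↔ₛ′ σ σ inv inv) _ ⟩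
            ∏ K (λ i → choose (entry Q (σ j) (σ i) ==ˢ ⊕) (1# + φ (σ i) c))    ≡⟨ ∏-cong child ⟩
            ∏ K (λ i → choose (entry Q j i ==ˢ ⊕) (1# + φ i 0))                ≡⟨ numerator-constant 0 j ⟨
            numeratorSlice (Vec.replicate N 0) j                              ∎

-- Periodicity in types E₆, E₇ and E₈

antisymmetricᵇ : ∀ {N} → Exchange N → Bool
antisymmetricᵇ Q = allᵇ λ i → allᵇ λ j → entry Q j i ==ˢ opp (entry Q i j)

antisymmetricᵇ-sound : ∀ {N} (Q : Exchange N) → antisymmetricᵇ Q ≡ true → ∀ i j → entry Q j i ≡ opp (entry Q i j)
antisymmetricᵇ-sound Q h i j = ==ˢ-sound _ _ (allᵇ-sound (λ j → entry Q j i ==ˢ opp (entry Q i j))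
  (allᵇ-sound (λ i → allᵇ λ j → entry Q j i ==ˢ opp (entry Q i j)) h i) j)

involutiveᵇ : ∀ {N} → (Fin N → Fin N) → Bool
involutiveᵇ σ = allᵇ λ i → ⌊ σ (σ i) ≟ i ⌋

involutiveᵇ-sound : ∀ {N} (σ : Fin N → Fin N) → involutiveᵇ σ ≡ true → Involutive σ
involutiveᵇ-sound σ h i = ⌊≟⌋-sound (allᵇ-sound (λ i → ⌊ σ (σ i) ≟ i ⌋) h i)

-- The length of a longest directed path starting at a vertex of E_n.
height : ℕ → ℕ
height 0 = 0
height 1 = 0
height 2 = 1
height 3 = 4
height 4 = 3
height 5 = 2
height 6 = 1
height _ = 0

descendsᵇ : ∀ {N} → Exchange N → Bool
descendsᵇ Q = allᵇ λ j → allᵇ λ i → not (entry Q j i ==ˢ ⊕) ∨ (height (toℕ i) ℕ.<ᵇ height (toℕ j))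

descendsᵇ-sound : ∀ {N} (Q : Exchange N) → descendsᵇ Q ≡ true → ∀ j i → entry Q j i ≡ ⊕ → height (toℕ i) ℕ.< height (toℕ j)
descendsᵇ-sound Q h j i e with allᵇ-sound (λ i → not (entry Q j i ==ˢ ⊕) ∨ (height (toℕ i) ℕ.<ᵇ height (toℕ j)))
  (allᵇ-sound (λ j → allᵇ λ i → not (entry Q j i ==ˢ ⊕) ∨ (height (toℕ i) ℕ.<ᵇ height (toℕ j))) h j) i
... | ok rewrite e = ℕ.<ᵇ⇒< _ _ (Equivalence.from Bool.T-≡ ok)

module TreeFrieze {N} (σ : Fin N → Fin N) (c fuel : ℕ) (w₁ w₂ : Word N) (ms : List Move)
  (Q : Exchange N)
  (antisymmetric : antisymmetricᵇ Q ≡ true) (descends : descendsᵇ Q ≡ true)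
  (involutive : involutiveᵇ σ ≡ true) (related : relatedᵇ σ Q Q ≡ true)
  (rewrites : rewritesToᵇ (rewriteWord fuel Q w₁ ms) w₂ σ ≡ true) where

  open Slices Q (antisymmetricᵇ-sound Q antisymmetric) public

  module _ (lowers-ok : lowersᵇ Q (Vec.replicate N 1) w₁ ≡ true)
           (lowers-end : lowers (Vec.replicate N 1) w₁ ≡ Vec.replicate N 0)
           (raises-ok : raisesᵇ Q (Vec.replicate N 1) w₂ ≡ true)
           (raises-end : raises (Vec.replicate N 1) w₂ ≡ Vec.replicate N c)
           {ℓ} (K : SemiField ℓ) where
    open SemiField K

    frieze-periodic : ∀ φ → (∀ i n → φ i n * φ i (suc n) ≡ 1# + neighbours K φ i n) →
      ∀ j → φ (σ j) c ≡ φ j 0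
    frieze-periodic φ frieze j = subst (λ k → φ (σ j) k ≡ φ j 0) (lookup-replicate (σ j) c)
      (subst (λ k → φ (σ j) (Vec.replicate N c at σ j) ≡ φ j k) (lookup-replicate j 0)
        (compare-slices (ClusterMutation.clusterMutation K) (xSlice K φ frieze)
          (xSlice-forward K φ frieze) (xSlice-backward K φ frieze)
          fuel w₁ w₂ ms σ c rewrites lowers-ok lowers-end raises-ok raises-end j))

    Y-frieze-periodic : ∀ φ → (∀ i n → φ i n * φ i (suc n) ≡ neighbours K (λ j n → 1# + φ j n) i n) →
      ∀ j → φ (σ j) c ≡ φ j 0
    Y-frieze-periodic φ frieze = ySlice-recover K φ frieze (λ i → height (toℕ i))
      (descendsᵇ-sound Q descends) σ (involutiveᵇ-sound σ involutive) (relatedᵇ-sound σ Q Q related) c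
      (compare-slices (CoefficientMutation.coefficientMutation K) (ySlice K φ frieze)
        (ySlice-forward K φ frieze) (ySlice-backward K φ frieze)
        fuel w₁ w₂ ms σ c rewrites lowers-ok lowers-end raises-ok raises-end)

-- The slices reached, 7, 10 and 16, are 1 + h / 2: both words start at slice 1, and the forward one
-- makes h / 2 rounds.
module E₆-Frieze = TreeFrieze (star E₆) 7 258 (List.reverse round₆) (replicateWord 6 round₆) moves₆
  (treeExchange 6) refl refl refl refl rewrites₆
module E₇-Frieze = TreeFrieze (λ i → i) 10 647 (List.reverse round₇) (replicateWord 9 round₇) moves₇
  (treeExchange 7) refl refl refl refl rewrites₇
module E₈-Frieze = TreeFrieze (λ i → i) 16 1839 (List.reverse round₈) (replicateWord 15 round₈) moves₈
  (treeExchange 8) refl refl refl refl rewrites₈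

module _ {ℓ} (K : SemiField ℓ) where
  E₆-frieze-periodic = E₆-Frieze.frieze-periodic refl refl refl refl K
  E₆-Y-frieze-periodic = E₆-Frieze.Y-frieze-periodic refl refl refl refl K
  E₇-frieze-periodic = E₇-Frieze.frieze-periodic refl refl refl refl K
  E₇-Y-frieze-periodic = E₇-Frieze.Y-frieze-periodic refl refl refl refl K
  E₈-frieze-periodic = E₈-Frieze.frieze-periodic refl refl refl refl K
  E₈-Y-frieze-periodic = E₈-Frieze.Y-frieze-periodic refl refl refl refl K

-- Types A and D

module Intervals {c} (K : SemiField c) (w : ℕ → SemiField.Carrier K) where
  open SemiField K
  open SemiFieldProperties K
  open ≡-Reasoning

  -- There are d + 1 summands: if `w k` is the distance from point k to point k + 1 of a line,
  -- `S i d` is the distance from point i to point i + d + 1.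
  S : ℕ → ℕ → Carrier
  S i zero    = w i
  S i (suc d) = S i d + w (suc (d ℕ.+ i))

  S-left : ∀ i d → S i (suc d) ≡ w i + S (suc i) d
  S-left i zero    = refl
  S-left i (suc d) = trans (cong₂ _+_ (S-left i d) (cong (λ k → w (suc k)) (sym (ℕ.+-suc d i)))) (+-assoc _ _ _)

  -- Four points of a line with successive distances a = `w i`, X = `S (suc i) d` and b =
  -- `w (suc j)` satisfy (a + X)(X + b) = (a + X + b) X + a b. All frieze relations of types A and D
  -- come down to this.
  ptolemy : ∀ i d {j} → suc d ℕ.+ i ≡ j → S i (suc d) * S (suc i) (suc d) ≡ S i (suc (suc d)) * S (suc i) d + w i * w (suc j)
  ptolemy i d refl = begin
    S i (suc d) * (S (suc i) d + w (suc (d ℕ.+ suc i)))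
      ≡⟨ cong₂ (λ a k → a * (S (suc i) d + w (suc k))) (S-left i d) (ℕ.+-suc d i) ⟩
    (w i + S (suc i) d) * (S (suc i) d + w (suc (suc (d ℕ.+ i))))
      ≡⟨ just-injective (solve 3 (λ a X b → (a :+ X) :* (X :+ b) := (a :+ X :+ b) :* X :+ a :* b) refl
           (just (w i)) (just (S (suc i) d)) (just (w (suc (suc (d ℕ.+ i)))))) ⟩
    (w i + S (suc i) d + w (suc (suc (d ℕ.+ i)))) * S (suc i) d + w i * w (suc (suc (d ℕ.+ i)))
      ≡⟨ cong (λ a → (a + w (suc (suc (d ℕ.+ i)))) * S (suc i) d + w i * w (suc (suc (d ℕ.+ i)))) (S-left i d) ⟨
    S i (suc (suc d)) * S (suc i) d + w i * w (suc (suc (d ℕ.+ i))) ∎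

-- The entries of a frieze of type A_n are the λ-lengths of the diagonals of an (n + 3)-gon; in terms of the
-- lengths y 0, ..., y (n + 1) of the diagonals at one vertex (including the two sides), the diagonal from m to
-- m + p + 1 has length y m * y (m + p + 1) * (w m + ⋯ + w (m + p)) with w k = 1 / (y k * y (k + 1)).
module FriezeA {c} (K : SemiField c) (n : ℕ) (F : ℕ → ℕ → SemiField.Carrier K) where
  open SemiField K
  open SemiFieldProperties K
  open ≡-Reasoning

  module _ (F-bottom : ∀ m → F 0 m ≡ 1#) (F-top : ∀ m → F (suc n) m ≡ 1#)
    (frieze : ∀ p m → p ℕ.< n → F (suc p) m * F (suc p) (suc m) ≡ 1# + F (suc (suc p)) m * F p (suc m)) where

    private
      y w : ℕ → Carrier
      y p = F p 0
      w k = (y k * y (suc k)) ⁻¹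

      open Intervals K w

      unit : ∀ k → y k * y (suc k) * w k ≡ 1#
      unit k = inverseʳ _

      interior : ∀ m p j → p ℕ.+ m ≡ j → j ℕ.≤ n → F p (suc m) ≡ y m * y (suc j) * S m p
      interior m zero j refl j≤n = trans (F-bottom (suc m)) (sym (unit m))
      interior zero (suc p) j eq j≤n = *-cancelˡ (y (suc p)) (begin
        y (suc p) * F (suc p) 1
          ≡⟨ frieze p 0 (subst (ℕ._≤ n) (sym j≡) j≤n) ⟩
        1# + y (suc (suc p)) * F p 1
          ≡⟨ cong₂ (λ o z → o + y (suc (suc p)) * z) (sym (unit (suc p)))
               (interior zero p p (ℕ.+-identityʳ p) (ℕ.<⇒≤ (subst (ℕ._≤ n) (sym j≡) j≤n))) ⟩
        y (suc p) * y (suc (suc p)) * w (suc p) + y (suc (suc p)) * (y 0 * y (suc p) * S 0 p)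
          ≡⟨ cong (λ o → y (suc p) * y (suc (suc p)) * w (suc p) + y (suc (suc p)) * (o * y (suc p) * S 0 p)) (F-bottom 0) ⟩
        y (suc p) * y (suc (suc p)) * w (suc p) + y (suc (suc p)) * (1# * y (suc p) * S 0 p)
          ≡⟨ just-injective (solve 4 (λ a b s w → a :* b :* w :+ b :* (con 1 :* a :* s) := a :* (con 1 :* b :* (s :+ w))) refl
               (just (y (suc p))) (just (y (suc (suc p)))) (just (S 0 p)) (just (w (suc p)))) ⟩
        y (suc p) * (1# * y (suc (suc p)) * (S 0 p + w (suc p)))
          ≡⟨ cong₂ (λ o k → y (suc p) * (o * y (suc (suc p)) * (S 0 p + w (suc k)))) (F-bottom 0) (ℕ.+-identityʳ p) ⟨
        y (suc p) * (y 0 * y (suc (suc p)) * S 0 (suc p))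
          ≡⟨ cong (λ k → y (suc p) * (y 0 * y (suc k) * S 0 (suc p))) j≡ ⟩
        y (suc p) * (y 0 * y (suc j) * S 0 (suc p)) ∎)
        where
        j≡ : suc p ≡ j
        j≡ = trans (cong suc (sym (ℕ.+-identityʳ p))) eq
      interior (suc m) (suc p) (suc j) eq j<n = *-cancelˡ (F (suc p) (suc m)) (begin
        F (suc p) (suc m) * F (suc p) (suc (suc m))
          ≡⟨ frieze p (suc m) (ℕ.≤-trans (ℕ.≤-trans (ℕ.m≤m+n (suc p) (suc m)) (ℕ.≤-reflexive eq)) j<n) ⟩
        1# + F (suc (suc p)) (suc m) * F p (suc (suc m))
          ≡⟨ cong₂ (λ a b → 1# + a * b) (interior m (suc (suc p)) (suc j) (cong suc eq₁) j<n)
               (interior (suc m) p j (ℕ.suc-injective eq) (ℕ.<⇒≤ j<n)) ⟩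
        1# + (y m * y₃ * S m (suc (suc p))) * (y (suc m) * y₂ * S (suc m) p)
          -- The summand 1 is the product of two sides of the polygon, which have length 1 by
          -- `unit m` and `unit (suc j)`. All terms then share a common factor, and `ptolemy`
          -- remains.
          ≡⟨ cong (_+ (y m * y₃ * S m (suc (suc p))) * (y (suc m) * y₂ * S (suc m) p))
               (trans (sym (*-identityˡ 1#)) (sym (cong₂ _*_ (unit m) (unit (suc j))))) ⟩
        (y m * y (suc m) * w m) * (y₂ * y₃ * w (suc j)) + (y m * y₃ * S m (suc (suc p))) * (y (suc m) * y₂ * S (suc m) p)
          ≡⟨ just-injective (solve 8 (λ a b c d w w' s t →
               (a :* b :* w) :* (c :* d :* w') :+ (a :* d :* s) :* (b :* c :* t) := a :* c :* (b :* d) :* (s :* t :+ w :* w')) refl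
               (just (y m)) (just (y (suc m))) (just y₂) (just y₃) (just (w m)) (just (w (suc j)))
               (just (S m (suc (suc p)))) (just (S (suc m) p))) ⟩
        y m * y₂ * (y (suc m) * y₃) * (S m (suc (suc p)) * S (suc m) p + w m * w (suc j))
          ≡⟨ cong (y m * y₂ * (y (suc m) * y₃) *_) (ptolemy m p eq₁) ⟨
        y m * y₂ * (y (suc m) * y₃) * (S m (suc p) * S (suc m) (suc p))
          ≡⟨ just-injective (solve 4 (λ u v s t → u :* v :* (s :* t) := u :* s :* (v :* t)) refl
               (just (y m * y₂)) (just (y (suc m) * y₃)) (just (S m (suc p))) (just (S (suc m) (suc p)))) ⟩
        y m * y₂ * S m (suc p) * (y (suc m) * y₃ * S (suc m) (suc p))
          ≡⟨ cong (_* (y (suc m) * y₃ * S (suc m) (suc p))) (interior m (suc p) j eq₁ (ℕ.<⇒≤ j<n)) ⟨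
        F (suc p) (suc m) * (y (suc m) * y₃ * S (suc m) (suc p)) ∎)
        where
        eq₁ : suc p ℕ.+ m ≡ j
        eq₁ = trans (sym (ℕ.+-suc p m)) (ℕ.suc-injective eq)
        y₂ = y (suc j)
        y₃ = y (suc (suc j))

      -- The second end of the diagonal has come round to the base vertex, so this is an initial
      -- diagonal read from its other end. This is the glide reflection.
      boundary : ∀ m p → p ℕ.+ m ≡ suc n → F p (suc m) ≡ y m
      boundary m zero refl = trans (F-bottom _) (sym (F-top 0))
      boundary zero (suc p) eq = trans (cong (λ k → F k 1) (trans (sym (ℕ.+-identityʳ (suc p))) eq))
                                       (trans (F-top 1) (sym (F-bottom 0)))
      boundary (suc m) (suc p) eq = *-cancelˡ (F (suc p) (suc m)) (begin
        F (suc p) (suc m) * F (suc p) (suc (suc m))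
          ≡⟨ frieze p (suc m) (ℕ.≤-trans (ℕ.m≤m+n (suc p) m) (ℕ.≤-reflexive eq₁)) ⟩
        1# + F (suc (suc p)) (suc m) * F p (suc (suc m))
          ≡⟨ cong₂ (λ a b → 1# + a * b) (boundary m (suc (suc p)) (cong suc eq₁))
               (interior (suc m) p n (ℕ.suc-injective eq) ℕ.≤-refl) ⟩
        1# + y m * (y (suc m) * y (suc n) * S (suc m) p)
          ≡⟨ cong₂ (λ o z → o + y m * (y (suc m) * z * S (suc m) p)) (sym (unit m)) (F-top 0) ⟩
        y m * y (suc m) * w m + y m * (y (suc m) * 1# * S (suc m) p)
          ≡⟨ just-injective (solve 4 (λ a b w s → a :* b :* w :+ a :* (b :* con 1 :* s) := a :* con 1 :* (w :+ s) :* b) refl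
               (just (y m)) (just (y (suc m))) (just (w m)) (just (S (suc m) p))) ⟩
        y m * 1# * (w m + S (suc m) p) * y (suc m)
          ≡⟨ cong₂ (λ o s → y m * o * s * y (suc m)) (F-top 0) (S-left m p) ⟨
        y m * y (suc n) * S m (suc p) * y (suc m)
          ≡⟨ cong (_* y (suc m)) (interior m (suc p) n eq₁ ℕ.≤-refl) ⟨
        F (suc p) (suc m) * y (suc m) ∎)
        where
        eq₁ : suc p ℕ.+ m ≡ n
        eq₁ = ℕ.suc-injective (trans (sym (cong suc (ℕ.+-suc p m))) eq)

    friezeA-periodic : ∀ p q → p ℕ.+ q ≡ suc n → F q (suc p) ≡ F p 0
    friezeA-periodic p q eq = boundary p q (trans (ℕ.+-comm q p) eq)

-- The entries of a Y-frieze of type A_n are the cross ratios of the quadrilaterals m, m + 1, m + p + 1, m + p + 2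
-- on n + 3 points; with one of the points at infinity, w k is the distance between consecutive ones.
module YFriezeA {c} (K : SemiField c) (n : ℕ) (g E : ℕ → ℕ → SemiField.Carrier K) where
  open SemiField K
  open SemiFieldProperties K
  open ≡-Reasoning

  module _ (E-bottom : ∀ m → E 0 m ≡ 1#) (E-top : ∀ m → E (suc n) m ≡ 1#)
    (E-inner : ∀ p m → p ℕ.< n → E (suc p) m ≡ 1# + g (suc p) m)
    (frieze : ∀ p m → p ℕ.< n → g (suc p) m * g (suc p) (suc m) ≡ E (suc (suc p)) m * E p (suc m)) where

    private
      s w : ℕ → Carrier
      s zero    = 1#
      s (suc p) = s p + s p ÷ g (suc p) 0
      w zero    = 1#
      -- At time 0 the first point of the quadrilateral is the one at infinity, so `g (suc p) 0` is
      -- the position of point p + 1 divided by the gap following it. This determines all gaps from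
      -- the initial slice, up to `w 0`, the unit of length.
      w (suc p) = s p ÷ g (suc p) 0

      open Intervals K w

      S≡s : ∀ p → S 0 p ≡ s p
      S≡s zero    = refl
      S≡s (suc p) = cong₂ _+_ (S≡s p) (cong (λ k → w (suc k)) (ℕ.+-identityʳ p))

      g₀ : ∀ p → g (suc p) 0 * w (suc p) ≡ s p
      g₀ p = ÷-* _ _

      E₀ : ∀ p → p ℕ.≤ n → E p 0 * w p ≡ s p
      E₀ zero    p≤n = trans (*-identityʳ _) (E-bottom 0)
      E₀ (suc p) p≤n = begin
        E (suc p) 0 * w (suc p)          ≡⟨ cong (_* w (suc p)) (E-inner p 0 p≤n) ⟩
        (1# + g (suc p) 0) * w (suc p)   ≡⟨ 1+-* _ _ ⟩
        g (suc p) 0 * w (suc p) + w (suc p) ≡⟨ cong (_+ w (suc p)) (g₀ p) ⟩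
        s p + w (suc p) ∎

      shift : ∀ {m p j} → suc p ℕ.+ suc m ≡ suc j → suc p ℕ.+ m ≡ j
      shift {m} {p} eq = trans (sym (ℕ.+-suc p m)) (ℕ.suc-injective eq)

      drop-0 : ∀ {p j} → suc p ℕ.+ 0 ≡ j → suc p ≡ j
      drop-0 {p} eq = trans (cong suc (sym (ℕ.+-identityʳ p))) eq

      bound : ∀ {p m j} → suc p ℕ.+ m ≡ j → j ℕ.≤ n → p ℕ.< n
      bound {p} {m} eq j≤n = ℕ.≤-trans (ℕ.m≤m+n (suc p) m) (ℕ.≤-trans (ℕ.≤-reflexive eq) j≤n)

      -- The three kinds of quadrilaterals: in `g₁` all points are finite; in `g₂` the last is at
      -- infinity, and the two factors containing it cancel; in `g₃` the third is at infinity and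
      -- the last is again point 0. The value in `g₃` is that of an initial entry in `g₀`. The
      -- lemmas on E are the same with 1 added, by `ptolemy` or by concatenating intervals.
      g₁ : ∀ m p j → suc p ℕ.+ m ≡ j → j ℕ.< n →
           g (suc p) (suc m) * (w m * w (suc j)) ≡ S m (suc (suc p)) * S (suc m) p
      E₁ : ∀ m p j → p ℕ.+ m ≡ j → j ℕ.< n → E p (suc m) * (w m * w (suc j)) ≡ S m p * S (suc m) p
      g₂ : ∀ m p → suc p ℕ.+ m ≡ n → g (suc p) (suc m) * w m ≡ S (suc m) p
      E₂ : ∀ m p → p ℕ.+ m ≡ n → E p (suc m) * w m ≡ S m p
      g₃ : ∀ m p → suc p ℕ.+ suc m ≡ suc n → g (suc p) (suc (suc m)) * w (suc m) ≡ s m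
      E₃ : ∀ m p → suc p ℕ.+ m ≡ suc n → E (suc p) (suc m) * w m ≡ s m

      g₁ zero p j eq j<n = quotient-step (frieze p 0 (bound eq (ℕ.<⇒≤ j<n))) (g₀ p) (E₀ (suc (suc p)) (subst (ℕ._< n) (sym (drop-0 eq)) j<n))
        (E₁ zero p p (ℕ.+-identityʳ p) (bound eq (ℕ.<⇒≤ j<n)))
        (subst (λ j → s p * (S 0 (suc (suc p)) * S 1 p) * (w (suc (suc p)) * (w 0 * w (suc p)))
                      ≡ w (suc p) * (w 0 * w (suc j)) * (s (suc (suc p)) * (S 0 p * S 1 p))) (drop-0 eq)
          (trans (cong₂ (λ u v → u * (v * S 1 p) * (w (suc (suc p)) * (w 0 * w (suc p)))) (sym (S≡s p)) (S≡s (suc (suc p))))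
            (just-injective (solve 6 (λ a b c d e f → a :* (b :* c) :* (d :* (e :* f)) := f :* (e :* d) :* (b :* (a :* c))) refl
              (just (S 0 p)) (just (s (suc (suc p)))) (just (S 1 p)) (just (w (suc (suc p)))) (just (w 0)) (just (w (suc p)))))))
      g₁ (suc m) p (suc j) eq j<n = quotient-step (frieze p (suc m) (bound eq (ℕ.<⇒≤ j<n)))
        (g₁ m p j eq₁ (ℕ.<⇒≤ j<n)) (E₁ m (suc (suc p)) (suc j) (cong suc eq₁) j<n)
        (E₁ (suc m) p j (ℕ.suc-injective eq) (ℕ.<⇒≤ j<n))
        (just-injective (solve 8 (λ a b c d w x y z → a :* b :* (c :* d) :* (w :* z :* (x :* y)) := w :* y :* (x :* z) :* (a :* c :* (b :* d))) refl
          (just (S m (suc (suc p)))) (just (S (suc m) p)) (just (S (suc m) (suc (suc p)))) (just (S (suc (suc m)) p))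
          (just (w m)) (just (w (suc m))) (just (w (suc j))) (just (w (suc (suc j))))))
        where
        eq₁ : suc p ℕ.+ m ≡ j
        eq₁ = shift eq

      E₁ m zero j refl j<n = trans (cong (_* (w m * w (suc m))) (E-bottom (suc m))) (*-identityˡ _)
      E₁ m (suc p) j eq j<n = begin
        E (suc p) (suc m) * (w m * w (suc j))        ≡⟨ cong (_* (w m * w (suc j))) (E-inner p (suc m) (bound eq (ℕ.<⇒≤ j<n))) ⟩
        (1# + g (suc p) (suc m)) * (w m * w (suc j)) ≡⟨ 1+-* _ _ ⟩
        g (suc p) (suc m) * (w m * w (suc j)) + w m * w (suc j) ≡⟨ cong (_+ w m * w (suc j)) (g₁ m p j eq j<n) ⟩
        S m (suc (suc p)) * S (suc m) p + w m * w (suc j) ≡⟨ ptolemy m p eq ⟨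
        S m (suc p) * S (suc m) (suc p) ∎

      g₂ zero p eq = quotient-step (frieze p 0 (bound eq ℕ.≤-refl)) (g₀ p)
        (trans (*-identityʳ _) (trans (cong (λ k → E (suc k) 0) (drop-0 eq)) (E-top 0)))
        (E₁ zero p p (ℕ.+-identityʳ p) (bound eq ℕ.≤-refl))
        (trans (cong (λ u → u * S 1 p * (1# * (w 0 * w (suc p)))) (sym (S≡s p)))
          (just-injective (solve 4 (λ a b c d → a :* b :* (con 1 :* (c :* d)) := d :* c :* (con 1 :* (a :* b))) refl
            (just (S 0 p)) (just (S 1 p)) (just (w 0)) (just (w (suc p))))))
      g₂ (suc m) p eq = quotient-step (frieze p (suc m) (bound eq ℕ.≤-refl))
        (g₁ m p (p ℕ.+ suc m) eq₁ (ℕ.≤-reflexive eq))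
        (E₂ m (suc (suc p)) (trans (cong suc eq₁) eq))
        (E₁ (suc m) p (p ℕ.+ suc m) refl (ℕ.≤-reflexive eq))
        (just-injective (solve 6 (λ a b c w x y → a :* b :* c :* (w :* (x :* y)) := w :* y :* x :* (a :* (b :* c))) refl
          (just (S m (suc (suc p)))) (just (S (suc m) p)) (just (S (suc (suc m)) p))
          (just (w m)) (just (w (suc m))) (just (w (suc (p ℕ.+ suc m))))))
        where
        eq₁ : suc p ℕ.+ m ≡ p ℕ.+ suc m
        eq₁ = sym (ℕ.+-suc p m)

      E₂ m zero refl = trans (cong (_* w m) (E-bottom (suc m))) (*-identityˡ _)
      E₂ m (suc p) eq = begin
        E (suc p) (suc m) * w m          ≡⟨ cong (_* w m) (E-inner p (suc m) (bound eq ℕ.≤-refl)) ⟩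
        (1# + g (suc p) (suc m)) * w m   ≡⟨ 1+-* _ _ ⟩
        g (suc p) (suc m) * w m + w m    ≡⟨ cong (_+ w m) (g₂ m p eq) ⟩
        S (suc m) p + w m                ≡⟨ +-comm _ _ ⟩
        w m + S (suc m) p                ≡⟨ S-left m p ⟨
        S m (suc p)                      ∎

      g₃ m p eq = quotient-step (frieze p (suc m) (bound eq₁ ℕ.≤-refl))
        (g₂ m p eq₁) (E₃ m (suc p) (cong suc eq₁)) (E₂ (suc m) p (ℕ.suc-injective eq))
        (just-injective (solve 4 (λ a b w x → a :* b :* (w :* x) := w :* x :* (b :* a)) refl
          (just (S (suc m) p)) (just (s m)) (just (w m)) (just (w (suc m)))))
        where
        eq₁ : suc p ℕ.+ m ≡ n
        eq₁ = shift eq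

      E₃ zero p eq = trans (*-identityʳ _) (trans (cong (λ k → E k 1) (trans (sym (ℕ.+-identityʳ (suc p))) eq)) (E-top 1))
      E₃ (suc m) p eq = begin
        E (suc p) (suc (suc m)) * w (suc m)          ≡⟨ cong (_* w (suc m)) (E-inner p (suc (suc m)) (bound (shift eq) ℕ.≤-refl)) ⟩
        (1# + g (suc p) (suc (suc m))) * w (suc m)   ≡⟨ 1+-* _ _ ⟩
        g (suc p) (suc (suc m)) * w (suc m) + w (suc m) ≡⟨ cong (_+ w (suc m)) (g₃ m p eq) ⟩
        s m + w (suc m) ∎

    Y-friezeA-periodic : ∀ p q → suc p ℕ.+ suc q ≡ suc n → g (suc q) (suc (suc p)) ≡ g (suc p) 0
    Y-friezeA-periodic p q eq = *-cancelˡ (w (suc p)) (trans (*-comm _ _) (trans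
      (trans (g₃ p q (trans (ℕ.+-comm (suc q) (suc p)) eq)) (sym (g₀ p))) (*-comm _ _)))

-- Type D

module QuasiPeriodic {c} (K : SemiField c) (N : ℕ) {{_ : ℕ.NonZero N}} where
  open SemiField K
  open SemiFieldProperties K
  open ≡-Reasoning

  extend : Carrier → (ℕ → Carrier) → ℕ → Carrier
  extend ρ w k = w (k ℕ.% N) * _^_ K ρ (k ℕ./ N)

  extend-< : ∀ ρ w {k} → k ℕ.< N → extend ρ w k ≡ w k
  extend-< ρ w k<N = trans (cong₂ (λ i e → w i * _^_ K ρ e) (ℕ.m<n⇒m%n≡m k<N) (ℕ.m<n⇒m/n≡0 k<N)) (*-identityʳ _)

  extend-shift : ∀ ρ w k → extend ρ w (N ℕ.+ k) ≡ ρ * extend ρ w k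
  extend-shift ρ w k = begin
    w ((N ℕ.+ k) ℕ.% N) * _^_ K ρ ((N ℕ.+ k) ℕ./ N)
      ≡⟨ cong₂ (λ i e → w i * _^_ K ρ e) (trans (cong (ℕ._% N) (ℕ.+-comm N k)) (ℕ.[m+n]%n≡m%n k N))
           (trans (ℕ.m/n≡1+[m∸n]/n (ℕ.m≤m+n N k)) (cong (λ j → suc (j ℕ./ N)) (ℕ.m+n∸m≡n N k))) ⟩
    w (k ℕ.% N) * (ρ * _^_ K ρ (k ℕ./ N))
      ≡⟨ just-injective (solve 3 (λ a b c → a :* (b :* c) := b :* (a :* c)) refl
           (just (w (k ℕ.% N))) (just ρ) (just (_^_ K ρ (k ℕ./ N)))) ⟩
    ρ * extend ρ w k ∎

  module _ (w : ℕ → Carrier) {ρ} (w-shift : ∀ k → w (N ℕ.+ k) ≡ ρ * w k) where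
    open Intervals K w

    S-shift : ∀ i d → S (N ℕ.+ i) d ≡ ρ * S i d
    S-shift i zero    = w-shift i
    S-shift i (suc d) = trans (cong₂ _+_ (S-shift i d)
      (trans (cong (λ k → w (suc k)) (trans (sym (ℕ.+-assoc d N i)) (trans (cong (ℕ._+ i) (ℕ.+-comm d N)) (ℕ.+-assoc N d i))))
        (trans (cong w (sym (ℕ.+-suc N (d ℕ.+ i)))) (w-shift (suc (d ℕ.+ i))))))
      (sym (distribˡ ρ _ _))

-- The entries of a frieze of type D_N are λ-lengths of arcs in a once punctured N-gon: α k and α k * W are those
-- of the plain and the notched arc from k to the puncture, and u q m belongs to the arc from m + q to m + N,
-- where u 0 m is a loop around the puncture.
module FriezeD {c} (K : SemiField c) (r : ℕ) (a b : ℕ → SemiField.Carrier K) (u : ℕ → ℕ → SemiField.Carrier K) where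
  open SemiField K
  open SemiFieldProperties K
  open ≡-Reasoning

  N : ℕ
  N = suc (suc r)

  open QuasiPeriodic K N

  module _ (u-bottom : ∀ m → u 0 m ≡ a m * b m) (u-top : ∀ m → u (suc r) m ≡ 1#)
    (frieze-a : ∀ m → a m * a (suc m) ≡ 1# + u 1 m)
    (frieze-b : ∀ m → b m * b (suc m) ≡ 1# + u 1 m)
    (frieze : ∀ q m → q ℕ.< r → u (suc q) m * u (suc q) (suc m) ≡ 1# + u (suc (suc q)) m * u q (suc m)) where

    private
      α₀ α w : ℕ → Carrier
      α₀ zero    = a 0
      -- Ptolemy for k, k + 1, N and the puncture: the diagonals are `u k 0` and the arc from k + 1,
      -- the side from k to k + 1 is 1, and the arc from N is the arc `a 0` from 0.
      α₀ (suc k) = (u (suc k) 0 * α₀ k + a 0) ÷ u k 0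
      α = extend 1# α₀
      w k = (α k * α (suc k)) ⁻¹

      open Intervals K w

      α-shift : ∀ k → α (N ℕ.+ k) ≡ α k
      α-shift k = trans (extend-shift 1# α₀ k) (*-identityˡ _)

      w-shift : ∀ k → w (N ℕ.+ k) ≡ w k
      w-shift k = cong _⁻¹ (cong₂ _*_ (α-shift k) (trans (cong α (sym (ℕ.+-suc N k))) (α-shift (suc k))))

      unit : ∀ k → α k * α (suc k) * w k ≡ 1#
      unit k = inverseʳ _

      W : ℕ → Carrier
      W m = S m (suc r)

      W-suc : ∀ m → W (suc m) ≡ W m
      W-suc m = begin
        S (suc m) r + w (suc (r ℕ.+ suc m)) ≡⟨ cong (λ k → S (suc m) r + w (suc k)) (ℕ.+-suc r m) ⟩
        S (suc m) r + w (N ℕ.+ m)           ≡⟨ cong (S (suc m) r +_) (w-shift m) ⟩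
        S (suc m) r + w m                   ≡⟨ +-comm _ _ ⟩
        w m + S (suc m) r                   ≡⟨ S-left m r ⟨
        W m                                 ∎

      arc : ℕ → ℕ → ℕ → Carrier
      arc q m d = α (q ℕ.+ m) * α (N ℕ.+ m) * S (q ℕ.+ m) d

      initial : ∀ d q → q ℕ.+ d ≡ suc r → u q 0 ≡ α q * α N * S q d
      initial zero q eq rewrite trans (sym (ℕ.+-identityʳ q)) eq = trans (u-top 0) (sym (unit (suc r)))
      initial (suc d) q eq = *-cancelˡ (α (suc q)) (begin
        α (suc q) * u q 0
          ≡⟨ cong (_* u q 0) (extend-< 1# α₀ (ℕ.s≤s q<)) ⟩
        ((u (suc q) 0 * α₀ q + a 0) ÷ u q 0) * u q 0
          ≡⟨ trans (*-comm _ _) (÷-* _ _) ⟩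
        u (suc q) 0 * α₀ q + a 0
          ≡⟨ cong₂ (λ x y → u (suc q) 0 * x + y) (sym (extend-< 1# α₀ (ℕ.<-trans (ℕ.n<1+n q) (ℕ.s≤s q<)))) (sym αN) ⟩
        u (suc q) 0 * α q + α N
          ≡⟨ cong₂ (λ x y → x * α q + y) (initial d (suc q) eq′) (sym (trans (cong (α N *_) (unit q)) (*-identityʳ _))) ⟩
        α (suc q) * α N * S (suc q) d * α q + α N * (α q * α (suc q) * w q)
          ≡⟨ just-injective (solve 5 (λ x y z s w → y :* z :* s :* x :+ z :* (x :* y :* w) := y :* (x :* z :* (w :+ s))) refl
               (just (α q)) (just (α (suc q))) (just (α N)) (just (S (suc q) d)) (just (w q))) ⟩
        α (suc q) * (α q * α N * (w q + S (suc q) d))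
          ≡⟨ cong (λ s → α (suc q) * (α q * α N * s)) (S-left q d) ⟨
        α (suc q) * (α q * α N * S q (suc d)) ∎)
        where
        eq′ : suc q ℕ.+ d ≡ suc r
        eq′ = trans (sym (ℕ.+-suc q d)) eq
        q< : q ℕ.< suc r
        q< = ℕ.≤-trans (ℕ.m≤m+n (suc q) d) (ℕ.≤-reflexive eq′)
        αN : α N ≡ a 0
        αN = trans (cong α (sym (ℕ.+-identityʳ N))) (trans (α-shift 0) (extend-< 1# α₀ ℕ.z<s))

      -- The flag means notched. One step in time rotates the polygon and also changes the tag, so
      -- each of the rows a and b alternates between plain and notched arcs. After N steps the
      -- rotation is complete, and the leaves are exchanged exactly if N is odd.
      leaf : Bool → ℕ → Carrier
      leaf false m = α m
      leaf true  m = α m * W m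

      leaf-product : ∀ τ m → leaf τ m * leaf (not τ) m ≡ α m * α m * W m
      leaf-product false m = sym (*-assoc _ _ _)
      leaf-product true  m = just-injective (solve 2 (λ x w → x :* w :* x := x :* x :* w) refl (just (α m)) (just (W m)))

      leaf-suc : ∀ τ m → leaf τ m * leaf (not τ) (suc m) ≡ α m * α (suc m) * W m
      leaf-suc false m = trans (cong (λ w → α m * (α (suc m) * w)) (W-suc m)) (sym (*-assoc _ _ _))
      leaf-suc true  m = just-injective (solve 3 (λ x y w → x :* w :* y := x :* y :* w) refl (just (α m)) (just (α (suc m))) (just (W m)))

      record Slice (m : ℕ) : Set c where
        field
          a≡ : a m ≡ leaf (isOdd m) m
          b≡ : b m ≡ leaf (not (isOdd m)) m
          u≡ : ∀ q d → q ℕ.+ d ≡ suc r → u q m ≡ arc q m d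

      slice-0 : Slice 0
      slice-0 = record { a≡ = a≡ ; b≡ = b≡ ; u≡ = u≡ }
        where
        a≡ : a 0 ≡ α 0
        a≡ = sym (extend-< 1# α₀ ℕ.z<s)
        αN : α N ≡ α 0
        αN = trans (cong α (sym (ℕ.+-identityʳ N))) (α-shift 0)
        b≡ : b 0 ≡ α 0 * W 0
        b≡ = *-cancelˡ (a 0) (begin
          a 0 * b 0               ≡⟨ u-bottom 0 ⟨
          u 0 0                   ≡⟨ initial (suc r) 0 refl ⟩
          α 0 * α N * W 0         ≡⟨ cong₂ (λ x y → x * y * W 0) (sym a≡) αN ⟩
          a 0 * α 0 * W 0         ≡⟨ *-assoc _ _ _ ⟩
          a 0 * (α 0 * W 0)       ∎)
        u≡ : ∀ q d → q ℕ.+ d ≡ suc r → u q 0 ≡ arc q 0 d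
        u≡ q d eq = trans (initial d q eq) (cong₂ (λ i j → α i * α j * S i d) (sym (ℕ.+-identityʳ q)) (sym (ℕ.+-identityʳ N)))

      slice-suc : ∀ m → Slice m → Slice (suc m)
      slice-suc m slice = record { a≡ = a≡′ ; b≡ = b≡′ ; u≡ = u≡′ }
        where
        open Slice slice
        leaf-step : ∀ τ (f : ℕ → Carrier) → f m * f (suc m) ≡ 1# + u 1 m → f m ≡ leaf τ m → f (suc m) ≡ leaf (not τ) (suc m)
        leaf-step τ f rel f≡ = *-cancelˡ (f m) (begin
          f m * f (suc m)                              ≡⟨ rel ⟩
          1# + u 1 m                                   ≡⟨ cong (1# +_) (u≡ 1 r refl) ⟩
          1# + α (suc m) * α (N ℕ.+ m) * S (suc m) r   ≡⟨ cong₂ (λ o x → o + α (suc m) * x * S (suc m) r) (sym (unit m)) (α-shift m) ⟩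
          α m * α (suc m) * w m + α (suc m) * α m * S (suc m) r
            ≡⟨ just-injective (solve 4 (λ x y w s → x :* y :* w :+ y :* x :* s := x :* y :* (w :+ s)) refl
                 (just (α m)) (just (α (suc m))) (just (w m)) (just (S (suc m) r))) ⟩
          α m * α (suc m) * (w m + S (suc m) r)        ≡⟨ cong (α m * α (suc m) *_) (S-left m r) ⟨
          α m * α (suc m) * W m                        ≡⟨ leaf-suc τ m ⟨
          leaf τ m * leaf (not τ) (suc m)              ≡⟨ cong (_* leaf (not τ) (suc m)) f≡ ⟨
          f m * leaf (not τ) (suc m)                   ∎)
        a≡′ : a (suc m) ≡ leaf (isOdd (suc m)) (suc m)
        a≡′ = leaf-step (isOdd m) a (frieze-a m) a≡
        b≡′ : b (suc m) ≡ leaf (not (isOdd (suc m))) (suc m)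
        b≡′ = leaf-step (not (isOdd m)) b (frieze-b m) b≡
        u≡′ : ∀ q d → q ℕ.+ d ≡ suc r → u q (suc m) ≡ arc q (suc m) d
        u≡′ zero d refl = begin
          u 0 (suc m)                                           ≡⟨ u-bottom (suc m) ⟩
          a (suc m) * b (suc m)                                 ≡⟨ cong₂ _*_ a≡′ b≡′ ⟩
          leaf (isOdd (suc m)) (suc m) * leaf (not (isOdd (suc m))) (suc m) ≡⟨ leaf-product (isOdd (suc m)) (suc m) ⟩
          α (suc m) * α (suc m) * W (suc m)                     ≡⟨ cong (λ x → α (suc m) * x * W (suc m)) (α-shift (suc m)) ⟨
          arc 0 (suc m) (suc r) ∎
        u≡′ (suc q) zero eq with trans (sym (ℕ.+-identityʳ q)) (ℕ.suc-injective eq)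
        ... | refl = trans (u-top (suc m)) (sym (begin
          α (suc (r ℕ.+ suc m)) * α (N ℕ.+ suc m) * w (suc (r ℕ.+ suc m)) ≡⟨ unit (suc (r ℕ.+ suc m)) ⟩
          1# ∎))
        u≡′ (suc q) (suc d) eq = *-cancelˡ (u (suc q) m) (begin
          u (suc q) m * u (suc q) (suc m)         ≡⟨ frieze q m q<r ⟩
          1# + u (suc (suc q)) m * u q (suc m)    ≡⟨ cong₂ (λ x y → 1# + x * y) (u≡ (suc (suc q)) d eq₁) (u≡′ q (suc (suc d)) eq₂) ⟩
          1# + arc (suc (suc q)) m d * arc q (suc m) (suc (suc d))
            ≡⟨ cong₂ (λ k l → 1# + arc (suc (suc q)) m d * (α k * α l * S k (suc (suc d)))) (ℕ.+-suc q m) (ℕ.+-suc N m) ⟩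
          1# + α₂ * β * S (suc i) d * (α₁ * β′ * S i (suc (suc d)))
            ≡⟨ cong (_+ α₂ * β * S (suc i) d * (α₁ * β′ * S i (suc (suc d))))
                 (trans (sym (*-identityˡ 1#)) (sym (cong₂ _*_ (unit i) (unit (N ℕ.+ m))))) ⟩
          α₁ * α₂ * w i * (β * β′ * w (N ℕ.+ m)) + α₂ * β * S (suc i) d * (α₁ * β′ * S i (suc (suc d)))
            ≡⟨ just-injective (solve 8 (λ a b c d v w s t →
                 a :* b :* v :* (c :* d :* w) :+ b :* c :* s :* (a :* d :* t) := a :* c :* (b :* d) :* (t :* s :+ v :* w)) refl
                 (just α₁) (just α₂) (just β) (just β′) (just (w i)) (just (w (N ℕ.+ m)))
                 (just (S (suc i) d)) (just (S i (suc (suc d))))) ⟩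
          α₁ * β * (α₂ * β′) * (S i (suc (suc d)) * S (suc i) d + w i * w (N ℕ.+ m))
            ≡⟨ cong (α₁ * β * (α₂ * β′) *_) (ptolemy i d end) ⟨
          α₁ * β * (α₂ * β′) * (S i (suc d) * S (suc i) (suc d))
            ≡⟨ just-injective (solve 4 (λ x y s t → x :* y :* (s :* t) := x :* s :* (y :* t)) refl
                 (just (α₁ * β)) (just (α₂ * β′)) (just (S i (suc d))) (just (S (suc i) (suc d)))) ⟩
          arc (suc q) m (suc d) * (α₂ * β′ * S (suc i) (suc d))
            ≡⟨ cong₂ (λ x y → x * y) (u≡ (suc q) (suc d) eq) (cong₂ (λ k l → α (suc k) * α l * S (suc k) (suc d)) (ℕ.+-suc q m) (ℕ.+-suc N m)) ⟨
          u (suc q) m * arc (suc q) (suc m) (suc d) ∎)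
          where
          i = suc (q ℕ.+ m)
          α₁ = α i
          α₂ = α (suc i)
          β = α (N ℕ.+ m)
          β′ = α (suc (N ℕ.+ m))
          eq₀ : suc q ℕ.+ d ≡ r
          eq₀ = trans (sym (ℕ.+-suc q d)) (ℕ.suc-injective eq)
          q<r : q ℕ.< r
          q<r = ℕ.≤-trans (ℕ.m≤m+n (suc q) d) (ℕ.≤-reflexive eq₀)
          eq₁ : suc (suc q) ℕ.+ d ≡ suc r
          eq₁ = cong suc eq₀
          eq₂ : q ℕ.+ suc (suc d) ≡ suc r
          eq₂ = trans (ℕ.+-suc q (suc d)) eq
          end : suc d ℕ.+ i ≡ suc (r ℕ.+ m)
          end = cong suc (trans (ℕ.+-suc d (q ℕ.+ m)) (trans (cong suc (trans (sym (ℕ.+-assoc d q m)) (cong (ℕ._+ m) (ℕ.+-comm d q))))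
                  (cong (ℕ._+ m) eq₀)))

      slices : ∀ m → Slice m
      slices zero    = slice-0
      slices (suc m) = slice-suc m (slices m)

      leaf-N : ∀ τ → leaf τ N ≡ leaf τ 0
      leaf-N τ = subst (λ k → leaf τ k ≡ leaf τ 0) (ℕ.+-identityʳ N) (lemma τ)
        where
        lemma : ∀ τ → leaf τ (N ℕ.+ 0) ≡ leaf τ 0
        lemma false = α-shift 0
        lemma true  = cong₂ _*_ (α-shift 0) (trans (S-shift w {1#} (λ k → trans (w-shift k) (sym (*-identityˡ _))) 0 (suc r)) (*-identityˡ _))

    a-periodic : a N ≡ (if isOdd N then b 0 else a 0)
    a-periodic = trans (Slice.a≡ (slices N)) (trans (leaf-N (isOdd N)) (lemma (isOdd N)))
      where
      lemma : ∀ τ → leaf τ 0 ≡ (if τ then b 0 else a 0)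
      lemma true  = sym (Slice.b≡ (slices 0))
      lemma false = sym (Slice.a≡ (slices 0))

    b-periodic : b N ≡ (if isOdd N then a 0 else b 0)
    b-periodic = trans (Slice.b≡ (slices N)) (trans (leaf-N (not (isOdd N))) (lemma (isOdd N)))
      where
      lemma : ∀ τ → leaf (not τ) 0 ≡ (if τ then a 0 else b 0)
      lemma true  = sym (Slice.a≡ (slices 0))
      lemma false = sym (Slice.b≡ (slices 0))

    u-periodic : ∀ q → q ℕ.≤ suc r → u q N ≡ u q 0
    u-periodic q q≤ = begin
      u q N                                                       ≡⟨ Slice.u≡ (slices N) q d eq ⟩
      α (q ℕ.+ N) * α (N ℕ.+ N) * S (q ℕ.+ N) d                   ≡⟨ cong (λ k → α k * α (N ℕ.+ N) * S k d) (ℕ.+-comm q N) ⟩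
      α (N ℕ.+ q) * α (N ℕ.+ N) * S (N ℕ.+ q) d
        ≡⟨ cong₂ _*_ (cong₂ _*_ (α-shift q) (α-shift N))
             (trans (S-shift w {1#} (λ k → trans (w-shift k) (sym (*-identityˡ _))) q d) (*-identityˡ _)) ⟩
      α q * α N * S q d                                           ≡⟨ initial d q eq ⟨
      u q 0                                                       ∎
      where
      d = suc r ℕ.∸ q
      eq : q ℕ.+ d ≡ suc r
      eq = ℕ.m+[n∸m]≡n q≤

-- As for type A, but with distances w k that are periodic only up to a factor ρ, the ratio of the two entries at the leaves.
module YFriezeD {c} (K : SemiField c) (r : ℕ) (a b : ℕ → SemiField.Carrier K) (g E : ℕ → ℕ → SemiField.Carrier K) where
  open SemiField K
  open SemiFieldProperties K
  open ≡-Reasoning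

  N : ℕ
  N = suc (suc r)

  open QuasiPeriodic K N

  module _ (E-bottom : ∀ m → E 0 m ≡ (1# + a m) * (1# + b m)) (E-top : ∀ m → E (suc r) m ≡ 1#)
    (E-inner : ∀ q m → q ℕ.< r → E (suc q) m ≡ 1# + g (suc q) m)
    (frieze-a : ∀ m → a m * a (suc m) ≡ E 1 m)
    (frieze-b : ∀ m → b m * b (suc m) ≡ E 1 m)
    (frieze : ∀ q m → q ℕ.< r → g (suc q) m * g (suc q) (suc m) ≡ E (suc (suc q)) m * E q (suc m)) where

    private
      ρ : Carrier
      -- With `w 0` normalised to 1, the initial slice must satisfy `a 0 * w 0 ≡ S 1 r` and
      -- `b 0 * w N ≡ S 1 r`, and `w N` is ρ.
      ρ = a 0 ÷ b 0

      -- s (suc k) is w (suc k) + ⋯ + w (suc r).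
      s : ℕ → Carrier
      s zero          = 1#
      s (suc zero)    = a 0
      s (suc (suc k)) = g (suc k) 0 * s (suc k) * ρ ÷ (s (suc k) + ρ + g (suc k) 0 * ρ)

      w₀ w : ℕ → Carrier
      w₀ zero    = 1#
      -- With g for `g (suc k) 0`, s for `s (suc k)`, s′ for the next sum and w for this gap, the
      -- conditions are g w ρ = (s + ρ) s′ and w + s′ = s. Both solutions are free of subtraction.
      -- For k = r the whole sum is the last gap.
      w₀ (suc k) = if k ℕ.≡ᵇ r then s (suc k) else s (suc k) * (s (suc k) + ρ) ÷ (s (suc k) + ρ + g (suc k) 0 * ρ)
      w = extend ρ w₀

      open Intervals K w

      w-shift : ∀ k → w (N ℕ.+ k) ≡ ρ * w k
      w-shift = extend-shift ρ w₀

      w-last : w (suc r) ≡ s (suc r)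
      w-last = trans (extend-< ρ w₀ (ℕ.n<1+n (suc r)))
        (cong (λ t → if t then s (suc r) else s (suc r) * (s (suc r) + ρ) ÷ (s (suc r) + ρ + g (suc r) 0 * ρ)) (≡ᵇ-refl r))

      w-inner : ∀ k → k ℕ.< r → w (suc k) ≡ s (suc k) * (s (suc k) + ρ) ÷ (s (suc k) + ρ + g (suc k) 0 * ρ)
      w-inner k k<r = trans (extend-< ρ w₀ (ℕ.s<s (ℕ.<-trans k<r (ℕ.n<1+n r)))) (lemma (k ℕ.≡ᵇ r) refl)
        where
        lemma : ∀ t → (k ℕ.≡ᵇ r) ≡ t → (if t then s (suc k) else s (suc k) * (s (suc k) + ρ) ÷ (s (suc k) + ρ + g (suc k) 0 * ρ))
                ≡ s (suc k) * (s (suc k) + ρ) ÷ (s (suc k) + ρ + g (suc k) 0 * ρ)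
        lemma false e = refl
        lemma true  e with ≡ᵇ-sound k r e
        ... | refl with ℕ.<-irrefl refl k<r
        ...   | ()

      wN : w N ≡ ρ
      wN = trans (cong w (sym (ℕ.+-identityʳ N))) (trans (w-shift 0)
        (trans (cong (ρ *_) (extend-< ρ w₀ ℕ.z<s)) (*-identityʳ ρ)))

      S≡s : ∀ d k → k ℕ.+ d ≡ r → S (suc k) d ≡ s (suc k)
      S≡s zero k eq rewrite trans (sym (ℕ.+-identityʳ k)) eq = w-last
      S≡s (suc d) k eq = *-cancelˡ D (begin
        D * S (suc k) (suc d)                  ≡⟨ cong (D *_) (trans (S-left (suc k) d) (cong₂ _+_ (w-inner k k<r) (S≡s d (suc k) eq′))) ⟩
        D * (s (suc k) * (s (suc k) + ρ) ÷ D + s (suc (suc k))) ≡⟨ distribˡ D _ _ ⟩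
        D * (s (suc k) * (s (suc k) + ρ) ÷ D) + D * s (suc (suc k)) ≡⟨ cong₂ _+_ (÷-* _ D) (÷-* _ D) ⟩
        s (suc k) * (s (suc k) + ρ) + g (suc k) 0 * s (suc k) * ρ
          ≡⟨ just-injective (solve 3 (λ s ρ g → s :* (s :+ ρ) :+ g :* s :* ρ := (s :+ ρ :+ g :* ρ) :* s) refl
               (just (s (suc k))) (just ρ) (just (g (suc k) 0))) ⟩
        D * s (suc k) ∎)
        where
        D = s (suc k) + ρ + g (suc k) 0 * ρ
        eq′ : suc k ℕ.+ d ≡ r
        eq′ = trans (sym (ℕ.+-suc k d)) eq
        k<r : k ℕ.< r
        k<r = ℕ.≤-trans (ℕ.m≤m+n (suc k) d) (ℕ.≤-reflexive eq′)

      g-initial : ∀ q d → suc q ℕ.+ d ≡ r → g (suc q) 0 * (w (suc q) * w N) ≡ S (suc q) (suc (suc d)) * S (suc (suc q)) d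
      g-initial q d eq = begin
        g (suc q) 0 * (w (suc q) * w N)
          ≡⟨ cong₂ (λ x y → g (suc q) 0 * (x * y)) (w-inner q (ℕ.≤-trans (ℕ.m≤m+n (suc q) d) (ℕ.≤-reflexive eq))) wN ⟩
        g (suc q) 0 * (s (suc q) * (s (suc q) + ρ) * D⁻¹ * ρ)
          ≡⟨ just-injective (solve 5 (λ g s t d ρ → g :* (s :* t :* d :* ρ) := t :* (g :* s :* ρ :* d)) refl
               (just (g (suc q) 0)) (just (s (suc q))) (just (s (suc q) + ρ)) (just D⁻¹) (just ρ)) ⟩
        (s (suc q) + ρ) * s (suc (suc q))
          ≡⟨ cong₂ _*_ (cong₂ _+_ (S≡s (suc d) q (trans (ℕ.+-suc q d) eq)) (trans (cong (λ k → w (suc k)) end) wN)) (S≡s d (suc q) eq) ⟨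
        S (suc q) (suc (suc d)) * S (suc (suc q)) d ∎
        where
        D⁻¹ = (s (suc q) + ρ + g (suc q) 0 * ρ) ⁻¹
        end : suc d ℕ.+ suc q ≡ suc r
        end = cong suc (trans (ℕ.+-comm d (suc q)) eq)

      -- Plays the part of the tag: the rows a and b are measured alternately against a gap and
      -- against the same gap one turn later, which is ρ times as large.
      mark : Bool → ℕ → Carrier
      mark false m = w m
      mark true  m = w (N ℕ.+ m)

      mark-product : ∀ τ m → mark τ m * mark (not τ) m ≡ w m * w (N ℕ.+ m)
      mark-product false m = refl
      mark-product true  m = *-comm _ _

      mark-suc : ∀ τ m → mark τ m * mark (not τ) (suc m) ≡ w (suc m) * w (N ℕ.+ m)
      mark-suc true  m = *-comm _ _
      mark-suc false m = begin
        w m * w (N ℕ.+ suc m) ≡⟨ cong (w m *_) (w-shift (suc m)) ⟩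
        w m * (ρ * w (suc m)) ≡⟨ just-injective (solve 3 (λ x y z → x :* (y :* z) := z :* (y :* x)) refl (just (w m)) (just ρ) (just (w (suc m)))) ⟩
        w (suc m) * (ρ * w m) ≡⟨ cong (w (suc m) *_) (w-shift m) ⟨
        w (suc m) * w (N ℕ.+ m) ∎

      S-end : ∀ m → S (suc m) (suc r) ≡ S (suc m) r + w (N ℕ.+ m)
      S-end m = cong (λ k → S (suc m) r + w (suc k)) (ℕ.+-suc r m)

      1+mark : ∀ τ m → mark τ m + S (suc m) r ≡ S (if τ then suc m else m) (suc r)
      1+mark false m = sym (S-left m r)
      1+mark true  m = trans (+-comm _ _) (sym (S-end m))

      E-bottom-at : ∀ m → a m * mark (isOdd m) m ≡ S (suc m) r → b m * mark (not (isOdd m)) m ≡ S (suc m) r →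
                    E 0 m * (w m * w (N ℕ.+ m)) ≡ S m (suc r) * S (suc m) (suc r)
      E-bottom-at m a≡ b≡ = begin
          E 0 m * (w m * w (N ℕ.+ m))                          ≡⟨ cong₂ _*_ (E-bottom m) (sym (mark-product (isOdd m) m)) ⟩
          (1# + a m) * (1# + b m) * (mark (isOdd m) m * mark (not (isOdd m)) m)
            ≡⟨ just-injective (solve 4 (λ a b x y → (con 1 :+ a) :* (con 1 :+ b) :* (x :* y) := (x :+ a :* x) :* (y :+ b :* y)) refl
                 (just (a m)) (just (b m)) (just (mark (isOdd m) m)) (just (mark (not (isOdd m)) m))) ⟩
          (mark (isOdd m) m + a m * mark (isOdd m) m) * (mark (not (isOdd m)) m + b m * mark (not (isOdd m)) m)
            ≡⟨ cong₂ (λ x y → (mark (isOdd m) m + x) * (mark (not (isOdd m)) m + y)) a≡ b≡ ⟩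
          (mark (isOdd m) m + S (suc m) r) * (mark (not (isOdd m)) m + S (suc m) r)
            ≡⟨ cong₂ _*_ (1+mark (isOdd m) m) (1+mark (not (isOdd m)) m) ⟩
          S (if isOdd m then suc m else m) (suc r) * S (if not (isOdd m) then suc m else m) (suc r) ≡⟨ lemma (isOdd m) ⟩
          S m (suc r) * S (suc m) (suc r) ∎
          where
          lemma : ∀ τ → S (if τ then suc m else m) (suc r) * S (if not τ then suc m else m) (suc r) ≡ S m (suc r) * S (suc m) (suc r)
          lemma true  = *-comm _ _
          lemma false = refl

      E-inner-at : ∀ m q d → suc q ℕ.+ d ≡ r →
        g (suc q) m * (w (suc (q ℕ.+ m)) * w (N ℕ.+ m)) ≡ S (suc (q ℕ.+ m)) (suc (suc d)) * S (suc (suc (q ℕ.+ m))) d →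
        E (suc q) m * (w (suc (q ℕ.+ m)) * w (N ℕ.+ m)) ≡ S (suc (q ℕ.+ m)) (suc d) * S (suc (suc (q ℕ.+ m))) (suc d)
      E-inner-at m q d eq₀ g≡ = begin
          E (suc q) m * (w i * w (N ℕ.+ m))                      ≡⟨ cong (_* (w i * w (N ℕ.+ m))) (E-inner q m (ℕ.≤-trans (ℕ.m≤m+n (suc q) d) (ℕ.≤-reflexive eq₀))) ⟩
          (1# + g (suc q) m) * (w i * w (N ℕ.+ m))
            ≡⟨ 1+-* _ _ ⟩
          g (suc q) m * (w i * w (N ℕ.+ m)) + w i * w (N ℕ.+ m)  ≡⟨ cong (_+ w i * w (N ℕ.+ m)) g≡ ⟩
          S i (suc (suc d)) * S (suc i) d + w i * w (N ℕ.+ m)    ≡⟨ ptolemy i d end ⟨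
          S i (suc d) * S (suc i) (suc d)                        ∎
          where
          i = suc (q ℕ.+ m)
          end : suc d ℕ.+ i ≡ suc (r ℕ.+ m)
          end = cong suc (trans (ℕ.+-suc d (q ℕ.+ m)) (trans (cong suc (trans (sym (ℕ.+-assoc d q m)) (cong (ℕ._+ m) (ℕ.+-comm d q))))
                  (cong (ℕ._+ m) eq₀)))

      record Slice (m : ℕ) : Set c where
        field
          a≡ : a m * mark (isOdd m) m ≡ S (suc m) r
          b≡ : b m * mark (not (isOdd m)) m ≡ S (suc m) r
          g≡ : ∀ q d → suc q ℕ.+ d ≡ r → g (suc q) m * (w (suc (q ℕ.+ m)) * w (N ℕ.+ m))
                                          ≡ S (suc (q ℕ.+ m)) (suc (suc d)) * S (suc (suc (q ℕ.+ m))) d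

        E-at : ∀ q d → q ℕ.+ d ≡ suc r → E q m * (w (q ℕ.+ m) * w (N ℕ.+ m)) ≡ S (q ℕ.+ m) d * S (suc (q ℕ.+ m)) d
        E-at zero d refl = E-bottom-at m a≡ b≡
        E-at (suc q) zero eq with trans (sym (ℕ.+-identityʳ q)) (ℕ.suc-injective eq)
        ... | refl = trans (cong (_* (w (suc (r ℕ.+ m)) * w (N ℕ.+ m))) (E-top m)) (*-identityˡ _)
        E-at (suc q) (suc d) eq = E-inner-at m q d eq₀ (g≡ q d eq₀)
          where
          eq₀ : suc q ℕ.+ d ≡ r
          eq₀ = trans (sym (ℕ.+-suc q d)) (ℕ.suc-injective eq)

      slice-0 : Slice 0
      slice-0 = record { a≡ = a≡ ; b≡ = b≡ ; g≡ = g≡ }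
        where
        a≡ : a 0 * w 0 ≡ S 1 r
        a≡ = trans (trans (cong (a 0 *_) (extend-< ρ w₀ ℕ.z<s)) (*-identityʳ (a 0))) (sym (S≡s r 0 refl))
        b≡ : b 0 * w (N ℕ.+ 0) ≡ S 1 r
        b≡ = trans (cong (λ k → b 0 * w k) (ℕ.+-identityʳ N)) (trans (cong (b 0 *_) wN) (trans (÷-* (a 0) (b 0)) (sym (S≡s r 0 refl))))
        g≡ : ∀ q d → suc q ℕ.+ d ≡ r → g (suc q) 0 * (w (suc (q ℕ.+ 0)) * w (N ℕ.+ 0))
                                        ≡ S (suc (q ℕ.+ 0)) (suc (suc d)) * S (suc (suc (q ℕ.+ 0))) d
        g≡ q d eq rewrite ℕ.+-identityʳ q | ℕ.+-identityʳ r = g-initial q d eq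

      slice-suc : ∀ m → Slice m → Slice (suc m)
      slice-suc m slice = record { a≡ = a≡′ ; b≡ = b≡′ ; g≡ = g≡′ }
        where
        open Slice slice
        leaf-step : ∀ τ (f : ℕ → Carrier) → f m * f (suc m) ≡ E 1 m → f m * mark τ m ≡ S (suc m) r →
                    f (suc m) * mark (not τ) (suc m) ≡ S (suc (suc m)) r
        leaf-step τ f rel f≡ = quotient-step (trans rel (sym (*-identityʳ _))) f≡ (E-at 1 r refl) (*-identityˡ 1#) (begin
          S (suc m) r * S (suc (suc m)) r * (w (suc m) * w (N ℕ.+ m) * 1#)
            ≡⟨ just-injective (solve 2 (λ x y → x :* (y :* con 1) := y :* (x :* con 1)) refl
                 (just (S (suc m) r * S (suc (suc m)) r)) (just (w (suc m) * w (N ℕ.+ m)))) ⟩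
          w (suc m) * w (N ℕ.+ m) * (S (suc m) r * S (suc (suc m)) r * 1#)
            ≡⟨ cong (_* (S (suc m) r * S (suc (suc m)) r * 1#)) (mark-suc τ m) ⟨
          mark τ m * mark (not τ) (suc m) * (S (suc m) r * S (suc (suc m)) r * 1#) ∎)

        a≡′ : a (suc m) * mark (isOdd (suc m)) (suc m) ≡ S (suc (suc m)) r
        a≡′ = leaf-step (isOdd m) a (frieze-a m) a≡
        b≡′ : b (suc m) * mark (not (isOdd (suc m))) (suc m) ≡ S (suc (suc m)) r
        b≡′ = leaf-step (not (isOdd m)) b (frieze-b m) b≡

        -- The new slice is filled row by row away from the leaves: the relation gives row q + 1
        -- from the old rows q + 1 and q + 2 and from the new row q, whose E-value is therefore a
        -- premise.
        g-step : ∀ q d → suc q ℕ.+ d ≡ r →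
          E q (suc m) * (w (q ℕ.+ suc m) * w (N ℕ.+ suc m)) ≡ S (q ℕ.+ suc m) (suc (suc d)) * S (suc (q ℕ.+ suc m)) (suc (suc d)) →
          g (suc q) (suc m) * (w (suc (q ℕ.+ suc m)) * w (N ℕ.+ suc m))
            ≡ S (suc (q ℕ.+ suc m)) (suc (suc d)) * S (suc (suc (q ℕ.+ suc m))) d
        g-step q d eq rewrite ℕ.+-suc q m = λ E≡ → quotient-step
          (frieze q m (ℕ.≤-trans (ℕ.m≤m+n (suc q) d) (ℕ.≤-reflexive eq)))
          (g≡ q d eq) (E-at (suc (suc q)) d (cong suc eq)) E≡
          (just-injective (solve 8 (λ x y z t a b c d → x :* y :* (z :* t) :* (a :* b :* (c :* d)) := c :* b :* (a :* d) :* (y :* t :* (x :* z))) refl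
            (just (S i (suc (suc d)))) (just (S (suc i) d)) (just (S (suc i) (suc (suc d)))) (just (S (suc (suc i)) d))
            (just (w (suc i))) (just (w (N ℕ.+ m))) (just (w i)) (just (w (N ℕ.+ suc m)))))
          where i = suc (q ℕ.+ m)

        g≡′ : ∀ q d → suc q ℕ.+ d ≡ r → g (suc q) (suc m) * (w (suc (q ℕ.+ suc m)) * w (N ℕ.+ suc m))
                                        ≡ S (suc (q ℕ.+ suc m)) (suc (suc d)) * S (suc (suc (q ℕ.+ suc m))) d
        g≡′ zero    d eq = g-step 0 d eq (subst (λ k → E 0 (suc m) * (w (suc m) * w (N ℕ.+ suc m)) ≡ S (suc m) k * S (suc (suc m)) k)
                             (sym (cong suc eq)) (E-bottom-at (suc m) a≡′ b≡′))
        g≡′ (suc q) d eq = g-step (suc q) d eq (E-inner-at (suc m) q (suc d) eq₁ (g≡′ q (suc d) eq₁))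
          where
          eq₁ : suc q ℕ.+ suc d ≡ r
          eq₁ = trans (ℕ.+-suc (suc q) d) eq

      slices : ∀ m → Slice m
      slices zero    = slice-0
      slices (suc m) = slice-suc m (slices m)

      mark-N : ∀ τ → mark τ N ≡ ρ * mark τ 0
      mark-N τ = subst (λ k → mark τ k ≡ ρ * mark τ 0) (ℕ.+-identityʳ N) (lemma τ)
        where
        lemma : ∀ τ → mark τ (N ℕ.+ 0) ≡ ρ * mark τ 0
        lemma false = w-shift 0
        lemma true  = w-shift (N ℕ.+ 0)

      S-N : ∀ i d → S (N ℕ.+ i) d ≡ ρ * S i d
      S-N = S-shift w w-shift

      leaf-periodic : ∀ τ x y → x * mark τ N ≡ S (suc N) r → y * mark τ 0 ≡ S 1 r → x ≡ y
      leaf-periodic τ x y x≡ y≡ = *-cancelˡ (ρ * mark τ 0) (begin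
        ρ * mark τ 0 * x   ≡⟨ *-comm _ _ ⟩
        x * (ρ * mark τ 0) ≡⟨ cong (x *_) (mark-N τ) ⟨
        x * mark τ N       ≡⟨ x≡ ⟩
        S (suc N) r        ≡⟨ cong (λ k → S k r) (ℕ.+-comm 1 N) ⟩
        S (N ℕ.+ 1) r      ≡⟨ S-N 1 r ⟩
        ρ * S 1 r          ≡⟨ cong (ρ *_) y≡ ⟨
        ρ * (y * mark τ 0) ≡⟨ just-injective (solve 3 (λ ρ y t → ρ :* (y :* t) := ρ :* t :* y) refl (just ρ) (just y) (just (mark τ 0))) ⟩
        ρ * mark τ 0 * y   ∎)

    Y-a-periodic : a N ≡ (if isOdd N then b 0 else a 0)
    Y-a-periodic = leaf-periodic (isOdd N) _ _ (Slice.a≡ (slices N)) (lemma (isOdd N))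
      where
      lemma : ∀ τ → (if τ then b 0 else a 0) * mark τ 0 ≡ S 1 r
      lemma true  = Slice.b≡ (slices 0)
      lemma false = Slice.a≡ (slices 0)

    Y-b-periodic : b N ≡ (if isOdd N then a 0 else b 0)
    Y-b-periodic = leaf-periodic (not (isOdd N)) _ _ (Slice.b≡ (slices N)) (lemma (isOdd N))
      where
      lemma : ∀ τ → (if τ then a 0 else b 0) * mark (not τ) 0 ≡ S 1 r
      lemma true  = Slice.a≡ (slices 0)
      lemma false = Slice.b≡ (slices 0)

    Y-g-periodic : ∀ q → q ℕ.< r → g (suc q) N ≡ g (suc q) 0
    Y-g-periodic q q<r = *-cancelˡ (ρ * w i * (ρ * w N)) (begin
      ρ * w i * (ρ * w N) * g (suc q) N                    ≡⟨ *-comm _ _ ⟩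
      g (suc q) N * (ρ * w i * (ρ * w N))                  ≡⟨ cong (g (suc q) N *_) (cong₂ _*_ (w-shift i) (w-shift N)) ⟨
      g (suc q) N * (w (N ℕ.+ i) * w (N ℕ.+ N))            ≡⟨ cong (λ k → g (suc q) N * (w k * w (N ℕ.+ N))) i+N ⟨
      g (suc q) N * (w (suc (q ℕ.+ N)) * w (N ℕ.+ N))      ≡⟨ Slice.g≡ (slices N) q d eq ⟩
      S (suc (q ℕ.+ N)) (suc (suc d)) * S (suc (suc (q ℕ.+ N))) d
        ≡⟨ cong (λ k → S k (suc (suc d)) * S (suc k) d) i+N ⟩
      S (N ℕ.+ i) (suc (suc d)) * S (suc (N ℕ.+ i)) d
        ≡⟨ cong₂ _*_ (S-N i (suc (suc d))) (trans (cong (λ k → S k d) (sym (ℕ.+-suc N i))) (S-N (suc i) d)) ⟩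
      ρ * S i (suc (suc d)) * (ρ * S (suc i) d)
        ≡⟨ just-injective (solve 3 (λ ρ x y → ρ :* x :* (ρ :* y) := ρ :* ρ :* (x :* y)) refl
             (just ρ) (just (S i (suc (suc d)))) (just (S (suc i) d))) ⟩
      ρ * ρ * (S i (suc (suc d)) * S (suc i) d)            ≡⟨ cong (ρ * ρ *_) (g-initial q d eq) ⟨
      ρ * ρ * (g (suc q) 0 * (w i * w N))
        ≡⟨ just-injective (solve 4 (λ ρ g x y → ρ :* ρ :* (g :* (x :* y)) := ρ :* x :* (ρ :* y) :* g) refl
             (just ρ) (just (g (suc q) 0)) (just (w i)) (just (w N))) ⟩
      ρ * w i * (ρ * w N) * g (suc q) 0                    ∎)
      where
      i = suc q
      d = r ℕ.∸ suc q
      eq : suc q ℕ.+ d ≡ r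
      eq = ℕ.m+[n∸m]≡n q<r
      i+N : suc (q ℕ.+ N) ≡ N ℕ.+ i
      i+N = ℕ.+-comm (suc q) N

-- Orientations and folding

extendBy : ∀ {a} {X : Set a} {n} → X → (Fin n → X) → ℕ → X
extendBy {n = zero}  d f p       = d
extendBy {n = suc n} d f zero    = f zero
extendBy {n = suc n} d f (suc p) = extendBy d (λ i → f (suc i)) p

extendBy-toℕ : ∀ {a} {X : Set a} {n} (d : X) (f : Fin n → X) i → extendBy d f (toℕ i) ≡ f i
extendBy-toℕ d f zero    = refl
extendBy-toℕ d f (suc i) = extendBy-toℕ d (λ i → f (suc i)) i

extendBy-≥ : ∀ {a} {X : Set a} {n} (d : X) (f : Fin n → X) {p} → n ℕ.≤ p → extendBy d f p ≡ d
extendBy-≥ {n = zero}  d f n≤p           = refl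
extendBy-≥ {n = suc n} d f (ℕ.s≤s n≤p) = extendBy-≥ d (λ i → f (suc i)) n≤p

extendBy-map : ∀ {a b} {X : Set a} {Y : Set b} {n} (d : X) (e : Y) (h : X → Y) (f : Fin n → X) {p} → p ℕ.< n →
  extendBy e (λ i → h (f i)) p ≡ h (extendBy d f p)
extendBy-map {n = suc n} d e h f {zero}  p<n = refl
extendBy-map {n = suc n} d e h f {suc p} (ℕ.s≤s p<n) = extendBy-map d e h (λ i → f (suc i)) p<n

extendBy-diagonal : ∀ {a} {X : Set a} {n} (d : X) (f : ℕ → Fin n → X) p → extendBy d (λ i → f (toℕ i) i) p ≡ extendBy d (f p) p
extendBy-diagonal {n = zero}  d f p       = refl
extendBy-diagonal {n = suc n} d f zero    = refl
extendBy-diagonal {n = suc n} d f (suc p) = extendBy-diagonal d (λ k i → f (suc k) (suc i)) p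

indicator : Bool → ℕ
indicator true  = 1
indicator false = 0

count : ℕ → List ℕ → ℕ
count w = List.foldr (λ p c → indicator (w ℕ.≡ᵇ p) ℕ.+ c) 0

module ListProducts {c} (K : SemiField c) where
  open SemiField K
  open SemiFieldProperties K
  open ≡-Reasoning

  listProduct : List Carrier → Carrier
  listProduct = List.foldr _*_ 1#

  ^-+ : ∀ x m n → _^_ K x (m ℕ.+ n) ≡ _^_ K x m * _^_ K x n
  ^-+ x zero    n = sym (*-identityˡ _)
  ^-+ x (suc m) n = trans (cong (x *_) (^-+ x m n)) (sym (*-assoc x _ _))

  ∏-indicator : ∀ {n} (f : Fin n → Carrier) p → ∏ K (λ w → _^_ K (f w) (indicator (toℕ w ℕ.≡ᵇ p))) ≡ extendBy 1# f p
  ∏-indicator {zero}  f p       = refl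
  ∏-indicator {suc n} f zero    = trans (cong₂ _*_ (*-identityʳ (f zero)) (∏-1 n)) (*-identityʳ _)
  ∏-indicator {suc n} f (suc p) = trans (*-identityˡ _) (∏-indicator (λ i → f (suc i)) p)

  ∏-count : ∀ {n} (f : Fin n → Carrier) L → ∏ K (λ w → _^_ K (f w) (count (toℕ w) L)) ≡ listProduct (List.map (extendBy 1# f) L)
  ∏-count {n} f []      = ∏-1 n
  ∏-count {n} f (p ∷ L) = begin
    ∏ K (λ w → _^_ K (f w) (indicator (toℕ w ℕ.≡ᵇ p) ℕ.+ count (toℕ w) L))
      ≡⟨ ∏-cong (λ w → ^-+ (f w) (indicator (toℕ w ℕ.≡ᵇ p)) (count (toℕ w) L)) ⟩
    ∏ K (λ w → _^_ K (f w) (indicator (toℕ w ℕ.≡ᵇ p)) * _^_ K (f w) (count (toℕ w) L))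
      ≡⟨ ∏-distrib-* (λ w → _^_ K (f w) (indicator (toℕ w ℕ.≡ᵇ p))) (λ w → _^_ K (f w) (count (toℕ w) L)) ⟩
    ∏ K (λ w → _^_ K (f w) (indicator (toℕ w ℕ.≡ᵇ p))) * ∏ K (λ w → _^_ K (f w) (count (toℕ w) L))
      ≡⟨ cong₂ _*_ (∏-indicator f p) (∏-count f L) ⟩
    extendBy 1# f p * listProduct (List.map (extendBy 1# f) L) ∎

-- Relations of each type in a fixed orientation

exponent : DynkinType → ℕ → ℕ → ℕ
exponent t w v = if w ℕ.≡ᵇ v then 0 else ∣ offDiag t w v ∣

parentF₄ : ℕ → ℕ
parentF₄ 0 = 1
parentF₄ 1 = 2
parentF₄ 3 = 2
parentF₄ _ = 100

-- The orientation in which the frieze relations of type t are solved: before t w v says that w precedes v.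
before : DynkinType → ℕ → ℕ → Bool
before E₆ w v = parent v ℕ.≡ᵇ w
before E₇ w v = parent v ℕ.≡ᵇ w
before E₈ w v = parent v ℕ.≡ᵇ w
before F₄ w v = parentF₄ v ℕ.≡ᵇ w
before _  w v = w ℕ.<ᵇ v

chain : ℕ → List ℕ
chain zero    = 1 ∷ []
chain (suc p) = p ∷ suc (suc p) ∷ []

nbrsE : ℕ → List ℕ
nbrsE 0 = 2 ∷ []
nbrsE 1 = 3 ∷ []
nbrsE 2 = 0 ∷ 3 ∷ []
nbrsE 3 = 1 ∷ 2 ∷ 4 ∷ []
nbrsE v = chain v

-- Neighbours of a vertex, repeated according to the exponents; those beyond the rank do not count.
nbrs : DynkinType → ℕ → List ℕ
nbrs (𝔸 k) v = chain v
nbrs (𝔹 k) 1 = 0 ∷ 0 ∷ 2 ∷ []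
nbrs (𝔹 k) v = chain v
nbrs (ℂ k) 0 = 1 ∷ 1 ∷ []
nbrs (ℂ k) v = chain v
nbrs (𝔻 k) 0 = 2 ∷ []
nbrs (𝔻 k) 1 = 2 ∷ []
nbrs (𝔻 k) 2 = 0 ∷ 1 ∷ 3 ∷ []
nbrs (𝔻 k) v = chain v
nbrs E₆ v = nbrsE v
nbrs E₇ v = nbrsE v
nbrs E₈ v = nbrsE v
nbrs F₄ 2 = 1 ∷ 1 ∷ 3 ∷ []
nbrs F₄ v = chain v
nbrs G₂ 0 = 1 ∷ 1 ∷ 1 ∷ []
nbrs G₂ v = 0 ∷ []

Counts : DynkinType → Set
Counts t = ∀ (w v : Fin (rank t)) → exponent t (toℕ w) (toℕ v) ≡ count (toℕ w) (nbrs t (toℕ v))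

chain-count : ∀ w v → (if w ℕ.≡ᵇ v then 0 else ∣ edgeVal (chainEdge w v) ∣) ≡ count w (chain v)
chain-count zero          zero                = refl
chain-count zero          (suc zero)          = refl
chain-count zero          (suc (suc v))       = refl
chain-count (suc zero)    zero                = refl
chain-count (suc (suc w)) zero                = refl
chain-count (suc zero)    (suc zero)          = refl
chain-count (suc (suc zero)) (suc zero)       = refl
chain-count (suc (suc (suc w))) (suc zero)    = refl
chain-count (suc w)       (suc (suc v))       = chain-count w (suc v)

checkCounts : ∀ t → allᵇ {rank t} (λ w → allᵇ {rank t} λ v → exponent t (toℕ w) (toℕ v) ℕ.≡ᵇ count (toℕ w) (nbrs t (toℕ v))) ≡ true → Counts t
checkCounts t h w v = ≡ᵇ-sound _ _ (allᵇ-sound (λ v → exponent t (toℕ w) (toℕ v) ℕ.≡ᵇ count (toℕ w) (nbrs t (toℕ v)))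
  (allᵇ-sound (λ w → allᵇ {rank t} λ v → exponent t (toℕ w) (toℕ v) ℕ.≡ᵇ count (toℕ w) (nbrs t (toℕ v))) h w) v)

count-𝔹 : ∀ k w v → exponent (𝔹 k) w v ≡ count w (nbrs (𝔹 k) v)
count-𝔹 k zero zero = refl
count-𝔹 k zero (suc zero) = refl
count-𝔹 k zero (suc (suc v)) = refl
count-𝔹 k (suc w) zero = chain-count (suc w) zero
count-𝔹 k (suc w) (suc zero) = chain-count (suc w) 1
count-𝔹 k (suc w) (suc (suc v)) = chain-count (suc w) (suc (suc v))

count-ℂ : ∀ k w v → exponent (ℂ k) w v ≡ count w (nbrs (ℂ k) v)
count-ℂ k zero zero = refl
count-ℂ k (suc zero) zero = refl
count-ℂ k (suc (suc w)) zero = refl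
count-ℂ k zero (suc v) = chain-count zero (suc v)
count-ℂ k (suc zero) (suc v) = chain-count 1 (suc v)
count-ℂ k (suc (suc w)) (suc v) = chain-count (suc (suc w)) (suc v)

count-𝔻 : ∀ k w v → exponent (𝔻 k) w v ≡ count w (nbrs (𝔻 k) v)
count-𝔻 k 0 0 = refl
count-𝔻 k 0 1 = refl
count-𝔻 k 0 2 = refl
count-𝔻 k 0 (suc (suc (suc zero))) = refl
count-𝔻 k 0 (suc (suc (suc (suc v)))) = refl
count-𝔻 k 1 0 = refl
count-𝔻 k 1 1 = refl
count-𝔻 k 1 2 = refl
count-𝔻 k 1 (suc (suc (suc zero))) = refl
count-𝔻 k 1 (suc (suc (suc (suc v)))) = refl
count-𝔻 k 2 0 = refl
count-𝔻 k 2 1 = refl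
count-𝔻 k 2 2 = refl
count-𝔻 k 2 (suc (suc (suc zero))) = refl
count-𝔻 k 2 (suc (suc (suc (suc v)))) = refl
count-𝔻 k (suc (suc (suc w))) 0 = refl
count-𝔻 k (suc (suc (suc w))) 1 = refl
count-𝔻 k (suc (suc (suc zero))) 2 = refl
count-𝔻 k (suc (suc (suc (suc w)))) 2 = refl
count-𝔻 k (suc (suc (suc w))) (suc (suc (suc v))) = trans (chain-count w v) (lemma v)
  where
  lemma : ∀ v → count w (chain v) ≡ count (suc (suc (suc w))) (chain (suc (suc (suc v))))
  lemma zero = refl
  lemma (suc v) = refl

counts : ∀ t → Counts t
counts (𝔸 k) w v = chain-count (toℕ w) (toℕ v)
counts (𝔹 k) w v = count-𝔹 k (toℕ w) (toℕ v)
counts (ℂ k) w v = count-ℂ k (toℕ w) (toℕ v)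
counts (𝔻 k) w v = count-𝔻 k (toℕ w) (toℕ v)
counts E₆ = checkCounts E₆ refl
counts E₇ = checkCounts E₇ refl
counts E₈ = checkCounts E₈ refl
counts F₄ = checkCounts F₄ refl
counts G₂ = checkCounts G₂ refl

later : Bool → ℕ → ℕ
later b m = if b then suc m else m

-- The shift in time, with respect to the orientation `before`, after which a frieze of type t repeats.
period : (t : DynkinType) → ℕ → ℕ
period (𝔸 k) v = suc (suc v)
period (𝔹 k) v = suc (rank (𝔹 k))
period (ℂ k) v = suc (rank (ℂ k))
period (𝔻 k) v = rank (𝔻 k)
period E₆ v = 7
period E₇ v = 10
period E₈ v = 16
period F₄ v = 7
period G₂ v = 4

-- Folding identifies the vertices of the folded diagram with those of the unfolded one only up to a shift.
offset : DynkinType → ℕ → ℕ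
offset (ℂ k) v = rank (ℂ k)
offset G₂    0 = 1
offset _     v = 0

-- With pre = id and post = 1 + x one gets friezes, with pre = 1 + x and post = id one gets Y-friezes.
module Systems {c} (K : SemiField c) (pre post : SemiField.Carrier K → SemiField.Carrier K) where
  open SemiField K
  open SemiFieldProperties K
  open ListProducts K
  open ≡-Reasoning

  -- Here P is `pre` of the entry inside the diagram and 1 beyond its ends; in type D its row 0 is
  -- the product over both leaves. The rows are arbitrary sequences, so folding needs no separate
  -- argument: several rows may carry the same vertex, possibly at different times.
  record BasePeriodic : Set c where
    field
      type-A : ∀ n (g P : ℕ → ℕ → Carrier) → (∀ m → P 0 m ≡ 1#) → (∀ m → P (suc n) m ≡ 1#) →
        (∀ p m → p ℕ.< n → P (suc p) m ≡ pre (g (suc p) m)) →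
        (∀ p m → p ℕ.< n → g (suc p) m * g (suc p) (suc m) ≡ post (P (suc (suc p)) m * P p (suc m))) →
        ∀ p q → suc p ℕ.+ suc q ≡ suc n → g (suc q) (suc (suc p)) ≡ g (suc p) 0
      type-D : ∀ r (a b : ℕ → Carrier) (g P : ℕ → ℕ → Carrier) →
        (∀ m → P 0 m ≡ pre (a m) * pre (b m)) → (∀ m → P (suc r) m ≡ 1#) →
        (∀ q m → q ℕ.< r → P (suc q) m ≡ pre (g (suc q) m)) →
        (∀ m → a m * a (suc m) ≡ post (P 1 m)) → (∀ m → b m * b (suc m) ≡ post (P 1 m)) →
        (∀ q m → q ℕ.< r → g (suc q) m * g (suc q) (suc m) ≡ post (P (suc (suc q)) m * P q (suc m))) →
        let N = suc (suc r) in
        (a N ≡ (if isOdd N then b 0 else a 0)) × (b N ≡ (if isOdd N then a 0 else b 0)) ×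
        (∀ q → q ℕ.< r → g (suc q) N ≡ g (suc q) 0)
      type-E₆ : ∀ (φ : Fin 6 → ℕ → Carrier) →
        (∀ i n → φ i n * φ i (suc n) ≡ post (E₆-Frieze.neighbours K (λ j n → pre (φ j n)) i n)) →
        ∀ j → φ (star E₆ j) 7 ≡ φ j 0
      type-E₇ : ∀ (φ : Fin 7 → ℕ → Carrier) →
        (∀ i n → φ i n * φ i (suc n) ≡ post (E₇-Frieze.neighbours K (λ j n → pre (φ j n)) i n)) →
        ∀ j → φ j 10 ≡ φ j 0
      type-E₈ : ∀ (φ : Fin 8 → ℕ → Carrier) →
        (∀ i n → φ i n * φ i (suc n) ≡ post (E₈-Frieze.neighbours K (λ j n → pre (φ j n)) i n)) →
        ∀ j → φ j 16 ≡ φ j 0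

  System : (t : DynkinType) → (Fin (rank t) → ℕ → Carrier) → Set c
  System t φ = ∀ v m → φ v m * φ v (suc m) ≡
    post (∏ K λ w → _^_ K (pre (φ w (later (before t (toℕ w) (toℕ v)) m))) (exponent t (toℕ w) (toℕ v)))

  Periodic : (t : DynkinType) → (Fin (rank t) → ℕ → Carrier) → Set c
  Periodic t φ = ∀ v → φ (star t v) (offset t (toℕ v) ℕ.+ period t (toℕ v)) ≡ φ v (offset t (toℕ v))

  module Explicit (t : DynkinType) (φ : Fin (rank t) → ℕ → Carrier) (system : System t φ) where
    g P : ℕ → ℕ → Carrier
    g p m = extendBy 1# (λ w → φ w m) p
    P p m = extendBy 1# (λ w → pre (φ w m)) p

    g-toℕ : ∀ v m → g (toℕ v) m ≡ φ v m
    g-toℕ v m = extendBy-toℕ 1# (λ w → φ w m) v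

    P-pre : ∀ {p} m → p ℕ.< rank t → P p m ≡ pre (g p m)
    P-pre m p< = extendBy-map 1# 1# pre (λ w → φ w m) p<

    P-top : ∀ m → P (rank t) m ≡ 1#
    P-top m = extendBy-≥ {n = rank t} 1# (λ w → pre (φ w m)) ℕ.≤-refl

    relation : ℕ → ℕ → Set c
    relation p m = g p m * g p (suc m) ≡ post (listProduct (List.map (λ q → P q (later (before t q p) m)) (nbrs t p)))

    explicit-at : ∀ v m → relation (toℕ v) m
    explicit-at v m = begin
      g (toℕ v) m * g (toℕ v) (suc m) ≡⟨ cong₂ _*_ (g-toℕ v m) (g-toℕ v (suc m)) ⟩
      φ v m * φ v (suc m)             ≡⟨ system v m ⟩
      post (∏ K λ w → _^_ K (f (toℕ w) w) (exponent t (toℕ w) (toℕ v)))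
        ≡⟨ cong post (∏-cong λ w → cong (_^_ K (f (toℕ w) w)) (counts t w v)) ⟩
      post (∏ K λ w → _^_ K (f (toℕ w) w) (count (toℕ w) (nbrs t (toℕ v))))
        ≡⟨ cong post (∏-count (λ w → f (toℕ w) w) (nbrs t (toℕ v))) ⟩
      post (listProduct (List.map (extendBy 1# (λ w → f (toℕ w) w)) (nbrs t (toℕ v))))
        ≡⟨ cong (λ l → post (listProduct l)) (List.map-cong (λ q → extendBy-diagonal 1# f q) (nbrs t (toℕ v))) ⟩
      post (listProduct (List.map (λ q → P q (later (before t q (toℕ v)) m)) (nbrs t (toℕ v)))) ∎
      where
      f : ℕ → Fin (rank t) → Carrier
      f q w = pre (φ w (later (before t q (toℕ v)) m))

    explicit : ∀ p m → p ℕ.< rank t → relation p m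
    explicit p m p< = subst (λ q → relation q m) (Fin.toℕ-fromℕ< p<) (explicit-at (fromℕ< p<) m)

  inner : ∀ (P : ℕ → ℕ → Carrier) p m →
    post (listProduct (List.map (λ q → P q (later (q ℕ.<ᵇ suc p) m)) (p ∷ suc (suc p) ∷ []))) ≡ post (P (suc (suc p)) m * P p (suc m))
  inner P p m rewrite <ᵇ-suc p | suc-<ᵇ p = cong post
    (trans (cong (P p (suc m) *_) (*-identityʳ _)) (*-comm _ _))

  module _ (base : BasePeriodic) where
    open BasePeriodic base

    periodic-𝔸 : ∀ k φ → System (𝔸 k) φ → Periodic (𝔸 k) φ
    periodic-𝔸 k φ system v = (begin
      φ (opposite v) (suc (suc (toℕ v)))       ≡⟨ g-toℕ (opposite v) (suc (suc (toℕ v))) ⟨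
      g (toℕ (opposite v)) (suc (suc (toℕ v))) ≡⟨ type-A (suc k) g′ P′ (λ _ → refl) P-top (λ p m → P-pre m) rel (toℕ v) (toℕ (opposite v)) eq ⟩
      g (toℕ v) 0                              ≡⟨ g-toℕ v 0 ⟩
      φ v 0                                    ∎)
      where
      open Explicit (𝔸 k) φ system
      g′ P′ : ℕ → ℕ → Carrier
      g′ zero    m = 1#
      g′ (suc p) m = g p m
      P′ zero    m = 1#
      P′ (suc p) m = P p m
      rel : ∀ p m → p ℕ.< suc k → g′ (suc p) m * g′ (suc p) (suc m) ≡ post (P′ (suc (suc p)) m * P′ p (suc m))
      rel zero    m p< = explicit 0 m p<
      rel (suc p) m p< = trans (explicit (suc p) m p<) (inner P p m)
      eq : suc (toℕ v) ℕ.+ suc (toℕ (opposite v)) ≡ suc (suc k)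
      eq = trans (cong suc (ℕ.+-suc (toℕ v) _)) (cong (λ x → suc (suc x)) (trans (cong (toℕ v ℕ.+_) (Fin.opposite-prop v))
             (ℕ.m+[n∸m]≡n (ℕ.s≤s⁻¹ (Fin.toℕ<n v)))))

    -- B_n is D_(n+1) with both leaves carrying vertex 0: their product accounts for the exponent 2,
    -- and exchanging them has no effect.
    periodic-𝔹 : ∀ k φ → System (𝔹 k) φ → Periodic (𝔹 k) φ
    periodic-𝔹 k φ system v = trans (sym (g-toℕ v N)) (trans (go (toℕ v) (Fin.toℕ<n v)) (g-toℕ v 0))
      where
      open Explicit (𝔹 k) φ system
      r N : ℕ
      r = suc k
      N = suc (suc r)
      P′ : ℕ → ℕ → Carrier
      P′ zero    m = P 0 m * P 0 m
      P′ (suc q) m = P (suc q) m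
      rel : ∀ q m → q ℕ.< r → g (suc q) m * g (suc q) (suc m) ≡ post (P′ (suc (suc q)) m * P′ q (suc m))
      rel zero    m q< = trans (explicit 1 m (ℕ.s≤s q<)) (cong post (just-injective
        (solve 2 (λ x y → x :* (x :* (y :* con 1)) := y :* (x :* x)) refl (just (P 0 (suc m))) (just (P 2 m)))))
      rel (suc q) m q< = trans (explicit (suc (suc q)) m (ℕ.s≤s q<)) (inner P (suc q) m)
      leaf : ∀ m → g 0 m * g 0 (suc m) ≡ post (P 1 m)
      leaf m = trans (explicit 0 m ℕ.z<s) (cong post (*-identityʳ _))
      conclusion = type-D r (g 0) (g 0) g P′ (λ m → cong₂ _*_ (P-pre {0} m ℕ.z<s) (P-pre {0} m ℕ.z<s)) P-top
        (λ q m q< → P-pre {suc q} m (ℕ.s≤s q<)) leaf leaf rel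
      same : ∀ b (x : Carrier) → (if b then x else x) ≡ x
      same true  x = refl
      same false x = refl
      go : ∀ p → p ℕ.< rank (𝔹 k) → g p N ≡ g p 0
      go zero    p< = trans (proj₁ conclusion) (same (isOdd N) (g 0 0))
      go (suc q) p< = proj₂ (proj₂ conclusion) q (ℕ.s≤s⁻¹ p<)

    periodic-𝔻 : ∀ k φ → System (𝔻 k) φ → Periodic (𝔻 k) φ
    periodic-𝔻 k φ system v = go v
      where
      open Explicit (𝔻 k) φ system
      r N : ℕ
      r = suc (suc k)
      N = suc (suc r)
      g′ P′ : ℕ → ℕ → Carrier
      g′ q m = g (suc q) m
      P′ zero    m = P 0 m * P 1 m
      P′ (suc q) m = P (suc (suc q)) m
      rel : ∀ q m → q ℕ.< r → g′ (suc q) m * g′ (suc q) (suc m) ≡ post (P′ (suc (suc q)) m * P′ q (suc m))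
      rel zero    m q< = trans (explicit 2 m (ℕ.s≤s (ℕ.s≤s q<))) (cong post (just-injective
        (solve 3 (λ x y z → x :* (y :* (z :* con 1)) := z :* (x :* y)) refl (just (P 0 (suc m))) (just (P 1 (suc m))) (just (P 3 m)))))
      rel (suc q) m q< = trans (explicit (suc (suc (suc q))) m (ℕ.s≤s (ℕ.s≤s q<))) (inner P (suc (suc q)) m)
      conclusion = type-D r (g 0) (g 1) g′ P′ (λ m → cong₂ _*_ (P-pre {0} m ℕ.z<s) (P-pre {1} m (ℕ.s≤s ℕ.z<s))) P-top
        (λ q m q< → P-pre {suc (suc q)} m (ℕ.s≤s (ℕ.s≤s q<)))
        (λ m → trans (explicit 0 m ℕ.z<s) (cong post (*-identityʳ _)))
        (λ m → trans (explicit 1 m (ℕ.s≤s ℕ.z<s)) (cong post (*-identityʳ _))) rel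
      parity : isOdd N ≡ isOdd k
      parity = trans (Bool.not-involutive (isOdd r)) (Bool.not-involutive (isOdd k))
      go : ∀ v → φ (star (𝔻 k) v) N ≡ φ v 0
      go v with isOdd k | subst (λ b → (g 0 N ≡ (if b then g 1 0 else g 0 0)) × (g 1 N ≡ (if b then g 0 0 else g 1 0))) parity
                            (proj₁ conclusion , proj₁ (proj₂ conclusion))
      go zero          | true  | a≡ , b≡ = b≡
      go zero          | false | a≡ , b≡ = a≡
      go (suc zero)    | true  | a≡ , b≡ = a≡
      go (suc zero)    | false | a≡ , b≡ = b≡
      go (suc (suc v)) | true  | _ = trans (sym (g-toℕ (suc (suc v)) N))
        (trans (proj₂ (proj₂ conclusion) (toℕ v) (Fin.toℕ<n v)) (g-toℕ (suc (suc v)) 0))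
      go (suc (suc v)) | false | _ = trans (sym (g-toℕ (suc (suc v)) N))
        (trans (proj₂ (proj₂ conclusion) (toℕ v) (Fin.toℕ<n v)) (g-toℕ (suc (suc v)) 0))

    -- C_n is folded from A_(2n-1), the middle vertex n of which is the vertex 0 of C_n.
    periodic-ℂ : ∀ k φ → System (ℂ k) φ → Periodic (ℂ k) φ
    periodic-ℂ k φ system v = (begin
      φ v (n ℕ.+ suc n)       ≡⟨ g-toℕ v (n ℕ.+ suc n) ⟨
      g (toℕ v) (n ℕ.+ suc n) ≡⟨ cong (g (toℕ v)) times ⟨
      g (toℕ v) (suc (suc p) ℕ.+ suc q) ≡⟨ lo-eq g (toℕ v) (suc q) (suc (suc p)) lo ⟨
      G (suc q) (suc (suc p)) ≡⟨ type-A (ℕ.pred n ℕ.+ n) G Q Q-bottom Q-top Q-pre rel p q ends ⟩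
      G (suc p) 0             ≡⟨ hi-eq g (toℕ v) 0 ⟩
      g (toℕ v) n             ≡⟨ g-toℕ v n ⟩
      φ v n                   ∎)
      where
      open Explicit (ℂ k) φ system
      n : ℕ
      n = suc (suc k)
      fold : (ℕ → ℕ → Carrier) → ℕ → ℕ → Carrier
      -- On the left half, increasing p approaches vertex 0, so the linear orientation of A is
      -- opposite to that of C. Delaying row p by p corrects this; from the middle on the delay
      -- stays n, which is the offset of type C.
      fold h p m = h (ℕ.∣ p - n ∣) (m ℕ.+ p ℕ.⊓ n)
      G Q : ℕ → ℕ → Carrier
      G = fold g
      Q = fold P
      lo-eq : ∀ (h : ℕ → ℕ → Carrier) d p m → p ℕ.+ d ≡ n → fold h p m ≡ h d (m ℕ.+ p)
      lo-eq h d p m eq = cong₂ (λ x y → h x (m ℕ.+ y)) (trans (cong (λ z → ℕ.∣ p - z ∣) (sym eq)) (ℕ.∣m-m+n∣≡n p d))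
        (ℕ.m≤n⇒m⊓n≡m (subst (p ℕ.≤_) eq (ℕ.m≤m+n p d)))
      hi-eq : ∀ (h : ℕ → ℕ → Carrier) d m → fold h (n ℕ.+ d) m ≡ h d (m ℕ.+ n)
      hi-eq h d m = cong₂ (λ x y → h x (m ℕ.+ y)) (trans (ℕ.∣-∣-comm (n ℕ.+ d) n) (ℕ.∣m-m+n∣≡n n d)) (ℕ.m≥n⇒m⊓n≡n (ℕ.m≤m+n n d))
      p q : ℕ
      p = suc k ℕ.+ toℕ v
      q = suc k ℕ.∸ toℕ v
      q+v : q ℕ.+ toℕ v ≡ suc k
      q+v = ℕ.m∸n+n≡m (ℕ.s≤s⁻¹ (Fin.toℕ<n v))
      lo : suc q ℕ.+ toℕ v ≡ n
      lo = cong suc q+v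
      ends : suc p ℕ.+ suc q ≡ suc (ℕ.pred n ℕ.+ n)
      ends = cong suc (trans (ℕ.+-assoc (suc k) (toℕ v) (suc q)) (cong (suc k ℕ.+_) (trans (ℕ.+-comm (toℕ v) (suc q)) lo)))
      times : suc (suc p) ℕ.+ suc q ≡ n ℕ.+ suc n
      times = cong suc (trans ends (sym (ℕ.+-suc (ℕ.pred n) n)))
      Q-bottom : ∀ m → Q 0 m ≡ 1#
      Q-bottom m = trans (lo-eq P n 0 m refl) (P-top _)
      Q-top : ∀ m → Q (suc (ℕ.pred n ℕ.+ n)) m ≡ 1#
      Q-top m = trans (hi-eq P n m) (P-top _)
      data Side (p : ℕ) : Set where
        low  : ∀ d → suc p ℕ.+ suc d ≡ n → Side p
        mid  : suc p ≡ n → Side p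
        high : ∀ d → suc p ≡ n ℕ.+ suc d → suc d ℕ.< n → Side p
      side : ∀ p → p ℕ.< ℕ.pred n ℕ.+ n → Side p
      side p p< with ℕ.<-cmp (suc p) n
      ... | tri< lt _ _ = low (n ℕ.∸ suc (suc p)) (trans (ℕ.+-suc (suc p) _) (ℕ.m+[n∸m]≡n lt))
      ... | tri≈ _ eq _ = mid eq
      ... | tri> _ _ gt = high (suc p ℕ.∸ suc n) eq (ℕ.+-cancelˡ-< (ℕ.pred n) _ _ (subst (ℕ._< ℕ.pred n ℕ.+ n) (ℕ.suc-injective eq) p<))
        where
        eq : suc p ≡ n ℕ.+ suc (suc p ℕ.∸ suc n)
        eq = sym (trans (ℕ.+-suc n _) (ℕ.m+[n∸m]≡n gt))
      Q-pre : ∀ p m → p ℕ.< ℕ.pred n ℕ.+ n → Q (suc p) m ≡ pre (G (suc p) m)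
      Q-pre p m p< with side p p<
      ... | low d eq = trans (lo-eq P (suc d) (suc p) m eq) (trans (P-pre _ (subst (suc d ℕ.<_) eq (ℕ.s≤s (ℕ.m≤n+m (suc d) p))))
                         (cong pre (sym (lo-eq g (suc d) (suc p) m eq))))
      ... | mid eq = trans (lo-eq P 0 (suc p) m (trans (ℕ.+-identityʳ _) eq)) (trans (P-pre _ ℕ.z<s)
                         (cong pre (sym (lo-eq g 0 (suc p) m (trans (ℕ.+-identityʳ _) eq)))))
      ... | high d eq d< = trans (cong (λ x → Q x m) eq) (trans (hi-eq P (suc d) m) (trans (P-pre _ d<)
                         (cong pre (trans (sym (hi-eq g (suc d) m)) (cong (λ x → G x m) (sym eq))))))
      rel : ∀ p m → p ℕ.< ℕ.pred n ℕ.+ n → G (suc p) m * G (suc p) (suc m) ≡ post (Q (suc (suc p)) m * Q p (suc m))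
      rel p m p< with side p p<
      ... | low d eq = begin
        G (suc p) m * G (suc p) (suc m)               ≡⟨ cong₂ _*_ (lo-eq g (suc d) (suc p) m eq) (lo-eq g (suc d) (suc p) (suc m) eq) ⟩
        g (suc d) M * g (suc d) (suc M)               ≡⟨ trans (explicit (suc d) M (subst (suc d ℕ.<_) eq (ℕ.s≤s (ℕ.m≤n+m (suc d) p)))) (inner P d M) ⟩
        post (P (suc (suc d)) M * P d (suc M))        ≡⟨ cong post (*-comm _ _) ⟩
        post (P d (suc M) * P (suc (suc d)) M)        ≡⟨ cong₂ (λ x y → post (P d x * P (suc (suc d)) y)) (ℕ.+-suc m (suc p)) (sym (ℕ.+-suc m p)) ⟨
        post (P d (m ℕ.+ suc (suc p)) * P (suc (suc d)) (suc m ℕ.+ p))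
          ≡⟨ cong post (cong₂ _*_ (lo-eq P d (suc (suc p)) m (trans (sym (ℕ.+-suc (suc p) d)) eq))
               (lo-eq P (suc (suc d)) p (suc m) (trans (ℕ.+-suc p (suc d)) eq))) ⟨
        post (Q (suc (suc p)) m * Q p (suc m)) ∎
        where M = m ℕ.+ suc p
      ... | mid refl = begin
        G n m * G n (suc m)                     ≡⟨ cong₂ _*_ (lo-eq g 0 n m (ℕ.+-identityʳ n)) (lo-eq g 0 n (suc m) (ℕ.+-identityʳ n)) ⟩
        g 0 (m ℕ.+ n) * g 0 (suc (m ℕ.+ n))     ≡⟨ explicit 0 (m ℕ.+ n) ℕ.z<s ⟩
        post (P 1 (m ℕ.+ n) * (P 1 (m ℕ.+ n) * 1#)) ≡⟨ cong (λ x → post (P 1 (m ℕ.+ n) * x)) (*-identityʳ _) ⟩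
        post (P 1 (m ℕ.+ n) * P 1 (m ℕ.+ n))    ≡⟨ cong (λ x → post (P 1 (m ℕ.+ n) * P 1 x)) (ℕ.+-suc m p) ⟩
        post (P 1 (m ℕ.+ n) * P 1 (suc m ℕ.+ p)) ≡⟨ cong post (cong₂ _*_ (trans (cong (λ x → Q x m) (ℕ.+-comm 1 n)) (hi-eq P 1 m)) (lo-eq P 1 p (suc m) (ℕ.+-comm p 1))) ⟨
        post (Q (suc n) m * Q p (suc m)) ∎
      ... | high d eq d< = begin
        G (suc p) m * G (suc p) (suc m)               ≡⟨ cong (λ x → G x m * G x (suc m)) eq ⟩
        G (n ℕ.+ suc d) m * G (n ℕ.+ suc d) (suc m)   ≡⟨ cong₂ _*_ (hi-eq g (suc d) m) (hi-eq g (suc d) (suc m)) ⟩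
        g (suc d) (m ℕ.+ n) * g (suc d) (suc (m ℕ.+ n)) ≡⟨ trans (explicit (suc d) (m ℕ.+ n) d<) (inner P d (m ℕ.+ n)) ⟩
        post (P (suc (suc d)) (m ℕ.+ n) * P d (suc (m ℕ.+ n))) ≡⟨ cong post (cong₂ _*_ (hi-eq P (suc (suc d)) m) (hi-eq P d (suc m))) ⟨
        post (Q (n ℕ.+ suc (suc d)) m * Q (n ℕ.+ d) (suc m))
          ≡⟨ cong₂ (λ x y → post (Q x m * Q y (suc m))) (trans (cong suc eq) (sym (ℕ.+-suc n (suc d)))) (ℕ.suc-injective (trans eq (ℕ.+-suc n d))) ⟨
        post (Q (suc (suc p)) m * Q p (suc m)) ∎

    -- Folded from D₄: the leaves `a`, `b` and row 2 carry vertex 1 of G₂, and row 1, the centre,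
    -- carries vertex 0. In type D the leaves a and b precede row 1, whereas here vertex 0 precedes
    -- vertex 1; hence the rows are read one step later, and vertex 0 has offset 1.
    periodic-G₂ : ∀ φ → System G₂ φ → Periodic G₂ φ
    periodic-G₂ φ system = go
      where
      open Explicit G₂ φ system
      g′ P′ : ℕ → ℕ → Carrier
      g′ 1 m = φ zero (suc m)
      g′ _ m = φ (suc zero) (suc m)
      P′ 0 m = pre (φ (suc zero) m) * pre (φ (suc zero) m)
      P′ 1 m = pre (φ zero (suc m))
      P′ 2 m = pre (φ (suc zero) (suc m))
      P′ _ m = 1#
      inners : ∀ q m → q ℕ.< 2 → P′ (suc q) m ≡ pre (g′ (suc q) m)
      inners 0 m _ = refl
      inners 1 m _ = refl
      inners (suc (suc q)) m (ℕ.s≤s (ℕ.s≤s ()))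
      leaf : ∀ m → φ (suc zero) m * φ (suc zero) (suc m) ≡ post (pre (φ zero (suc m)))
      leaf m = trans (explicit 1 m (ℕ.s≤s ℕ.z<s)) (cong post (*-identityʳ _))
      rel : ∀ q m → q ℕ.< 2 → g′ (suc q) m * g′ (suc q) (suc m) ≡ post (P′ (suc (suc q)) m * P′ q (suc m))
      rel 0 m _ = trans (explicit 0 (suc m) ℕ.z<s) (cong (λ x → post (P 1 (suc m) * (P 1 (suc m) * x))) (*-identityʳ _))
      rel 1 m _ = trans (leaf (suc m)) (cong post (sym (*-identityˡ _)))
      rel (suc (suc q)) m (ℕ.s≤s (ℕ.s≤s ()))
      conclusion = type-D 2 (φ (suc zero)) (φ (suc zero)) g′ P′ (λ _ → refl) (λ _ → refl) inners leaf leaf rel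
      go : Periodic G₂ φ
      go zero       = proj₂ (proj₂ conclusion) 0 ℕ.z<s
      go (suc zero) = proj₁ conclusion

    matches : Bool → ℕ → Sign → Bool
    matches true  1 ⊖ = true
    matches false 1 ⊕ = true
    matches _     0 ⊙ = true
    matches _     _ _ = false

    module _ (t : DynkinType) (Q : Exchange (rank t)) (anti : ∀ i j → entry Q j i ≡ opp (entry Q i j))
      (ok : allᵇ (λ v → allᵇ λ w → matches (before t (toℕ w) (toℕ v)) (exponent t (toℕ w) (toℕ v)) (entry Q v w)) ≡ true) where
      tree-relation : ∀ φ → System t φ → ∀ v m → φ v m * φ v (suc m) ≡ post (Slices.neighbours Q anti K (λ j n → pre (φ j n)) v m)
      tree-relation φ system v m = trans (system v m) (cong post (∏-cong λ w →
        lemma (φ w) (before t (toℕ w) (toℕ v)) (exponent t (toℕ w) (toℕ v)) (entry Q v w)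
          (allᵇ-sound (λ w → matches (before t (toℕ w) (toℕ v)) (exponent t (toℕ w) (toℕ v)) (entry Q v w))
            (allᵇ-sound (λ v → allᵇ λ w → matches (before t (toℕ w) (toℕ v)) (exponent t (toℕ w) (toℕ v)) (entry Q v w)) ok v) w)))
        where
        lemma : ∀ (f : ℕ → Carrier) b e s → matches b e s ≡ true →
          _^_ K (pre (f (later b m))) e ≡ Slices.neighbour Q anti K s (λ n → pre (f n)) m
        lemma f true  1 ⊖ h = *-identityʳ _
        lemma f false 1 ⊕ h = *-identityʳ _
        lemma f true  0 ⊙ h = refl
        lemma f false 0 ⊙ h = refl

    periodic-E₆ : ∀ φ → System E₆ φ → Periodic E₆ φ
    periodic-E₆ φ system v = type-E₆ φ (tree-relation E₆ (treeExchange 6) (antisymmetricᵇ-sound (treeExchange 6) refl) refl φ system) v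
    periodic-E₇ : ∀ φ → System E₇ φ → Periodic E₇ φ
    periodic-E₇ φ system v = type-E₇ φ (tree-relation E₇ (treeExchange 7) (antisymmetricᵇ-sound (treeExchange 7) refl) refl φ system) v
    periodic-E₈ : ∀ φ → System E₈ φ → Periodic E₈ φ
    periodic-E₈ φ system v = type-E₈ φ (tree-relation E₈ (treeExchange 8) (antisymmetricᵇ-sound (treeExchange 8) refl) refl φ system) v

    -- The fibres of `foldF₄` are the orbits of `star E₆`, so the twist in the periodicity of E₆
    -- disappears after folding.
    periodic-F₄ : ∀ φ → System F₄ φ → Periodic F₄ φ
    periodic-F₄ φ system = go
      where
      open Explicit F₄ φ system
      foldF₄ : Fin 6 → Fin 4
      foldF₄ = Vec.lookup (# 0 ∷ # 3 ∷ # 1 ∷ # 2 ∷ # 1 ∷ # 0 ∷ [])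
      rel : ∀ i m → φ (foldF₄ i) m * φ (foldF₄ i) (suc m) ≡ post (E₆-Frieze.neighbours K (λ j n → pre (φ (foldF₄ j) n)) i m)
      rel zero m = trans (explicit 0 m ℕ.z<s) (cong post (just-injective
        (solve 1 (λ x → x :* con 1 := con 1 :* (con 1 :* (x :* (con 1 :* (con 1 :* (con 1 :* con 1)))))) refl (just (P 1 (suc m))))))
      rel (suc zero) m = trans (explicit-at (# 3) m) (cong post (just-injective
        (solve 1 (λ x → x :* (con 1 :* con 1) := con 1 :* (con 1 :* (con 1 :* (x :* (con 1 :* (con 1 :* con 1)))))) refl (just (P 2 (suc m))))))
      rel (suc (suc zero)) m = trans (explicit-at (# 1) m) (cong post (just-injective
        (solve 2 (λ x y → x :* (y :* con 1) := x :* (con 1 :* (con 1 :* (y :* (con 1 :* (con 1 :* con 1)))))) refl (just (P 0 m)) (just (P 2 (suc m))))))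
      rel (suc (suc (suc zero))) m = trans (explicit-at (# 2) m) (cong post (just-injective
        (solve 2 (λ x y → x :* (x :* (y :* con 1)) := con 1 :* (y :* (x :* (con 1 :* (x :* (con 1 :* con 1)))))) refl (just (P 1 m)) (just (P 3 m)))))
      rel (suc (suc (suc (suc zero)))) m = trans (explicit-at (# 1) m) (cong post (just-injective
        (solve 2 (λ x y → x :* (y :* con 1) := con 1 :* (con 1 :* (con 1 :* (y :* (con 1 :* (x :* con 1)))))) refl (just (P 0 m)) (just (P 2 (suc m))))))
      rel (suc (suc (suc (suc (suc zero))))) m = trans (explicit 0 m ℕ.z<s) (cong post (just-injective
        (solve 1 (λ x → x :* con 1 := con 1 :* (con 1 :* (con 1 :* (con 1 :* (x :* (con 1 :* con 1)))))) refl (just (P 1 (suc m))))))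
      conclusion = type-E₆ (λ j → φ (foldF₄ j)) rel
      go : Periodic F₄ φ
      go zero                   = conclusion (# 0)
      go (suc zero)             = conclusion (# 2)
      go (suc (suc zero))       = conclusion (# 3)
      go (suc (suc (suc zero))) = conclusion (# 1)

    periodic : ∀ t φ → System t φ → Periodic t φ
    periodic (𝔸 k) = periodic-𝔸 k
    periodic (𝔹 k) = periodic-𝔹 k
    periodic (ℂ k) = periodic-ℂ k
    periodic (𝔻 k) = periodic-𝔻 k
    periodic E₆ = periodic-E₆
    periodic E₇ = periodic-E₇
    periodic E₈ = periodic-E₈
    periodic F₄ = periodic-F₄
    periodic G₂ = periodic-G₂

-- The simply laced types, for friezes and Y-friezes

module _ {c} (K : SemiField c) where
  open SemiField K

  private
    bound : ∀ {p q n} → suc p ℕ.+ suc q ≡ suc n → p ℕ.< n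
    bound {p} {q} eq = ℕ.≤-trans (ℕ.m≤m+n (suc p) q) (ℕ.≤-reflexive (ℕ.suc-injective (trans (sym (ℕ.+-suc (suc p) q)) eq)))

  -- The formulas for friezes concern a single array that is 1 on the boundary. This is P, which
  -- coincides with g on the inner rows as `pre` is the identity; `inner` transfers relations and
  -- conclusions.
  friezeBase : Systems.BasePeriodic K id (λ x → 1# + x)
  friezeBase = record
    { type-A = λ n g P bottom top inner rel p q eq →
        trans (sym (inner q _ (bound (trans (ℕ.+-comm (suc q) (suc p)) eq))))
        (trans (FriezeA.friezeA-periodic K n P bottom top
          (λ p m p< → trans (cong₂ _*_ (inner p m p<) (inner p (suc m) p<)) (rel p m p<)) (suc p) (suc q) eq)
        (inner p 0 (bound eq)))
    ; type-D = λ r a b g P bottom top inner rel-a rel-b rel →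
        let rel′ = λ q m q< → trans (cong₂ _*_ (inner q m q<) (inner q (suc m) q<)) (rel q m q<)
        in FriezeD.a-periodic K r a b P bottom top rel-a rel-b rel′
         , FriezeD.b-periodic K r a b P bottom top rel-a rel-b rel′
         , λ q q< → trans (sym (inner q _ q<)) (trans
             (FriezeD.u-periodic K r a b P bottom top rel-a rel-b rel′ (suc q) (ℕ.≤-trans q< (ℕ.n≤1+n r)))
             (inner q 0 q<))
    ; type-E₆ = E₆-frieze-periodic K ; type-E₇ = E₇-frieze-periodic K ; type-E₈ = E₈-frieze-periodic K }

  Y-friezeBase : Systems.BasePeriodic K (λ x → 1# + x) id
  Y-friezeBase = record
    { type-A = YFriezeA.Y-friezeA-periodic K
    ; type-D = λ r a b g P bottom top inner rel-a rel-b rel →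
        YFriezeD.Y-a-periodic K r a b g P bottom top inner rel-a rel-b rel
        , YFriezeD.Y-b-periodic K r a b g P bottom top inner rel-a rel-b rel
        , YFriezeD.Y-g-periodic K r a b g P bottom top inner rel-a rel-b rel
    ; type-E₆ = E₆-Y-frieze-periodic K ; type-E₇ = E₇-Y-frieze-periodic K ; type-E₈ = E₈-Y-frieze-periodic K }

-- Delays relating two orientations

-- lt w v is 1 if w precedes v in the given labelling and 0 otherwise. Shifting the entries of each vertex v by
-- delay v turns the orientation given by the labelling into the orientation `before`.
delayChain delayE delayF₄ delayD : (ℕ → ℕ → ℕ) → ℕ → ℕ
delayChain lt zero    = 0
delayChain lt (suc p) = delayChain lt p ℕ.+ lt (suc p) p

delayE lt 0 = lt 2 3 ℕ.+ lt 0 2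
delayE lt 1 = lt 1 3
delayE lt 2 = lt 2 3
delayE lt 3 = 0
delayE lt 4 = lt 4 3
delayE lt 5 = delayE lt 4 ℕ.+ lt 5 4
delayE lt 6 = delayE lt 5 ℕ.+ lt 6 5
delayE lt 7 = delayE lt 6 ℕ.+ lt 7 6
delayE lt _ = 0

delayF₄ lt 0 = lt 1 2 ℕ.+ lt 0 1
delayF₄ lt 1 = lt 1 2
delayF₄ lt 3 = lt 3 2
delayF₄ lt _ = 0

-- Starting at 1 keeps the other leaf within the naturals: its delay has to be that of vertex 2
-- minus `lt 2 1`, which is `lt 2 0 + lt 1 2` because `lt 2 1` and `lt 1 2` add up to 1.
delayD lt 0 = 1
delayD lt 1 = lt 2 0 ℕ.+ lt 1 2
delayD lt 2 = suc (lt 2 0)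
delayD lt (suc (suc (suc p))) = delayD lt (suc (suc p)) ℕ.+ lt (suc (suc (suc p))) (suc (suc p))

delay : DynkinType → (ℕ → ℕ → ℕ) → ℕ → ℕ
delay (𝔻 k) = delayD
delay E₆ = delayE
delay E₇ = delayE
delay E₈ = delayE
delay F₄ = delayF₄
delay _  = delayChain

module Delays (lt : ℕ → ℕ → ℕ) where

  -- The relation of v at time `m + δ v` contains the entry of w at time `m + δ v + lt w v`. On the
  -- clock of w, which is shifted by `δ w`, this has to be m, or m + 1 if b puts w before v.
  Balanced : (ℕ → ℕ) → (ℕ → ℕ → Bool) → ℕ → ℕ → Set
  Balanced δ b v w = δ v ℕ.+ lt w v ≡ δ w ℕ.+ indicator (b w v)

  parent-child : ∀ δ b {p q} → b q p ≡ false → δ q ≡ δ p ℕ.+ lt q p → Balanced δ b p q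
  parent-child δ b {p} {q} e h rewrite e = trans (sym h) (sym (ℕ.+-identityʳ (δ q)))

  AllBalanced : ℕ → (ℕ → ℕ) → (ℕ → ℕ → Bool) → ℕ → List ℕ → Set
  AllBalanced n δ b v = All (λ w → w ℕ.< n → Balanced δ b v w)

  module _ {n} (total : ∀ w v → w ℕ.< n → v ℕ.< n → w ≢ v → lt w v ℕ.+ lt v w ≡ 1) where

    child-parent : ∀ δ b {p q} → p ℕ.< n → q ℕ.< n → p ≢ q → b p q ≡ true → δ q ≡ δ p ℕ.+ lt q p → Balanced δ b q p
    child-parent δ b {p} {q} p< q< p≢q e h rewrite e = trans (cong (ℕ._+ lt p q) h)
      (trans (ℕ.+-assoc (δ p) _ _) (cong (δ p ℕ.+_) (total q p q< p< (≢-sym p≢q))))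

    chain-up : ∀ p → p ℕ.< n → Balanced (delayChain lt) ℕ._<ᵇ_ p (suc p)
    chain-up p p< = parent-child (delayChain lt) ℕ._<ᵇ_ {p} {suc p} (suc-<ᵇ p) refl

    chain-down : ∀ p → suc p ℕ.< n → p ℕ.< n → Balanced (delayChain lt) ℕ._<ᵇ_ (suc p) p
    chain-down p sp< p< = child-parent (delayChain lt) ℕ._<ᵇ_ {p} {suc p} p< sp< (≢-sym ℕ.1+n≢n) (<ᵇ-suc p) refl

    chain-balanced : ∀ v → v ℕ.< n → AllBalanced n (delayChain lt) ℕ._<ᵇ_ v (chain v)
    chain-balanced zero    v< = (λ _ → chain-up 0 v<) ∷ []
    chain-balanced (suc p) v< = chain-down p v< ∷ (λ _ → chain-up (suc p) v<) ∷ []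

    D-balanced : ∀ k v → v ℕ.< n → AllBalanced n (delayD lt) ℕ._<ᵇ_ v (nbrs (𝔻 k) v)
    D-balanced k 0 v< = (λ _ → parent-child (delayD lt) ℕ._<ᵇ_ {0} {2} refl refl) ∷ []
    D-balanced k 1 v< = (λ w< → trans (ℕ.+-assoc (lt 2 0) _ _) (trans (cong (lt 2 0 ℕ.+_) (total 1 2 v< w< λ ()))
      (trans (ℕ.+-comm (lt 2 0) 1) (sym (ℕ.+-identityʳ _))))) ∷ []
    D-balanced k 2 v< =
      (λ w< → child-parent (delayD lt) ℕ._<ᵇ_ {0} {2} w< v< (λ ()) refl refl)
      ∷ (λ _ → ℕ.+-comm 1 (lt 2 0 ℕ.+ lt 1 2))
      ∷ (λ _ → parent-child (delayD lt) ℕ._<ᵇ_ {2} {3} refl refl) ∷ []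
    D-balanced k (suc (suc (suc p))) v< =
      (λ w< → child-parent (delayD lt) ℕ._<ᵇ_ {suc (suc p)} {suc (suc (suc p))} w< v< (≢-sym ℕ.1+n≢n) (<ᵇ-suc p) refl)
      ∷ (λ _ → parent-child (delayD lt) ℕ._<ᵇ_ {suc (suc (suc p))} {suc (suc (suc (suc p)))} (suc-<ᵇ p) refl) ∷ []

    E-balanced : n ℕ.≤ 8 → ∀ v → v ℕ.< n → AllBalanced n (delayE lt) (λ w v → parent v ℕ.≡ᵇ w) v (nbrsE v)
    E-balanced n≤8 v v< = go v v<
      where
      b : ℕ → ℕ → Bool
      b w v = parent v ℕ.≡ᵇ w
      up : ∀ p q → b q p ≡ false → delayE lt q ≡ delayE lt p ℕ.+ lt q p → q ℕ.< n → Balanced (delayE lt) b p q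
      up p q e h _ = parent-child (delayE lt) b {p} {q} e h
      down : ∀ p q → q ℕ.< n → p ≢ q → b p q ≡ true → delayE lt q ≡ delayE lt p ℕ.+ lt q p → p ℕ.< n → Balanced (delayE lt) b q p
      down p q q< p≢q e h p< = child-parent (delayE lt) b p< q< p≢q e h
      absurd : ∀ {m} → suc (suc (suc (suc (suc (suc (suc (suc m))))))) ℕ.< n → ∀ {A : Set} → A
      absurd h with ℕ.≤-trans h n≤8
      ... | ℕ.s≤s (ℕ.s≤s (ℕ.s≤s (ℕ.s≤s (ℕ.s≤s (ℕ.s≤s (ℕ.s≤s (ℕ.s≤s ())))))))
      go : ∀ v → v ℕ.< n → AllBalanced n (delayE lt) b v (nbrsE v)
      go 0 v< = down 2 0 v< (λ ()) refl refl ∷ []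
      go 1 v< = down 3 1 v< (λ ()) refl refl ∷ []
      go 2 v< = up 2 0 refl refl ∷ down 3 2 v< (λ ()) refl refl ∷ []
      go 3 v< = up 3 1 refl refl ∷ up 3 2 refl refl ∷ up 3 4 refl refl ∷ []
      go 4 v< = down 3 4 v< (λ ()) refl refl ∷ up 4 5 refl refl ∷ []
      go 5 v< = down 4 5 v< (λ ()) refl refl ∷ up 5 6 refl refl ∷ []
      go 6 v< = down 5 6 v< (λ ()) refl refl ∷ up 6 7 refl refl ∷ []
      go 7 v< = down 6 7 v< (λ ()) refl refl ∷ (λ h → absurd h) ∷ []
      go (suc (suc (suc (suc (suc (suc (suc (suc v)))))))) v< = absurd v<

    F₄-balanced : n ≡ 4 → ∀ v → v ℕ.< n → AllBalanced n (delayF₄ lt) (before F₄) v (nbrs F₄ v)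
    F₄-balanced refl = go
      where
      up : ∀ p q → before F₄ q p ≡ false → delayF₄ lt q ≡ delayF₄ lt p ℕ.+ lt q p → q ℕ.< 4 → Balanced (delayF₄ lt) (before F₄) p q
      up p q e h _ = parent-child (delayF₄ lt) (before F₄) {p} {q} e h
      down : ∀ p q → q ℕ.< 4 → p ≢ q → before F₄ p q ≡ true → delayF₄ lt q ≡ delayF₄ lt p ℕ.+ lt q p → p ℕ.< 4 → Balanced (delayF₄ lt) (before F₄) q p
      down p q q< p≢q e h p< = child-parent (delayF₄ lt) (before F₄) p< q< p≢q e h
      go : ∀ v → v ℕ.< 4 → AllBalanced 4 (delayF₄ lt) (before F₄) v (nbrs F₄ v)
      go 0 v< = down 1 0 v< (λ ()) refl refl ∷ []
      go 1 v< = up 1 0 refl refl ∷ down 2 1 v< (λ ()) refl refl ∷ []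
      go 2 v< = up 2 1 refl refl ∷ up 2 1 refl refl ∷ up 2 3 refl refl ∷ []
      go 3 v< = down 2 3 v< (λ ()) refl refl ∷ (λ { (ℕ.s≤s (ℕ.s≤s (ℕ.s≤s (ℕ.s≤s ())))) }) ∷ []
      go (suc (suc (suc (suc v)))) (ℕ.s≤s (ℕ.s≤s (ℕ.s≤s (ℕ.s≤s ()))))

  balanced : ∀ t → (∀ w v → w ℕ.< rank t → v ℕ.< rank t → w ≢ v → lt w v ℕ.+ lt v w ≡ 1) →
    ∀ v → v ℕ.< rank t → AllBalanced (rank t) (delay t lt) (before t) v (nbrs t v)
  balanced (𝔸 k) total v v< = chain-balanced total v v<
  balanced (𝔹 k) total 0 v< = chain-balanced total 0 v<
  balanced (𝔹 k) total 1 v< = chain-down total 0 v< ∷ chain-down total 0 v< ∷ (λ _ → chain-up total 1 v<) ∷ []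
  balanced (𝔹 k) total (suc (suc v)) v< = chain-balanced total (suc (suc v)) v<
  balanced (ℂ k) total 0 v< = (λ _ → chain-up total 0 v<) ∷ (λ _ → chain-up total 0 v<) ∷ []
  balanced (ℂ k) total (suc v) v< = chain-balanced total (suc v) v<
  balanced (𝔻 k) total v v< = D-balanced total k v v<
  balanced E₆ total v v< = E-balanced total (ℕ.m≤n+m 6 2) v v<
  balanced E₇ total v v< = E-balanced total (ℕ.m≤n+m 7 1) v v<
  balanced E₈ total v v< = E-balanced total (ℕ.m≤n+m 8 0) v v<
  balanced F₄ total v v< = F₄-balanced total refl v v<
  balanced G₂ total 0 v< = (λ _ → chain-up total 0 v<) ∷ (λ _ → chain-up total 0 v<) ∷ (λ _ → chain-up total 0 v<) ∷ []
  balanced G₂ total 1 v< = chain-down total 0 v< ∷ []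
  balanced G₂ total (suc (suc v)) (ℕ.s≤s (ℕ.s≤s ()))

-- Arbitrary labellings

count-All : ∀ {Q : ℕ → Set} w {L} → All Q L → count w L ≡ 0 ⊎ Q w
count-All w [] = inj₁ refl
count-All w {p ∷ L} (q ∷ qs) with w ℕ.≡ᵇ p in e
... | true  = inj₂ (subst _ (sym (≡ᵇ-sound w p e)) q)
... | false = count-All w qs

indicator-total : ∀ m n → m ≢ n → indicator (m ℕ.<ᵇ n) ℕ.+ indicator (n ℕ.<ᵇ m) ≡ 1
indicator-total zero    zero    m≢n = contradiction refl m≢n
indicator-total zero    (suc n) m≢n = refl
indicator-total (suc m) zero    m≢n = refl
indicator-total (suc m) (suc n) m≢n = indicator-total m n (λ eq → m≢n (cong suc eq))

≡ᵇ-≢ : ∀ {m n} → m ≢ n → (m ℕ.≡ᵇ n) ≡ false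
≡ᵇ-≢ {m} {n} m≢n with m ℕ.≡ᵇ n in e
... | true  = contradiction (≡ᵇ-sound m n e) m≢n
... | false = refl

later-indicator : ∀ b m → later b m ≡ m ℕ.+ indicator b
later-indicator true  m = ℕ.+-comm 1 m
later-indicator false m = sym (ℕ.+-identityʳ m)

module Relabelled {r : ℕ} (A : Matrix r) (t : DynkinType) (e : Fin r ↔ Fin (rank t))
  (A≡ : ∀ i j → A i j ≡ stdCartan t (Inverse.to e i) (Inverse.to e j)) where

  to = Inverse.to e
  from = Inverse.from e

  to-from : ∀ v → to (from v) ≡ v
  to-from v = Inverse.inverseˡ e refl

  from-to : ∀ i → from (to i) ≡ i
  from-to i = Inverse.inverseʳ e refl

  A-from : ∀ u v → A (from u) (from v) ≡ stdCartan t u v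
  A-from u v = trans (A≡ (from u) (from v)) (cong₂ (stdCartan t) (to-from u) (to-from v))

  label : ℕ → ℕ
  label = extendBy 0 (λ v → toℕ (from v))

  label-toℕ : ∀ v → label (toℕ v) ≡ toℕ (from v)
  label-toℕ = extendBy-toℕ 0 (λ v → toℕ (from v))

  precedes : Fin (rank t) → Fin (rank t) → Bool
  precedes w v = toℕ (from w) ℕ.<ᵇ toℕ (from v)

  lt : ℕ → ℕ → ℕ
  lt w v = indicator (label w ℕ.<ᵇ label v)

  δ : Fin (rank t) → ℕ
  δ v = delay t lt (toℕ v)

  from-≢ : ∀ {w v} → w ≢ v → toℕ (from w) ≢ toℕ (from v)
  from-≢ {w} {v} w≢v eq = w≢v (trans (sym (to-from w)) (trans (cong to (Fin.toℕ-injective eq)) (to-from v)))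

  lt-total : ∀ w v → w ℕ.< rank t → v ℕ.< rank t → w ≢ v → lt w v ℕ.+ lt v w ≡ 1
  lt-total w v w< v< w≢v = subst₂ (λ w v → lt w v ℕ.+ lt v w ≡ 1) (Fin.toℕ-fromℕ< w<) (Fin.toℕ-fromℕ< v<)
    (indicator-total _ _ λ eq → from-≢ {fromℕ< w<} {fromℕ< v<}
      (λ eq′ → w≢v (trans (sym (Fin.toℕ-fromℕ< w<)) (trans (cong toℕ eq′) (Fin.toℕ-fromℕ< v<))))
      (trans (sym (label-toℕ (fromℕ< w<))) (trans eq (label-toℕ (fromℕ< v<)))))

  delays : ∀ w v → exponent t (toℕ w) (toℕ v) ≡ 0 ⊎
           δ v ℕ.+ indicator (precedes w v) ≡ δ w ℕ.+ indicator (before t (toℕ w) (toℕ v))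
  delays w v with count-All (toℕ w) (Delays.balanced lt t lt-total (toℕ v) (Fin.toℕ<n v))
  ... | inj₁ zero-count = inj₁ (trans (counts t w v) zero-count)
  ... | inj₂ eq = inj₂ (trans (cong₂ (λ x y → δ v ℕ.+ indicator (x ℕ.<ᵇ y)) (sym (label-toℕ w)) (sym (label-toℕ v)))
                              (eq (Fin.toℕ<n w)))

  module _ {c} (K : SemiField c) (pre post : SemiField.Carrier K → SemiField.Carrier K) where
    open SemiField K
    open SemiFieldProperties K
    open Systems K pre post
    open ≡-Reasoning

    module _ (f : Fin r → ℤ → Carrier)
      (frieze : ∀ i m → f i m * f i (m ℤ.+ ℤ.+ 1) ≡
        post (∏ K (splitFactor K A i (λ j → pre (f j m)) (λ j → pre (f j (m ℤ.+ ℤ.+ 1)))))) where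

      -- The origin z is an arbitrary integer, so periodicity of sequences indexed by naturals, read
      -- near time 0, covers the whole frieze.
      reoriented : ℤ → Fin (rank t) → ℕ → Carrier
      reoriented z v n = f (from v) (z ℤ.+ ℤ.+ (n ℕ.+ δ v))

      +1 : ∀ z n → z ℤ.+ ℤ.+ n ℤ.+ ℤ.+ 1 ≡ z ℤ.+ ℤ.+ suc n
      +1 z n = trans (ℤ.+-assoc z (ℤ.+ n) (ℤ.+ 1)) (cong (λ k → z ℤ.+ ℤ.+ k) (ℕ.+-comm n 1))

      reoriented-system : ∀ z → System t (reoriented z)
      reoriented-system z v m = begin
        f (from v) now * f (from v) (z ℤ.+ ℤ.+ suc (m ℕ.+ δ v)) ≡⟨ cong (λ x → f (from v) now * f (from v) x) (+1 z (m ℕ.+ δ v)) ⟨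
        f (from v) now * f (from v) (now ℤ.+ ℤ.+ 1)             ≡⟨ frieze (from v) now ⟩
        post (∏ K (split (from v)))                             ≡⟨ cong post (∏-reindex e′ (split (from v))) ⟩
        post (∏ K (λ w → split (from v) (from w)))              ≡⟨ cong post (∏-cong factor) ⟩
        post (∏ K λ w → _^_ K (pre (reoriented z w (later (before t (toℕ w) (toℕ v)) m))) (exponent t (toℕ w) (toℕ v))) ∎
        where
        e′ = ↔-sym e
        now = z ℤ.+ ℤ.+ (m ℕ.+ δ v)
        split : Fin r → Fin r → Carrier
        split i = splitFactor K A i (λ j → pre (f j now)) (λ j → pre (f j (now ℤ.+ ℤ.+ 1)))
        factor : ∀ w → split (from v) (from w) ≡ _^_ K (pre (reoriented z w (later (before t (toℕ w) (toℕ v)) m))) (exponent t (toℕ w) (toℕ v))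
        factor w with w Fin.≟ v
        ... | yes refl rewrite <ᵇ-irrefl (toℕ (from w)) | ≡ᵇ-refl (toℕ w) = refl
        ... | no w≢v = go (precedes v w) (precedes w v) refl refl
          where
          ε : ℕ
          ε = exponent t (toℕ w) (toℕ v)
          A≡ε : ∣ A (from w) (from v) ∣ ≡ ε
          A≡ε = trans (cong ∣_∣ (A-from w v)) lemma
            where
            lemma : ∣ stdCartan t w v ∣ ≡ ε
            lemma rewrite ≡ᵇ-≢ {toℕ w} {toℕ v} (λ eq → w≢v (Fin.toℕ-injective eq)) = refl
          time : ∀ x → δ v ℕ.+ x ≡ δ w ℕ.+ indicator (before t (toℕ w) (toℕ v)) →
                 m ℕ.+ δ v ℕ.+ x ≡ later (before t (toℕ w) (toℕ v)) m ℕ.+ δ w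
          time x eq = begin
            m ℕ.+ δ v ℕ.+ x ≡⟨ ℕ.+-assoc m _ x ⟩
            m ℕ.+ (δ v ℕ.+ x) ≡⟨ cong (m ℕ.+_) eq ⟩
            m ℕ.+ (δ w ℕ.+ indicator (before t (toℕ w) (toℕ v))) ≡⟨ cong (m ℕ.+_) (ℕ.+-comm (δ w) _) ⟩
            m ℕ.+ (indicator (before t (toℕ w) (toℕ v)) ℕ.+ δ w) ≡⟨ ℕ.+-assoc m _ (δ w) ⟨
            m ℕ.+ indicator (before t (toℕ w) (toℕ v)) ℕ.+ δ w ≡⟨ cong (ℕ._+ δ w) (later-indicator (before t (toℕ w) (toℕ v)) m) ⟨
            later (before t (toℕ w) (toℕ v)) m ℕ.+ δ w ∎
          go : ∀ b b′ → precedes v w ≡ b → precedes w v ≡ b′ →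
            split (from v) (from w) ≡ _^_ K (pre (reoriented z w (later (before t (toℕ w) (toℕ v)) m))) ε
          go true b′ e₁ e₂ rewrite e₁ | A≡ε with delays w v
          ... | inj₁ ε≡0 rewrite ε≡0 = refl
          ... | inj₂ eq = cong (λ x → _^_ K (pre (f (from w) (z ℤ.+ ℤ.+ x))) ε)
            (trans (sym (ℕ.+-identityʳ _)) (time 0 (trans (cong (λ b → δ v ℕ.+ indicator b) (sym not-before)) eq)))
            where
            not-before : precedes w v ≡ false
            not-before with precedes w v | indicator-total (toℕ (from v)) (toℕ (from w)) (from-≢ {v} {w} (≢-sym w≢v))
            ... | false | _ = refl
            ... | true  | s with trans (sym (cong (λ b → indicator b ℕ.+ 1) e₁)) s
            ...   | ()
          go false true e₁ e₂ rewrite e₁ | e₂ | A≡ε with delays w v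
          ... | inj₁ ε≡0 rewrite ε≡0 = refl
          ... | inj₂ eq = cong (λ x → _^_ K (pre (f (from w) x)) ε) (trans (+1 z (m ℕ.+ δ v))
            (cong (λ x → z ℤ.+ ℤ.+ x) (trans (ℕ.+-comm 1 _) (time 1 (trans (cong (λ b → δ v ℕ.+ indicator b) (sym e₂)) eq)))))
          go false false e₁ e₂ with trans (sym (cong₂ (λ a b → indicator a ℕ.+ indicator b) e₁ e₂))
                                          (indicator-total (toℕ (from v)) (toℕ (from w)) (from-≢ {v} {w} (≢-sym w≢v)))
          ... | ()

      reoriented-invariant : BasePeriodic →
        (∀ v → suc (mᵢ A t e (from (star t v)) ℕ.+ δ v) ≡ δ (star t v) ℕ.+ period t (toℕ v)) → Invariant (F A t e) f
      reoriented-invariant base shift i m = begin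
        f (from (star t v)) (m ℤ.+ ℤ.+ M ℤ.+ ℤ.+ 1)         ≡⟨ cong (f (from (star t v))) (+1 m M) ⟩
        f (from (star t v)) (m ℤ.+ ℤ.+ suc M)               ≡⟨ cong (f (from (star t v))) times ⟩
        reoriented z (star t v) (s ℕ.+ period t (toℕ v))    ≡⟨ periodic base t (reoriented z) (reoriented-system z) v ⟩
        f (from v) (z ℤ.+ ℤ.+ (s ℕ.+ δ v))                  ≡⟨ cong₂ f (from-to i) z+ ⟩
        f i m                                               ∎
        where
        v = to i
        s = offset t (toℕ v)
        M = mᵢ A t e (from (star t v))
        -- Makes `f i m` the entry of v at time s, the offset at which `Periodic` compares.
        z = m ℤ.- ℤ.+ (s ℕ.+ δ v)
        z+ : z ℤ.+ ℤ.+ (s ℕ.+ δ v) ≡ m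
        z+ = trans (ℤ.+-assoc m _ _) (trans (cong (λ x → m ℤ.+ x) (ℤ.+-inverseˡ (ℤ.+ (s ℕ.+ δ v)))) (ℤ.+-identityʳ m))
        steps : s ℕ.+ δ v ℕ.+ suc M ≡ s ℕ.+ period t (toℕ v) ℕ.+ δ (star t v)
        steps = trans (ℕ.+-assoc s _ _) (trans (cong (s ℕ.+_) (trans (ℕ.+-comm (δ v) (suc M)) (trans (shift v) (ℕ.+-comm (δ (star t v)) _))))
                  (sym (ℕ.+-assoc s _ _)))
        times : m ℤ.+ ℤ.+ suc M ≡ z ℤ.+ ℤ.+ (s ℕ.+ period t (toℕ v) ℕ.+ δ (star t v))
        times = trans (cong (ℤ._+ ℤ.+ suc M) (sym z+)) (trans (ℤ.+-assoc z _ _) (cong (λ x → z ℤ.+ ℤ.+ x) steps))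

-- Walks in the diagram and the numbers m_i

record Edge (t : DynkinType) (u w : Fin (rank t)) : Set where
  constructor edge
  field
    outgoing : stdCartan t u w ≡ -1ℤ
    incoming : stdCartan t w u ≡ -1ℤ
    ordered  : before t (toℕ u) (toℕ w) ≡ true

-- Walks in the diagram, with the numbers of steps along and against the orientation `before`.
data Walk (t : DynkinType) (v : Fin (rank t)) : Fin (rank t) → List (Fin (rank t)) → ℕ → ℕ → Set where
  stop : Walk t v v (v ∷ []) 0 0
  along   : ∀ {u w L f b} → Edge t u w → Walk t v w L f b → Walk t v u (u ∷ L) (suc f) b
  against : ∀ {u w L f b} → Edge t w u → Walk t v w L f b → Walk t v u (u ∷ L) f (suc b)

snoc-along : ∀ {t u v w L f b} → Walk t w u L f b → Edge t w v → Walk t v u (L List.∷ʳ v) (suc f) b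
snoc-along stop          e = along e stop
snoc-along (along e' W)   e = along e' (snoc-along W e)
snoc-along (against e' W) e = against e' (snoc-along W e)

snoc-against : ∀ {t u v w L f b} → Walk t w u L f b → Edge t v w → Walk t v u (L List.∷ʳ v) f (suc b)
snoc-against stop          e = against e stop
snoc-against (along e' W)   e = along e' (snoc-against W e)
snoc-against (against e' W) e = against e' (snoc-against W e)

reverse-walk : ∀ {t u v L f b} → Walk t v u L f b → Walk t u v (List.reverse L) b f
reverse-walk stop = stop
reverse-walk {t} {u} {v} (along {L = L} e W) = subst (λ M → Walk t u v M _ _) (sym (List.unfold-reverse u L)) (snoc-against (reverse-walk W) e)
reverse-walk {t} {u} {v} (against {L = L} e W) = subst (λ M → Walk t u v M _ _) (sym (List.unfold-reverse u L)) (snoc-along (reverse-walk W) e)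

walk-head : ∀ {t u v L f b} → Walk t v u L f b → ∃ λ M → L ≡ u ∷ M
walk-head stop          = _ , refl
walk-head (along _ _)   = _ , refl
walk-head (against _ _) = _ , refl

length-filterᵇ : ∀ {a} {X : Set a} (p : X → Bool) x xs →
  List.length (List.filterᵇ p (x ∷ xs)) ≡ indicator (p x) ℕ.+ List.length (List.filterᵇ p xs)
length-filterᵇ p x xs with p x
... | true  = refl
... | false = refl

module Counting {r : ℕ} (A : Matrix r) (t : DynkinType) (e : Fin r ↔ Fin (rank t))
  (A≡ : ∀ i j → A i j ≡ stdCartan t (Inverse.to e i) (Inverse.to e j)) where
  open Relabelled A t e A≡

  edgesOf : List (Fin (rank t)) → List (Fin r × Fin r)
  edgesOf L = let p = List.map from L in List.zip p (List.drop 1 p)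

  forwards backwards : List (Fin (rank t)) → ℕ
  forwards L = List.length (List.filterᵇ (λ uv → arrowᵇ A t e (proj₁ uv) (proj₂ uv)) (edgesOf L))
  backwards L = List.length (List.filterᵇ (λ uv → arrowᵇ A t e (proj₂ uv) (proj₁ uv)) (edgesOf L))

  arrow-precedes : ∀ {u w} → stdCartan t u w ≡ -1ℤ → arrowᵇ A t e (from u) (from w) ≡ precedes u w
  arrow-precedes {u} {w} h rewrite trans (A-from u w) h = Bool.∧-identityʳ _

  forwards-∷ : ∀ {u w} M → stdCartan t u w ≡ -1ℤ → forwards (u ∷ w ∷ M) ≡ indicator (precedes u w) ℕ.+ forwards (w ∷ M)
  forwards-∷ {u} {w} M h = trans (length-filterᵇ _ (from u , from w) (edgesOf (w ∷ M)))
    (cong (λ b → indicator b ℕ.+ forwards (w ∷ M)) (arrow-precedes h))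

  backwards-∷ : ∀ {u w} M → stdCartan t w u ≡ -1ℤ → backwards (u ∷ w ∷ M) ≡ indicator (precedes w u) ℕ.+ backwards (w ∷ M)
  backwards-∷ {u} {w} M h = trans (length-filterᵇ _ (from u , from w) (edgesOf (w ∷ M)))
    (cong (λ b → indicator b ℕ.+ backwards (w ∷ M)) (arrow-precedes h))

  module _ {u w} (E : Edge t u w) where
    open Edge E

    edge-≢ : u ≢ w
    edge-≢ refl with trans (sym (cong (λ b → if b then ℤ.+ 2 else offDiag t (toℕ u) (toℕ u)) (≡ᵇ-refl (toℕ u)))) outgoing
    ... | ()

    edge-delay : δ w ℕ.+ indicator (precedes u w) ≡ δ u ℕ.+ 1
    edge-delay with delays u w
    ... | inj₂ eq = trans eq (cong (λ b → δ u ℕ.+ indicator b) ordered)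
    ... | inj₁ eq with trans (sym (cong ∣_∣ outgoing)) (trans lemma eq)
      where
      lemma : ∣ stdCartan t u w ∣ ≡ exponent t (toℕ u) (toℕ w)
      lemma rewrite ≡ᵇ-≢ {toℕ u} {toℕ w} (λ eq → edge-≢ (Fin.toℕ-injective eq)) = refl
    ...   | ()

    edge-total : indicator (precedes u w) ℕ.+ indicator (precedes w u) ≡ 1
    edge-total = indicator-total _ _ (from-≢ {u} {w} edge-≢)

  -- By `edge-delay`, twice the change of delay over an edge is its direction in `before` minus its
  -- direction in the labelling, each counted as 1 or -1. Along a walk from u to v this telescopes
  -- to 2 δ v - 2 δ u = (f - b) - (forwards - backwards), stated here without subtraction.
  walk-delay : ∀ {u v L f b} → Walk t v u L f b →
    (forwards L ℕ.+ (δ v ℕ.+ δ v ℕ.+ b) ≡ backwards L ℕ.+ (δ u ℕ.+ δ u ℕ.+ f)) × (forwards L ℕ.+ backwards L ≡ f ℕ.+ b)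
  walk-delay stop = refl , refl
  walk-delay {u} {v} (along {w = w} {L = L} {f} {b} E W) with walk-head W
  ... | M , refl = delayed , total
    where
    open ℕSolver.+-*-Solver
    x = indicator (precedes u w)
    y = indicator (precedes w u)
    IH = walk-delay W
    fw = forwards-∷ M (Edge.outgoing E)
    bw = backwards-∷ M (Edge.incoming E)
    total : forwards (u ∷ w ∷ M) ℕ.+ backwards (u ∷ w ∷ M) ≡ suc f ℕ.+ b
    total = trans (cong₂ ℕ._+_ fw bw) (trans
      (solve 4 (λ x y a b → (x :+ a) :+ (y :+ b) := (x :+ y) :+ (a :+ b)) refl x y (forwards (w ∷ M)) (backwards (w ∷ M)))
      (cong₂ ℕ._+_ (edge-total E) (proj₂ IH)))
    delayed : forwards (u ∷ w ∷ M) ℕ.+ (δ v ℕ.+ δ v ℕ.+ b) ≡ backwards (u ∷ w ∷ M) ℕ.+ (δ u ℕ.+ δ u ℕ.+ suc f)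
    delayed = ℕ.+-cancelˡ-≡ x _ _ (begin
      x ℕ.+ (forwards (u ∷ w ∷ M) ℕ.+ (δ v ℕ.+ δ v ℕ.+ b)) ≡⟨ cong (λ z → x ℕ.+ (z ℕ.+ (δ v ℕ.+ δ v ℕ.+ b))) fw ⟩
      x ℕ.+ (x ℕ.+ forwards (w ∷ M) ℕ.+ (δ v ℕ.+ δ v ℕ.+ b))
        ≡⟨ solve 3 (λ x a d → x :+ (x :+ a :+ d) := (x :+ x) :+ (a :+ d)) refl x (forwards (w ∷ M)) (δ v ℕ.+ δ v ℕ.+ b) ⟩
      (x ℕ.+ x) ℕ.+ (forwards (w ∷ M) ℕ.+ (δ v ℕ.+ δ v ℕ.+ b)) ≡⟨ cong ((x ℕ.+ x) ℕ.+_) (proj₁ IH) ⟩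
      (x ℕ.+ x) ℕ.+ (backwards (w ∷ M) ℕ.+ (δ w ℕ.+ δ w ℕ.+ f))
        ≡⟨ solve 4 (λ x a d f → (x :+ x) :+ (a :+ (d :+ d :+ f)) := (d :+ x) :+ (d :+ x) :+ (a :+ f)) refl x (backwards (w ∷ M)) (δ w) f ⟩
      (δ w ℕ.+ x) ℕ.+ (δ w ℕ.+ x) ℕ.+ (backwards (w ∷ M) ℕ.+ f) ≡⟨ cong (λ z → z ℕ.+ z ℕ.+ (backwards (w ∷ M) ℕ.+ f)) (edge-delay E) ⟩
      (δ u ℕ.+ 1) ℕ.+ (δ u ℕ.+ 1) ℕ.+ (backwards (w ∷ M) ℕ.+ f)
        ≡⟨ solve 3 (λ a d f → (d :+ con 1) :+ (d :+ con 1) :+ (a :+ f) := con 1 :+ (a :+ (d :+ d :+ (con 1 :+ f)))) refl (backwards (w ∷ M)) (δ u) f ⟩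
      1 ℕ.+ (backwards (w ∷ M) ℕ.+ (δ u ℕ.+ δ u ℕ.+ suc f)) ≡⟨ cong (ℕ._+ (backwards (w ∷ M) ℕ.+ (δ u ℕ.+ δ u ℕ.+ suc f))) (edge-total E) ⟨
      x ℕ.+ y ℕ.+ (backwards (w ∷ M) ℕ.+ (δ u ℕ.+ δ u ℕ.+ suc f))
        ≡⟨ solve 4 (λ x y a d → x :+ y :+ (a :+ d) := x :+ (y :+ a :+ d)) refl x y (backwards (w ∷ M)) (δ u ℕ.+ δ u ℕ.+ suc f) ⟩
      x ℕ.+ (y ℕ.+ backwards (w ∷ M) ℕ.+ (δ u ℕ.+ δ u ℕ.+ suc f)) ≡⟨ cong (λ z → x ℕ.+ (z ℕ.+ (δ u ℕ.+ δ u ℕ.+ suc f))) bw ⟨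
      x ℕ.+ (backwards (u ∷ w ∷ M) ℕ.+ (δ u ℕ.+ δ u ℕ.+ suc f)) ∎)
      where open ≡-Reasoning
  walk-delay {u} {v} (against {w = w} {L = L} {f} {b} E W) with walk-head W
  ... | M , refl = delayed , total
    where
    open ℕSolver.+-*-Solver
    x = indicator (precedes u w)
    y = indicator (precedes w u)
    IH = walk-delay W
    fw = forwards-∷ M (Edge.incoming E)
    bw = backwards-∷ M (Edge.outgoing E)
    total : forwards (u ∷ w ∷ M) ℕ.+ backwards (u ∷ w ∷ M) ≡ f ℕ.+ suc b
    total = trans (cong₂ ℕ._+_ fw bw) (trans
      (solve 4 (λ x y a b → (x :+ a) :+ (y :+ b) := (y :+ x) :+ (a :+ b)) refl x y (forwards (w ∷ M)) (backwards (w ∷ M)))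
      (trans (cong₂ ℕ._+_ (edge-total E) (proj₂ IH)) (sym (ℕ.+-suc f b))))
    delayed : forwards (u ∷ w ∷ M) ℕ.+ (δ v ℕ.+ δ v ℕ.+ suc b) ≡ backwards (u ∷ w ∷ M) ℕ.+ (δ u ℕ.+ δ u ℕ.+ f)
    delayed = ℕ.+-cancelˡ-≡ y _ _ (begin
      y ℕ.+ (forwards (u ∷ w ∷ M) ℕ.+ (δ v ℕ.+ δ v ℕ.+ suc b)) ≡⟨ cong (λ z → y ℕ.+ (z ℕ.+ (δ v ℕ.+ δ v ℕ.+ suc b))) fw ⟩
      y ℕ.+ (x ℕ.+ forwards (w ∷ M) ℕ.+ (δ v ℕ.+ δ v ℕ.+ suc b))
        ≡⟨ solve 5 (λ x y a d b → y :+ (x :+ a :+ (d :+ d :+ (con 1 :+ b))) := (y :+ x) :+ (con 1 :+ (a :+ (d :+ d :+ b)))) refl x y (forwards (w ∷ M)) (δ v) b ⟩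
      y ℕ.+ x ℕ.+ (1 ℕ.+ (forwards (w ∷ M) ℕ.+ (δ v ℕ.+ δ v ℕ.+ b))) ≡⟨ cong₂ (λ p q → p ℕ.+ (1 ℕ.+ q)) (edge-total E) (proj₁ IH) ⟩
      1 ℕ.+ (1 ℕ.+ (backwards (w ∷ M) ℕ.+ (δ w ℕ.+ δ w ℕ.+ f)))
        ≡⟨ solve 3 (λ a d f → con 1 :+ (con 1 :+ (a :+ (d :+ d :+ f))) := (d :+ con 1) :+ (d :+ con 1) :+ (a :+ f)) refl (backwards (w ∷ M)) (δ w) f ⟩
      (δ w ℕ.+ 1) ℕ.+ (δ w ℕ.+ 1) ℕ.+ (backwards (w ∷ M) ℕ.+ f) ≡⟨ cong (λ z → z ℕ.+ z ℕ.+ (backwards (w ∷ M) ℕ.+ f)) (edge-delay E) ⟨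
      (δ u ℕ.+ y) ℕ.+ (δ u ℕ.+ y) ℕ.+ (backwards (w ∷ M) ℕ.+ f)
        ≡⟨ solve 4 (λ y a d f → (d :+ y) :+ (d :+ y) :+ (a :+ f) := y :+ (y :+ a :+ (d :+ d :+ f))) refl y (backwards (w ∷ M)) (δ u) f ⟩
      y ℕ.+ (y ℕ.+ backwards (w ∷ M) ℕ.+ (δ u ℕ.+ δ u ℕ.+ f)) ≡⟨ cong (λ z → y ℕ.+ (z ℕ.+ (δ u ℕ.+ δ u ℕ.+ f))) bw ⟨
      y ℕ.+ (backwards (u ∷ w ∷ M) ℕ.+ (δ u ℕ.+ δ u ℕ.+ f)) ∎)
      where open ≡-Reasoning

  halve : ∀ X n m → X ℕ.+ (n ℕ.+ n) ≡ m ℕ.+ m → X ℕ./ 2 ℕ.+ n ≡ m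
  halve X n m eq = begin
    X ℕ./ 2 ℕ.+ n               ≡⟨ cong (X ℕ./ 2 ℕ.+_) (ℕ.m*n/n≡m n 2) ⟨
    X ℕ./ 2 ℕ.+ n ℕ.* 2 ℕ./ 2   ≡⟨ ℕ.+-distrib-/-∣ʳ X (divides n refl) ⟨
    (X ℕ.+ n ℕ.* 2) ℕ./ 2       ≡⟨ cong (ℕ._/ 2) (trans (cong (X ℕ.+_) (double n)) (trans eq (sym (double m)))) ⟩
    m ℕ.* 2 ℕ./ 2               ≡⟨ ℕ.m*n/n≡m m 2 ⟩
    m ∎
    where
    open ≡-Reasoning
    double : ∀ k → k ℕ.* 2 ≡ k ℕ.+ k
    double k = trans (ℕ.*-comm k 2) (cong (k ℕ.+_) (ℕ.+-identityʳ k))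

  -- After doubling, the labelling enters the left side through a_i - b_i and through the delays,
  -- and `walk-delay` cancels these contributions. What is left, h + 2 + f - b = 2 period, involves
  -- only the fixed orientation. The bound on f + b makes the truncated subtraction in `mᵢ` exact,
  -- and the equation itself shows that the number halved there is even.
  mᵢ-shift : ∀ v {f b} → Walk t v (star t v) (path t (star t v)) f b →
    coxeter t ℕ.+ 2 ℕ.+ f ≡ period t (toℕ v) ℕ.+ period t (toℕ v) ℕ.+ b → f ℕ.+ b ℕ.≤ coxeter t →
    suc (mᵢ A t e (from (star t v)) ℕ.+ δ v) ≡ δ (star t v) ℕ.+ period t (toℕ v)
  mᵢ-shift v {f} {b} W h≡ h≤ = trans (sym (ℕ.+-suc _ (δ v))) (trans (cong (λ z → z ℕ.+ suc (δ v)) m≡) (halve X (suc (δ v)) (δ v* ℕ.+ p)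
      (ℕ.+-cancelʳ-≡ (b ℕ.+ f ℕ.+ bs) _ _ doubled)))
    where
    open ℕSolver.+-*-Solver
    v* = star t v
    p = period t (toℕ v)
    h = coxeter t
    fs = forwards (path t v*)
    bs = backwards (path t v*)
    X = h ℕ.+ fs ℕ.∸ bs
    m≡ : mᵢ A t e (from v*) ≡ X ℕ./ 2
    m≡ = cong (λ u → (h ℕ.+ forwards (path t u) ℕ.∸ backwards (path t u)) ℕ./ 2) (to-from v*)
    X≡ : X ℕ.+ bs ≡ h ℕ.+ fs
    X≡ = ℕ.m∸n+n≡m (ℕ.≤-trans (ℕ.≤-trans (ℕ.m≤n+m bs fs) (ℕ.≤-trans (ℕ.≤-reflexive (proj₂ (walk-delay W))) h≤)) (ℕ.m≤m+n h fs))
    doubled : X ℕ.+ (suc (δ v) ℕ.+ suc (δ v)) ℕ.+ (b ℕ.+ f ℕ.+ bs) ≡ (δ v* ℕ.+ p) ℕ.+ (δ v* ℕ.+ p) ℕ.+ (b ℕ.+ f ℕ.+ bs)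
    doubled = begin
      X ℕ.+ (suc (δ v) ℕ.+ suc (δ v)) ℕ.+ (b ℕ.+ f ℕ.+ bs)
        ≡⟨ solve 5 (λ X d b f bs → X :+ ((con 1 :+ d) :+ (con 1 :+ d)) :+ (b :+ f :+ bs) := (X :+ bs) :+ (con 2 :+ f :+ (d :+ d :+ b))) refl X (δ v) b f bs ⟩
      (X ℕ.+ bs) ℕ.+ (2 ℕ.+ f ℕ.+ (δ v ℕ.+ δ v ℕ.+ b)) ≡⟨ cong (ℕ._+ (2 ℕ.+ f ℕ.+ (δ v ℕ.+ δ v ℕ.+ b))) X≡ ⟩
      (h ℕ.+ fs) ℕ.+ (2 ℕ.+ f ℕ.+ (δ v ℕ.+ δ v ℕ.+ b))
        ≡⟨ solve 4 (λ h fs f d → (h :+ fs) :+ (con 2 :+ f :+ d) := (h :+ con 2 :+ f) :+ (fs :+ d)) refl h fs f (δ v ℕ.+ δ v ℕ.+ b) ⟩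
      (h ℕ.+ 2 ℕ.+ f) ℕ.+ (fs ℕ.+ (δ v ℕ.+ δ v ℕ.+ b)) ≡⟨ cong₂ ℕ._+_ h≡ (proj₁ (walk-delay W)) ⟩
      (p ℕ.+ p ℕ.+ b) ℕ.+ (bs ℕ.+ (δ v* ℕ.+ δ v* ℕ.+ f))
        ≡⟨ solve 5 (λ p b bs d f → (p :+ p :+ b) :+ (bs :+ (d :+ d :+ f)) := (d :+ p) :+ (d :+ p) :+ (b :+ f :+ bs)) refl p b bs (δ v*) f ⟩
      (δ v* ℕ.+ p) ℕ.+ (δ v* ℕ.+ p) ℕ.+ (b ℕ.+ f ℕ.+ bs) ∎
      where open ≡-Reasoning

-- The part of the computation of m_i that depends on the type but not on the labelling.
record StarWalk (t : DynkinType) (v : Fin (rank t)) : Set where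
  constructor starWalk
  field
    {f b}   : ℕ
    walk    : Walk t v (star t v) (path t (star t v)) f b
    balance : coxeter t ℕ.+ 2 ℕ.+ f ≡ period t (toℕ v) ℕ.+ period t (toℕ v) ℕ.+ b
    short   : f ℕ.+ b ℕ.≤ coxeter t

chain-edge : ∀ k {u w : Fin (suc k)} → toℕ w ≡ suc (toℕ u) → Edge (𝔸 k) u w
chain-edge k {u} {w} eq = edge (lemma₁ (toℕ u) (toℕ w) eq) (lemma₂ (toℕ u) (toℕ w) eq) (lemma₃ (toℕ u) (toℕ w) eq)
  where
  entry𝔸 : ℕ → ℕ → ℤ
  entry𝔸 i j = if i ℕ.≡ᵇ j then ℤ.+ 2 else offDiag (𝔸 k) i j
  lemma₁ : ∀ i j → j ≡ suc i → entry𝔸 i j ≡ -1ℤ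
  lemma₁ zero    _ refl = refl
  lemma₁ (suc i) _ refl = lemma₁ i (suc i) refl
  lemma₂ : ∀ i j → j ≡ suc i → entry𝔸 j i ≡ -1ℤ
  lemma₂ zero    _ refl = refl
  lemma₂ (suc i) _ refl = lemma₂ i (suc i) refl
  lemma₃ : ∀ i j → j ≡ suc i → (i ℕ.<ᵇ j) ≡ true
  lemma₃ zero    _ refl = refl
  lemma₃ (suc i) _ refl = lemma₃ i (suc i) refl

filterᵇ-true : ∀ {a} {X : Set a} (p : X → Bool) x xs → p x ≡ true → List.filterᵇ p (x ∷ xs) ≡ x ∷ List.filterᵇ p xs
filterᵇ-true p x xs h with p x
... | true = refl

filterᵇ-false : ∀ {a} {X : Set a} (p : X → Bool) x xs → p x ≡ false → List.filterᵇ p (x ∷ xs) ≡ List.filterᵇ p xs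
filterᵇ-false p x xs h with p x
... | false = refl

module Segments (k lo hi : ℕ) where
  V = Fin (suc k)

  within : ℕ → Bool
  within x = ((lo ℕ.≡ᵇ x) ∨ (lo ℕ.<ᵇ x)) ∧ ((x ℕ.≡ᵇ hi) ∨ (x ℕ.<ᵇ hi))

  leqᵇ : ∀ m n → m ℕ.≤ n → ((m ℕ.≡ᵇ n) ∨ (m ℕ.<ᵇ n)) ≡ true
  leqᵇ zero    zero    h = refl
  leqᵇ zero    (suc n) h = refl
  leqᵇ (suc m) (suc n) (ℕ.s≤s h) = leqᵇ m n h

  gtᵇ : ∀ m n → n ℕ.< m → ((m ℕ.≡ᵇ n) ∨ (m ℕ.<ᵇ n)) ≡ false
  gtᵇ (suc m) zero    h = refl
  gtᵇ (suc m) (suc n) (ℕ.s≤s h) = gtᵇ m n h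

  -- Taken over an arbitrary tabulated list because the tails of `allFin` are tabulations of shifted
  -- functions. In the following lemmas f enumerates s, s + 1, ..., with s beyond the segment, in
  -- it, or not yet past its start.
  segment : ∀ {n} → (Fin n → V) → List V
  segment f = List.filterᵇ (λ j → within (toℕ j)) (List.tabulate f)

  beyond : ∀ n s (f : Fin n → V) → (∀ j → toℕ (f j) ≡ s ℕ.+ toℕ j) → hi ℕ.< s → segment f ≡ []
  beyond zero    s f f≡ h = refl
  beyond (suc n) s f f≡ h = trans (filterᵇ-false (λ j → within (toℕ j)) (f zero) (List.tabulate (λ j → f (suc j))) outside)
    (beyond n (suc s) (λ j → f (suc j)) (λ j → trans (f≡ (suc j)) (ℕ.+-suc s (toℕ j))) (ℕ.<-trans h (ℕ.n<1+n s)))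
    where
    outside : within (toℕ (f zero)) ≡ false
    outside rewrite trans (f≡ zero) (ℕ.+-identityʳ s) | gtᵇ s hi h = Bool.∧-zeroʳ _

  inside : ∀ n s (f : Fin n → V) → (∀ j → toℕ (f j) ≡ s ℕ.+ toℕ j) → lo ℕ.≤ s → hi ℕ.< s ℕ.+ n →
    ∀ d {u v : V} → toℕ u ≡ s → toℕ v ≡ hi → s ℕ.+ d ≡ hi → Walk (𝔸 k) v u (segment f) d 0
  inside zero s f f≡ lo≤ hi< d u≡ v≡ eq =
    contradiction (ℕ.≤-trans (ℕ.≤-trans hi< (ℕ.≤-reflexive (ℕ.+-identityʳ s))) (ℕ.≤-trans (ℕ.m≤m+n s d) (ℕ.≤-reflexive eq))) (ℕ.<-irrefl refl)
  inside (suc n) s f f≡ lo≤ hi< d {u} {v} u≡ v≡ eq =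
    subst (λ L → Walk (𝔸 k) v u L d 0) (sym kept) (rest d eq)
    where
    f′ : Fin n → V
    f′ j = f (suc j)
    f≡′ : ∀ j → toℕ (f′ j) ≡ suc s ℕ.+ toℕ j
    f≡′ j = trans (f≡ (suc j)) (ℕ.+-suc s (toℕ j))
    f0≡ : toℕ (f zero) ≡ s
    f0≡ = trans (f≡ zero) (ℕ.+-identityʳ s)
    hit : within (toℕ (f zero)) ≡ true
    hit rewrite f0≡ | leqᵇ lo s lo≤ = leqᵇ s hi (subst (s ℕ.≤_) eq (ℕ.m≤m+n s d))
    kept : segment f ≡ u ∷ segment f′
    kept = trans (filterᵇ-true (λ j → within (toℕ j)) (f zero) (List.tabulate f′) hit)
                 (cong (_∷ segment f′) (Fin.toℕ-injective (trans f0≡ (sym u≡))))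
    rest : ∀ d → s ℕ.+ d ≡ hi → Walk (𝔸 k) v u (u ∷ segment f′) d 0
    rest zero eq with Fin.toℕ-injective (trans u≡ (trans (sym (ℕ.+-identityʳ s)) (trans eq (sym v≡))))
    ... | refl = subst (λ L → Walk (𝔸 k) u u (u ∷ L) 0 0)
      (sym (beyond n (suc s) f′ f≡′ (ℕ.s≤s (ℕ.≤-reflexive (trans (sym eq) (ℕ.+-identityʳ s)))))) stop
    rest (suc d) eq = along (chain-edge k (trans w≡ (cong suc (sym u≡))))
      (inside n (suc s) f′ f≡′ (ℕ.≤-trans lo≤ (ℕ.n≤1+n s)) (subst (hi ℕ.<_) (ℕ.+-suc s n) hi<) d {w} {v} w≡ v≡ (trans (sym (ℕ.+-suc s d)) eq))
      where
      w< : suc s ℕ.< suc k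
      w< = ℕ.≤-trans (ℕ.s≤s (ℕ.≤-trans (ℕ.≤-trans (ℕ.≤-reflexive (sym (ℕ.+-identityʳ (suc s)))) (ℕ.+-monoʳ-≤ (suc s) ℕ.z≤n))
             (ℕ.≤-reflexive (trans (sym (ℕ.+-suc s d)) eq)))) (subst (ℕ._< suc k) v≡ (Fin.toℕ<n v))
      w = fromℕ< w<
      w≡ : toℕ w ≡ suc s
      w≡ = Fin.toℕ-fromℕ< w<

  search : ∀ n s (f : Fin n → V) → (∀ j → toℕ (f j) ≡ s ℕ.+ toℕ j) → s ℕ.≤ lo → hi ℕ.< s ℕ.+ n →
    ∀ d {u v : V} → toℕ u ≡ lo → toℕ v ≡ hi → lo ℕ.+ d ≡ hi → Walk (𝔸 k) v u (segment f) d 0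
  search n s f f≡ s≤ hi< d {u} {v} u≡ v≡ eq with ℕ.m≤n⇒m<n∨m≡n s≤
  ... | inj₂ refl = inside n s f f≡ ℕ.≤-refl hi< d u≡ v≡ eq
  search zero s f f≡ s≤ hi< d {u} {v} u≡ v≡ eq | inj₁ s<lo =
    contradiction (ℕ.≤-trans (ℕ.≤-trans hi< (ℕ.≤-reflexive (ℕ.+-identityʳ s))) (ℕ.≤-trans s≤ (subst (lo ℕ.≤_) eq (ℕ.m≤m+n lo d)))) (ℕ.<-irrefl refl)
  search (suc n) s f f≡ s≤ hi< d {u} {v} u≡ v≡ eq | inj₁ s<lo = subst (λ L → Walk (𝔸 k) v u L d 0)
    (sym (filterᵇ-false (λ j → within (toℕ j)) (f zero) (List.tabulate (λ j → f (suc j))) miss))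
    (search n (suc s) (λ j → f (suc j)) (λ j → trans (f≡ (suc j)) (ℕ.+-suc s (toℕ j))) s<lo (subst (hi ℕ.<_) (ℕ.+-suc s n) hi<) d u≡ v≡ eq)
    where
    miss : within (toℕ (f zero)) ≡ false
    miss rewrite trans (f≡ zero) (ℕ.+-identityʳ s) | gtᵇ lo s s<lo = refl

starWalk-𝔸 : ∀ k v → StarWalk (𝔸 k) v
starWalk-𝔸 k v = go (ℕ.<-≤-connex (toℕ v) (toℕ x))
  where
  open ℕSolver.+-*-Solver
  x : Fin (suc k)
  x = opposite v
  v+x : toℕ v ℕ.+ toℕ x ≡ k
  v+x = trans (cong (toℕ v ℕ.+_) (Fin.opposite-prop v)) (ℕ.m+[n∸m]≡n (ℕ.s≤s⁻¹ (Fin.toℕ<n v)))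
  segment : ℕ → ℕ → List (Fin (suc k))
  segment lo hi = Segments.segment k lo hi (λ j → j)
  segment-walk : ∀ lo hi d {a b : Fin (suc k)} → toℕ a ≡ lo → toℕ b ≡ hi → lo ℕ.+ d ≡ hi → Walk (𝔸 k) b a (segment lo hi) d 0
  segment-walk lo hi d {a} {b} a≡ b≡ eq = Segments.search k lo hi (suc k) 0 (λ j → j) (λ _ → refl) ℕ.z≤n (subst (ℕ._< suc k) b≡ (Fin.toℕ<n b)) d a≡ b≡ eq
  path≡ : path (𝔸 k) x ≡ (if toℕ v ℕ.<ᵇ toℕ x then List.reverse (segment (toℕ x ℕ.⊓ toℕ v) (toℕ x ℕ.⊔ toℕ v))
                                             else segment (toℕ x ℕ.⊓ toℕ v) (toℕ x ℕ.⊔ toℕ v))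
  path≡ = cong (λ y → if toℕ y ℕ.<ᵇ toℕ x then List.reverse (segment (toℕ x ℕ.⊓ toℕ y) (toℕ x ℕ.⊔ toℕ y))
                                         else segment (toℕ x ℕ.⊓ toℕ y) (toℕ x ℕ.⊔ toℕ y)) (Fin.opposite-involutive v)
  go : toℕ v ℕ.< toℕ x ⊎ toℕ x ℕ.≤ toℕ v → StarWalk (𝔸 k) v
  go (inj₁ v<x) = starWalk {f = 0} {b = d} (subst (λ L → Walk (𝔸 k) v x L 0 d) (sym (trans path≡ lemma))
      (reverse-walk (segment-walk (toℕ v) (toℕ x) d refl refl eq))) bal (ℕ.≤-trans d≤ (ℕ.≤-trans (ℕ.n≤1+n k) (ℕ.n≤1+n (suc k))))
    where
    d = toℕ x ℕ.∸ toℕ v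
    eq : toℕ v ℕ.+ d ≡ toℕ x
    eq = ℕ.m+[n∸m]≡n (ℕ.<⇒≤ v<x)
    lemma : (if toℕ v ℕ.<ᵇ toℕ x then List.reverse (segment (toℕ x ℕ.⊓ toℕ v) (toℕ x ℕ.⊔ toℕ v))
                                 else segment (toℕ x ℕ.⊓ toℕ v) (toℕ x ℕ.⊔ toℕ v)) ≡ List.reverse (segment (toℕ v) (toℕ x))
    lemma rewrite Equivalence.to Bool.T-≡ (ℕ.<⇒<ᵇ v<x) | ℕ.m≥n⇒m⊓n≡n (ℕ.<⇒≤ v<x) | ℕ.m≥n⇒m⊔n≡m (ℕ.<⇒≤ v<x) = refl
    d≤ : d ℕ.≤ k
    d≤ = ℕ.≤-trans (ℕ.m∸n≤m (toℕ x) (toℕ v)) (ℕ.s≤s⁻¹ (Fin.toℕ<n x))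
    bal : suc (suc k) ℕ.+ 2 ℕ.+ 0 ≡ suc (suc (toℕ v)) ℕ.+ suc (suc (toℕ v)) ℕ.+ d
    bal = trans (cong (λ z → suc (suc z) ℕ.+ 2 ℕ.+ 0) (sym (trans (cong (toℕ v ℕ.+_) eq) v+x)))
      (solve 2 (λ v d → con 2 :+ (v :+ (v :+ d)) :+ con 2 :+ con 0 := (con 2 :+ v) :+ (con 2 :+ v) :+ d) refl (toℕ v) d)
  go (inj₂ x≤v) = starWalk {f = d} {b = 0} (subst (λ L → Walk (𝔸 k) v x L d 0) (sym (trans path≡ lemma))
      (segment-walk (toℕ x) (toℕ v) d refl refl eq)) bal
      (ℕ.≤-trans (ℕ.≤-reflexive (ℕ.+-identityʳ d)) (ℕ.≤-trans d≤ (ℕ.≤-trans (ℕ.n≤1+n k) (ℕ.n≤1+n (suc k)))))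
    where
    d = toℕ v ℕ.∸ toℕ x
    eq : toℕ x ℕ.+ d ≡ toℕ v
    eq = ℕ.m+[n∸m]≡n x≤v
    lemma : (if toℕ v ℕ.<ᵇ toℕ x then List.reverse (segment (toℕ x ℕ.⊓ toℕ v) (toℕ x ℕ.⊔ toℕ v))
                                 else segment (toℕ x ℕ.⊓ toℕ v) (toℕ x ℕ.⊔ toℕ v)) ≡ segment (toℕ x) (toℕ v)
    lemma with toℕ v ℕ.<ᵇ toℕ x in h
    ... | true  = contradiction (ℕ.≤-trans (ℕ.<ᵇ⇒< (toℕ v) (toℕ x) (Equivalence.from Bool.T-≡ h)) x≤v) (ℕ.<-irrefl refl)
    ... | false rewrite ℕ.m≤n⇒m⊓n≡m x≤v | ℕ.m≤n⇒m⊔n≡n x≤v = refl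
    d≤ : d ℕ.≤ k
    d≤ = ℕ.≤-trans (ℕ.m∸n≤m (toℕ v) (toℕ x)) (ℕ.s≤s⁻¹ (Fin.toℕ<n v))
    bal : suc (suc k) ℕ.+ 2 ℕ.+ d ≡ suc (suc (toℕ v)) ℕ.+ suc (suc (toℕ v)) ℕ.+ 0
    bal = begin
      suc (suc k) ℕ.+ 2 ℕ.+ d ≡⟨ cong (λ z → suc (suc z) ℕ.+ 2 ℕ.+ d) v+x ⟨
      suc (suc (toℕ v ℕ.+ toℕ x)) ℕ.+ 2 ℕ.+ d
        ≡⟨ solve 3 (λ v x d → con 2 :+ (v :+ x) :+ con 2 :+ d := (con 2 :+ v) :+ (con 2 :+ (x :+ d)) :+ con 0) refl (toℕ v) (toℕ x) d ⟩
      suc (suc (toℕ v)) ℕ.+ suc (suc (toℕ x ℕ.+ d)) ℕ.+ 0 ≡⟨ cong (λ z → suc (suc (toℕ v)) ℕ.+ suc (suc z) ℕ.+ 0) eq ⟩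
      suc (suc (toℕ v)) ℕ.+ suc (suc (toℕ v)) ℕ.+ 0 ∎
      where open ≡-Reasoning

starWalk-𝔻 : ∀ k v → StarWalk (𝔻 k) v
starWalk-𝔻 k v = go (isOdd k) refl v
  where
  open ℕSolver.+-*-Solver
  h≡ : coxeter (𝔻 k) ≡ 6 ℕ.+ (k ℕ.+ k)
  h≡ = trans (cong (ℕ._∸ 2) (solve 1 (λ k → con 2 :* (con 4 :+ k) := con 2 :+ (con 6 :+ (k :+ k))) refl k)) refl
  bal : ∀ n → coxeter (𝔻 k) ℕ.+ 2 ℕ.+ n ≡ (4 ℕ.+ k) ℕ.+ (4 ℕ.+ k) ℕ.+ n
  bal n = trans (cong (λ z → z ℕ.+ 2 ℕ.+ n) h≡)
    (solve 2 (λ k n → con 6 :+ (k :+ k) :+ con 2 :+ n := (con 4 :+ k) :+ (con 4 :+ k) :+ n) refl k n)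
  two≤ : 2 ℕ.≤ coxeter (𝔻 k)
  two≤ = subst (2 ℕ.≤_) (sym h≡) (ℕ.s≤s (ℕ.s≤s ℕ.z≤n))
  leaves : Fin (4 ℕ.+ k) → Fin (4 ℕ.+ k) → List (Fin (4 ℕ.+ k))
  leaves u w = u ∷ suc (suc zero) ∷ w ∷ []
  via : ∀ {v u L f b} → star (𝔻 k) v ≡ u → path (𝔻 k) u ≡ L → Walk (𝔻 k) v u L f b →
        Walk (𝔻 k) v (star (𝔻 k) v) (path (𝔻 k) (star (𝔻 k) v)) f b
  via {v} {u} {L} {f} {b} star≡ path≡ W = subst (λ u → Walk (𝔻 k) v u (path (𝔻 k) u) f b) (sym star≡)
                                            (subst (λ L → Walk (𝔻 k) v u L f b) (sym path≡) W)
  go : ∀ τ → isOdd k ≡ τ → ∀ v → StarWalk (𝔻 k) v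
  go true odd zero = starWalk (via {zero} (cong (λ τ → if τ then suc zero else zero) odd)
      (cong (λ τ → if τ then leaves (suc zero) zero else suc zero ∷ []) odd)
      -- Both leaves precede vertex 2, so the walk goes once along and once against the orientation
      -- and leaves the balance unchanged.
      (along {w = suc (suc zero)} (edge refl refl refl) (against (edge refl refl refl) stop))) (bal 1) two≤
  go true odd (suc zero) = starWalk (via {suc zero} (cong (λ τ → if τ then zero else suc zero) odd)
      (cong (λ τ → if τ then leaves zero (suc zero) else zero ∷ []) odd)
      (along {w = suc (suc zero)} (edge refl refl refl) (against (edge refl refl refl) stop))) (bal 1) two≤
  go false even zero = starWalk (via {zero} (cong (λ τ → if τ then suc zero else zero) even)
      (cong (λ τ → if τ then leaves zero (suc zero) else zero ∷ []) even) stop) (bal 0) ℕ.z≤n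
  go false even (suc zero) = starWalk (via {suc zero} (cong (λ τ → if τ then zero else suc zero) even)
      (cong (λ τ → if τ then leaves (suc zero) zero else suc zero ∷ []) even) stop) (bal 0) ℕ.z≤n
  go τ h (suc (suc v)) = starWalk (via {suc (suc v)} {suc (suc v)} (fixed (isOdd k) (suc (suc v))) refl stop) (bal 0) ℕ.z≤n
    where
    fixed : ∀ τ (w : Fin (4 ℕ.+ k)) → (if τ then w else w) ≡ w
    fixed true  w = refl
    fixed false w = refl

starWalks : ∀ t v → StarWalk t v
starWalks (𝔸 k) = starWalk-𝔸 k
starWalks (𝔻 k) = starWalk-𝔻 k
starWalks (𝔹 k) v = starWalk stop (solve 1 (λ k → con 2 :* (con 2 :+ k) :+ con 2 :+ con 0 := (con 3 :+ k) :+ (con 3 :+ k) :+ con 0) refl k) ℕ.z≤n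
  where open ℕSolver.+-*-Solver
starWalks (ℂ k) v = starWalk stop (solve 1 (λ k → con 2 :* (con 2 :+ k) :+ con 2 :+ con 0 := (con 3 :+ k) :+ (con 3 :+ k) :+ con 0) refl k) ℕ.z≤n
  where open ℕSolver.+-*-Solver
starWalks E₆ = go
  where
  e₃₄ : Edge E₆ (# 3) (# 4)
  e₃₄ = edge refl refl refl
  e₄₅ : Edge E₆ (# 4) (# 5)
  e₄₅ = edge refl refl refl
  e₃₂ : Edge E₆ (# 3) (# 2)
  e₃₂ = edge refl refl refl
  e₂₀ : Edge E₆ (# 2) (# 0)
  e₂₀ = edge refl refl refl
  go : ∀ v → StarWalk E₆ v
  go zero = starWalk (against e₄₅ (against e₃₄ (along e₃₂ (along e₂₀ stop)))) refl (ℕ.m≤m+n 4 8)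
  go (suc zero) = starWalk stop refl ℕ.z≤n
  go (suc (suc zero)) = starWalk (against e₃₄ (along e₃₂ stop)) refl (ℕ.m≤m+n 2 10)
  go (suc (suc (suc zero))) = starWalk stop refl ℕ.z≤n
  go (suc (suc (suc (suc zero)))) = starWalk (against e₃₂ (along e₃₄ stop)) refl (ℕ.m≤m+n 2 10)
  go (suc (suc (suc (suc (suc zero))))) = starWalk (against e₂₀ (against e₃₂ (along e₃₄ (along e₄₅ stop)))) refl (ℕ.m≤m+n 4 8)
starWalks E₇ v = starWalk stop refl ℕ.z≤n
starWalks E₈ v = starWalk stop refl ℕ.z≤n
starWalks F₄ v = starWalk stop refl ℕ.z≤n
starWalks G₂ v = starWalk stop refl ℕ.z≤n

theorem5p2 : ∀ {c ℓ} {r : ℕ} (A : Matrix r) → IsCartanMatrix A → Indecomposable A → FiniteType A →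
    (t : DynkinType) (e : Fin r ↔ Fin (rank t)) →
    (∀ i j → A i j ≡ stdCartan t (Inverse.to e i) (Inverse.to e j)) →
    (K : SemiField c) (S : SemiField.Carrier K → Set ℓ) → IsSubSemiring K S →
    (∀ f → SValued K S f → IsFrieze K A f → Invariant (F A t e) f) ×
    (∀ k → SValued K S k → IsYFrieze K A k → Invariant (F A t e) k)
theorem5p2 A _ _ _ t e A≡ K S _ =
  (λ f _ frieze → reoriented-invariant K (λ x → x) (λ x → 1# + x) f frieze (friezeBase K) shift) ,
  (λ k _ frieze → reoriented-invariant K (λ x → 1# + x) (λ x → x) k frieze (Y-friezeBase K) shift)
  where
  open SemiField K using (1#; _+_)
  open Relabelled A t e A≡
  shift : ∀ v → suc (mᵢ A t e (from (star t v)) ℕ.+ δ v) ≡ δ (star t v) ℕ.+ period t (toℕ v)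
  shift v = Counting.mᵢ-shift A t e A≡ v walk balance short
    where open StarWalk (starWalks t v)
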